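{- Every left-linear term rewrite system (TRS) $\mathcal{R}$ that is hot-decreasing is confluent.
   Context: **TRSs.** A TRS is a set of rules $\ell\to r$ between first-order terms, with $\ell$ not a variable and every variable of $r$ occurring in $\ell$. It is left-linear if no variable occurs more than once in any left-hand side. A TRS is confluent if its rewrite relation $\to_{\mathcal R}$ is. **Multisteps.** For each rule $\varrho:\ell\to r$ of $\mathcal R$ let $\varrho$ also denote a fresh rule symbol whose arguments correspond to the variables $\vec x$ of $\ell$, so that we write $\varrho(\vec x):\ell\to r$. A multistep $\Phi$ of $\mathcal R$ is (given by) a proofterm, i.e. a term over function symbols, rule symbols and variables. Its source (target) is the term obtained by replacing recursively each $\varrho(\vec t)$ by $\ell[\vec x:=\vec t]$ (by $r[\vec x:=\vec t]$). We write $\Phi: t \multimap s$ if $\Phi$ has source $t$ and target $s$. A multistep without rule symbols is empty; a (single) step is a multistep with exactly one occurrence of a rule symbol. **Critical peaks.** Let $\varrho:\ell\to r$ and $\theta: g\to d$ be rules of $\mathcal R$, renamed to have no variables in common (possibly variants of the same rule), $p$ a non-variable position of $\ell$ and $\sigma$ a most general unifier of $\ell|_p$ and $g$. The peak $r\sigma \leftarrow \ell\sigma \to (\ell[d]_p)\sigma$, with $\varrho$ contracted at the root on the left and $\theta$ at position $p$ on the right, is a critical peak, and so is its mirror image. Overlaps of a rule with itself at the root are not excluded. A critical peak $s\leftarrow t\to u$ is outer–inner if the redex position of the left step $t\to s$ is a strict prefix of that of the right step $t\to u$; inner–outer in the mirrored case; overlay if the positions are equal. **Hot-labelling.** Let $\mathcal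 C\subseteq\mathcal R$ be a terminating subsystem and let a labelling of the rules in $\mathcal R\setminus\mathcal C$ by elements of a set equipped with a well-founded strict order $\succ$ be given. The hot-labelling assigns to a multistep $\Phi:t\multimap s$ of $\mathcal R$: - the term $t$, if $\Phi$ contains $\mathcal C$-rules only (in particular if $\Phi$ is empty); - otherwise, the (finite) set of $\succ$-maximal elements among the labels of the $\mathcal R\setminus\mathcal C$-rules occurring in $\Phi$. The hot-order $\mathring\succ$ on such labels relates terms by $\to_{\mathcal C}^+$, sets by the multiset extension $\succ_{\mathsf{mul}}$ of $\succ$, and every set is greater than every term. It is a well-founded order; $\mathring\succeq$ is its reflexive closure. Write $\to_\alpha$ for the relation of multisteps with hot-label $\alpha$, $\to_J=\bigcup_{\alpha\in J}\to_\alpha$ for a set $J$ of labels, $\leftrightarrow^*_J$ for convertibility by $\to_J$, and $\to_\alpha^=$ for the reflexive closure. Put ${\downarrow}\alpha=\{\beta\mid\alpha\mathrel{\mathring\succ}\beta\}$ and ${\downarrow}(\alpha,\beta)={\downarrow}\alpha\cup{\downarrow}\beta$. **Decreasingness.** A peak $b\leftarrow_\alpha a\to_\beta c$ is decreasing (for the hot-labelling) if $$b\ \leftrightarrow^*_{{\downarrow}\alpha}\cdot\to^=_\beta\cdot\leftrightarrow^*_{{\downarrow}(\alpha,\beta)}\cdot{}^{=}_{\ \alpha}{\leftarrow}\cdot\leftrightarrow^*_{{\downarrow}\beta}\ c .$$ **Hot-decreasing TRS.** $\mathcal R$ is hot-decreasing if there exist a terminating $\mathcal C\subseteq\mathcal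 R$, and a labelling of $\mathcal R\setminus\mathcal C$ into a well-founded strict order $\succ$, such that all critical peaks of $\mathcal R$ are decreasing for the resulting hot-labelling and, moreover, each outer–inner critical peak $s\leftarrow t\to u$ in which the outer step $t\to s$ has label $\alpha$ is decreasing by a conversion of the shape $s\leftrightarrow^*_{{\downarrow}\alpha} w \leftarrow_{\gamma} u$ for some term $w$ and some label $\gamma$ with $\alpha\mathrel{\mathring\succeq}\gamma$, i.e. the last part is a single multistep $u\multimap w$ with label $\gamma$. -}

module Defs where

open import Data.Fin.Base using (Fin; zero; suc)
open import Data.List.Base using (List; []; _++_)
open import Data.List.Membership.Propositional using (_∈_)
open import Data.List.Relation.Binary.Permutation.Propositional using (_↭_)
open import Data.List.Relation.Unary.Unique.Propositional using (Unique)
open import Data.Nat.Base using (ℕ; suc)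
open import Data.Product.Base using (Σ; ∃; ∃-syntax; _×_; _,_; proj₁)
open import Data.Sum.Base using (_⊎_; inj₁; inj₂; [_,_]′)
open import Data.Vec.Base using (Vec; []; _∷_; lookup; tabulate; _[_]≔_)
open import Data.Vec.Properties using (lookup∘tabulate)
open import Function.Base using (flip; _∘_)
open import Function.Bundles using (_⇔_)
open import Induction.WellFounded using (WellFounded)
open import Level using (0ℓ)
open import Relation.Binary.Construct.Closure.Equivalence using (EqClosure)
open import Relation.Binary.Construct.Closure.Reflexive using (ReflClosure)
open import Relation.Binary.Construct.Closure.Transitive using (TransClosure)
open import Relation.Binary.Construct.Composition using () renaming (_;_ to _⨾_)
open import Relation.Binary.Core using (Rel)
open import Relation.Binary.PropositionalEquality
  using (_≡_; _≢_; refl; sym; trans; cong; cong₂; module ≡-Reasoning)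
open import Relation.Binary.Rewriting using (StronglyNormalizing)
open import Relation.Binary.Structures using (IsStrictPartialOrder)
open import Relation.Nullary.Negation.Core using (¬_)
open import Relation.Unary using (Pred; _∪_)

------------------------------------------------------------------------
-- First-order terms

record Signature : Set₁ where
  field
    Symbol : Set
    arity  : Symbol → ℕ

open Signature public

data Term (S : Signature) (V : Set) : Set where
  var : V → Term S V
  fn  : (f : Symbol S) → Vec (Term S V) (arity S f) → Term S V

module _ {S : Signature} where

  infixl 8 _·_ _·*_

  mutual
    _·_ : {V W : Set} → Term S V → (V → Term S W) → Term S W
    var x   · σ = σ x
    fn f ts · σ = fn f (ts ·* σ)

    _·*_ : {V W : Set} {n : ℕ} → Vec (Term S V) n → (V → Term S W) → Vec (Term S W) n
    []       ·* σ = []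
    (t ∷ ts) ·* σ = t · σ ∷ ts ·* σ

  data Pos {V : Set} : Term S V → Set where
    root : ∀ {t} → Pos t
    arg  : ∀ {f ts} (i : Fin (arity S f)) → Pos (lookup ts i) → Pos (fn f ts)

  infix 9 _∣_

  _∣_ : {V : Set} (t : Term S V) → Pos t → Term S V
  t       ∣ root    = t
  fn f ts ∣ arg i p = lookup ts i ∣ p

  replace : {V : Set} (t : Term S V) → Pos t → Term S V → Term S V
  replace t         root      u = u
  replace (fn f ts) (arg i p) u = fn f (ts [ i ]≔ replace (lookup ts i) p u)

  Linear : {V : Set} → Term S V → Set
  Linear t = ∀ x (p q : Pos t) → t ∣ p ≡ var x → t ∣ q ≡ var x → p ≡ q

  Unifier : {V : Set} → (V → Term S ℕ) → Term S V → Term S V → Set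
  Unifier σ s t = s · σ ≡ t · σ

  record MGU {V : Set} (σ : V → Term S ℕ) (s t : Term S V) : Set where
    field
      unifies     : Unifier σ s t
      mostGeneral : ∀ τ → Unifier τ s t → ∃ λ δ → ∀ x → τ x ≡ σ x · δ

  mutual
    ·-cong : {V W : Set} (t : Term S V) {σ τ : V → Term S W} →
             (∀ x → σ x ≡ τ x) → t · σ ≡ t · τ
    ·-cong (var x)   σ≗τ = σ≗τ x
    ·-cong (fn f ts) σ≗τ = cong (fn f) (·*-cong ts σ≗τ)

    ·*-cong : {V W : Set} {n : ℕ} (ts : Vec (Term S V) n) {σ τ : V → Term S W} →
              (∀ x → σ x ≡ τ x) → ts ·* σ ≡ ts ·* τ
    ·*-cong []       σ≗τ = refl
    ·*-cong (t ∷ ts) σ≗τ = cong₂ _∷_ (·-cong t σ≗τ) (·*-cong ts σ≗τ)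

  mutual
    ·-assoc : {U V W : Set} (t : Term S U) (σ : U → Term S V) (τ : V → Term S W) →
              t · σ · τ ≡ t · (λ x → σ x · τ)
    ·-assoc (var x)   σ τ = refl
    ·-assoc (fn f ts) σ τ = cong (fn f) (·*-assoc ts σ τ)

    ·*-assoc : {U V W : Set} {n : ℕ} (ts : Vec (Term S U) n)
               (σ : U → Term S V) (τ : V → Term S W) →
               ts ·* σ ·* τ ≡ ts ·* (λ x → σ x · τ)
    ·*-assoc []       σ τ = refl
    ·*-assoc (t ∷ ts) σ τ = cong₂ _∷_ (·-assoc t σ τ) (·*-assoc ts σ τ)

  lookup-·* : {V W : Set} {n : ℕ} (ts : Vec (Term S V) n) (σ : V → Term S W) (i : Fin n) →
              lookup (ts ·* σ) i ≡ lookup ts i · σ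
  lookup-·* (t ∷ ts) σ zero    = refl
  lookup-·* (t ∷ ts) σ (suc i) = lookup-·* ts σ i

  update-·* : {V W : Set} {n : ℕ} (ts : Vec (Term S V) n) (i : Fin n) (u : Term S V)
              (σ : V → Term S W) →
              u · σ ≡ lookup ts i · σ → (ts [ i ]≔ u) ·* σ ≡ ts ·* σ
  update-·* (t ∷ ts) zero    u σ eq = cong (_∷ ts ·* σ) eq
  update-·* (t ∷ ts) (suc i) u σ eq = cong (t · σ ∷_) (update-·* ts i u σ eq)

  replace-· : {V W : Set} (t : Term S V) (p : Pos t) (u : Term S V) (σ : V → Term S W) →
              t ∣ p · σ ≡ u · σ → replace t p u · σ ≡ t · σ
  replace-· t         root      u σ eq = sym eq
  replace-· (fn f ts) (arg i p) u σ eq =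
    cong (fn f) (update-·* ts i _ σ (replace-· (lookup ts i) p u σ eq))

------------------------------------------------------------------------
-- Term rewrite systems

-- A set of rules is given as a family indexed by the rule symbols.  The
-- variables of the rule ρ are named by Fin (vars ρ); as all of them occur
-- in lhs ρ, they are exactly the variables of the left-hand side, and in
-- particular every variable of rhs ρ occurs in lhs ρ.
record TRS (S : Signature) : Set₁ where
  field
    Rule    : Set
    vars    : Rule → ℕ
    lhs     : (ρ : Rule) → Term S (Fin (vars ρ))
    rhs     : (ρ : Rule) → Term S (Fin (vars ρ))
    non-var : ∀ ρ x → lhs ρ ≢ var x
    occurs  : ∀ ρ x → ∃ λ p → lhs ρ ∣ p ≡ var x

open TRS public

LeftLinear : {S : Signature} → TRS S → Set
LeftLinear R = ∀ ρ → Linear (lhs R ρ)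

data Step {S : Signature} (R : TRS S) : Rel (Term S ℕ) 0ℓ where
  contract : ∀ ρ (σ : Fin (vars R ρ) → Term S ℕ) → Step R (lhs R ρ · σ) (rhs R ρ · σ)
  inside   : ∀ f ts i {u} → Step R (lookup ts i) u → Step R (fn f ts) (fn f (ts [ i ]≔ u))

subsystem : {S : Signature} (R : TRS S) → Pred (Rule R) 0ℓ → TRS S
subsystem R C = record
  { Rule    = ∃ C
  ; vars    = vars R ∘ proj₁
  ; lhs     = lhs R ∘ proj₁
  ; rhs     = rhs R ∘ proj₁
  ; non-var = non-var R ∘ proj₁
  ; occurs  = occurs R ∘ proj₁
  }

------------------------------------------------------------------------
-- Multisteps

withRules : (S : Signature) → TRS S → Signature
withRules S R = record
  { Symbol = Symbol S ⊎ Rule R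
  ; arity  = [ arity S , vars R ]′
  }

module _ {S : Signature} (R : TRS S) where

  Proofterm : Set → Set
  Proofterm = Term (withRules S R)

  mutual
    ⌈_⌉ : {V : Set} → Term S V → Proofterm V
    ⌈ var x ⌉   = var x
    ⌈ fn f ts ⌉ = fn (inj₁ f) ⌈ ts ⌉*

    ⌈_⌉* : {V : Set} {n : ℕ} → Vec (Term S V) n → Vec (Proofterm V) n
    ⌈ [] ⌉*     = []
    ⌈ t ∷ ts ⌉* = ⌈ t ⌉ ∷ ⌈ ts ⌉*

  mutual
    unfold : {V : Set} → ((ρ : Rule R) → Term S (Fin (vars R ρ))) →
             Proofterm V → Term S V
    unfold side (var x)          = var x
    unfold side (fn (inj₁ f) Φs) = fn f (unfold* side Φs)
    unfold side (fn (inj₂ ρ) Φs) = side ρ · lookup (unfold* side Φs)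

    unfold* : {V : Set} {n : ℕ} → ((ρ : Rule R) → Term S (Fin (vars R ρ))) →
              Vec (Proofterm V) n → Vec (Term S V) n
    unfold* side []       = []
    unfold* side (Φ ∷ Φs) = unfold side Φ ∷ unfold* side Φs

  src tgt : {V : Set} → Proofterm V → Term S V
  src = unfold (lhs R)
  tgt = unfold (rhs R)

  -- t [ Φ ]ₚ for a proofterm Φ and a position p of the term t.
  plug : {V : Set} (t : Term S V) → Pos t → Proofterm V → Proofterm V
  plug t         root      Φ = Φ
  plug (fn f ts) (arg i p) Φ = fn (inj₁ f) (⌈ ts ⌉* [ i ]≔ plug (lookup ts i) p Φ)

  RuleIn : {V : Set} → Rule R → Proofterm V → Set
  RuleIn ρ Φ = ∃ λ p → ∃ λ Φs → Φ ∣ p ≡ fn (inj₂ ρ) Φs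

  module _ (side : (ρ : Rule R) → Term S (Fin (vars R ρ))) where

    mutual
      unfold-⌈⌉ : {V : Set} (t : Term S V) → unfold side ⌈ t ⌉ ≡ t
      unfold-⌈⌉ (var x)   = refl
      unfold-⌈⌉ (fn f ts) = cong (fn f) (unfold*-⌈⌉* ts)

      unfold*-⌈⌉* : {V : Set} {n : ℕ} (ts : Vec (Term S V) n) → unfold* side ⌈ ts ⌉* ≡ ts
      unfold*-⌈⌉* []       = refl
      unfold*-⌈⌉* (t ∷ ts) = cong₂ _∷_ (unfold-⌈⌉ t) (unfold*-⌈⌉* ts)

    mutual
      unfold-· : {V W : Set} (Φ : Proofterm V) (σ : V → Proofterm W) →
                 unfold side (Φ · σ) ≡ unfold side Φ · (unfold side ∘ σ)
      unfold-· (var x)          σ = refl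
      unfold-· (fn (inj₁ f) Φs) σ = cong (fn f) (unfold*-·* Φs σ)
      unfold-· (fn (inj₂ ρ) Φs) σ = begin
        side ρ · lookup (unfold* side (Φs ·* σ))
          ≡⟨ cong (λ ts → side ρ · lookup ts) (unfold*-·* Φs σ) ⟩
        side ρ · lookup (unfold* side Φs ·* (unfold side ∘ σ))
          ≡⟨ ·-cong (side ρ) (lookup-·* (unfold* side Φs) (unfold side ∘ σ)) ⟩
        side ρ · (λ x → lookup (unfold* side Φs) x · (unfold side ∘ σ))
          ≡⟨ ·-assoc (side ρ) (lookup (unfold* side Φs)) (unfold side ∘ σ) ⟨
        side ρ · lookup (unfold* side Φs) · (unfold side ∘ σ) ∎
        where open ≡-Reasoning

      unfold*-·* : {V W : Set} {n : ℕ} (Φs : Vec (Proofterm V) n) (σ : V → Proofterm W) →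
                   unfold* side (Φs ·* σ) ≡ unfold* side Φs ·* (unfold side ∘ σ)
      unfold*-·* []       σ = refl
      unfold*-·* (Φ ∷ Φs) σ = cong₂ _∷_ (unfold-· Φ σ) (unfold*-·* Φs σ)

    unfold-·⌈⌉ : {V W : Set} (Φ : Proofterm V) (σ : V → Term S W) →
                 unfold side (Φ · (⌈_⌉ ∘ σ)) ≡ unfold side Φ · σ
    unfold-·⌈⌉ Φ σ = trans (unfold-· Φ (⌈_⌉ ∘ σ)) (·-cong (unfold side Φ) (unfold-⌈⌉ ∘ σ))

    unfold*-update : {V : Set} {n : ℕ} (ts : Vec (Term S V) n) (i : Fin n) (Φ : Proofterm V) →
                     unfold* side (⌈ ts ⌉* [ i ]≔ Φ) ≡ ts [ i ]≔ unfold side Φ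
    unfold*-update (t ∷ ts) zero    Φ = cong (unfold side Φ ∷_) (unfold*-⌈⌉* ts)
    unfold*-update (t ∷ ts) (suc i) Φ = cong₂ _∷_ (unfold-⌈⌉ t) (unfold*-update ts i Φ)

    unfold-plug : {V : Set} (t : Term S V) (p : Pos t) (Φ : Proofterm V) →
                  unfold side (plug t p Φ) ≡ replace t p (unfold side Φ)
    unfold-plug t         root      Φ = refl
    unfold-plug (fn f ts) (arg i p) Φ = cong (fn f)
      (trans (unfold*-update ts i _) (cong (ts [ i ]≔_) (unfold-plug (lookup ts i) p Φ)))

    lookup-unfold* : {V : Set} {n : ℕ} (Φs : Vec (Proofterm V) n) (i : Fin n) →
                     lookup (unfold* side Φs) i ≡ unfold side (lookup Φs i)
    lookup-unfold* (Φ ∷ Φs) zero    = refl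
    lookup-unfold* (Φ ∷ Φs) (suc i) = lookup-unfold* Φs i

    unfold-rule : {V : Set} (ρ : Rule R) (ι : Fin (vars R ρ) → V) →
                  unfold side (fn (inj₂ ρ) (tabulate (var ∘ ι))) ≡ side ρ · (var ∘ ι)
    unfold-rule ρ ι = ·-cong (side ρ) λ x →
      trans (lookup-unfold* (tabulate (var ∘ ι)) x) (cong (unfold side) (lookup∘tabulate (var ∘ ι) x))

record Multistep {S : Signature} (R : TRS S) (t s : Term S ℕ) : Set where
  field
    proofterm : Proofterm R ℕ
    source    : src R proofterm ≡ t
    target    : tgt R proofterm ≡ s

open Multistep public

------------------------------------------------------------------------
-- Critical peaks

-- The two rules are renamed apart by the two injections into the
-- disjoint union of their sets of variables.
record Overlap {S : Signature} (R : TRS S) : Set where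
  field
    ρ θ : Rule R

  Var : Set
  Var = Fin (vars R ρ) ⊎ Fin (vars R θ)

  ℓ : Term S Var
  ℓ = lhs R ρ · (var ∘ inj₁)

  r : Term S Var
  r = rhs R ρ · (var ∘ inj₁)

  g : Term S Var
  g = lhs R θ · (var ∘ inj₂)

  d : Term S Var
  d = rhs R θ · (var ∘ inj₂)

  field
    p      : Pos ℓ
    nonVar : ∀ x → ℓ ∣ p ≢ var x
    σ      : Var → Term S ℕ
    mgu    : MGU σ (ℓ ∣ p) g

  ρ⟨x⟩ θ⟨y⟩ : Proofterm R Var
  ρ⟨x⟩ = fn (inj₂ ρ) (tabulate (var ∘ inj₁))
  θ⟨y⟩ = fn (inj₂ θ) (tabulate (var ∘ inj₂))

  rootStep : Multistep R (ℓ · σ) (r · σ)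
  rootStep = record
    { proofterm = ρ⟨x⟩ · (⌈_⌉ R ∘ σ)
    ; source    = trans (unfold-·⌈⌉ R (lhs R) ρ⟨x⟩ σ) (cong (_· σ) (unfold-rule R (lhs R) ρ inj₁))
    ; target    = trans (unfold-·⌈⌉ R (rhs R) ρ⟨x⟩ σ) (cong (_· σ) (unfold-rule R (rhs R) ρ inj₁))
    }

  pStep : Multistep R (ℓ · σ) (replace ℓ p d · σ)
  pStep = record
    { proofterm = plug R ℓ p θ⟨y⟩ · (⌈_⌉ R ∘ σ)
    ; source    = trans (plugged (lhs R)) (replace-· ℓ p g σ (MGU.unifies mgu))
    ; target    = plugged (rhs R)
    }
    where
    plugged : (side : (ρ : Rule R) → Term S (Fin (vars R ρ))) →
              unfold R side (plug R ℓ p θ⟨y⟩ · (⌈_⌉ R ∘ σ)) ≡ replace ℓ p (side θ · (var ∘ inj₂)) · σ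
    plugged side = trans (unfold-·⌈⌉ R side (plug R ℓ p θ⟨y⟩) σ)
      (cong (_· σ) (trans (unfold-plug R side ℓ p θ⟨y⟩)
                          (cong (replace ℓ p) (unfold-rule R side θ inj₂))))

data CriticalPeak {S : Signature} (R : TRS S) :
       {s t u : Term S ℕ} → Multistep R t s → Multistep R t u → Set where
  peak   : (o : Overlap R) → CriticalPeak R (Overlap.rootStep o) (Overlap.pStep o)
  mirror : (o : Overlap R) → CriticalPeak R (Overlap.pStep o) (Overlap.rootStep o)

-- The redex positions of peak o are root and p, so it is outer–inner iff p
-- is not root; mirror o never is.
data OuterInner {S : Signature} (R : TRS S) :
       {s t u : Term S ℕ} → Multistep R t s → Multistep R t u → Set where
  outer-inner : (o : Overlap R) → Overlap.p o ≢ root →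
                OuterInner R (Overlap.rootStep o) (Overlap.pStep o)

------------------------------------------------------------------------
-- The hot-labelling

-- Dershowitz–Manna multiset extension; lists up to _↭_ are finite multisets.
MultisetExtension : {L : Set} → Rel L 0ℓ → Rel (List L) 0ℓ
MultisetExtension _≻_ M N = ∃[ X ] ∃[ Y ] ∃[ Z ]
  M ↭ Z ++ X × N ↭ Z ++ Y × X ≢ [] ×
  (∀ {y} → y ∈ Y → ∃[ x ] (x ∈ X × x ≻ y))

-- The irrelevant argument of label makes the label of a rule outside C
-- independent of the proof that it is outside C.
record RuleLabelling {S : Signature} (R : TRS S) : Set₁ where
  infix 4 _≻_
  field
    C                    : Pred (Rule R) 0ℓ
    C-terminating        : StronglyNormalizing (Step (subsystem R C))
    L                    : Set
    _≻_                  : Rel L 0ℓ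
    isStrictPartialOrder : IsStrictPartialOrder _≡_ _≻_
    ≻-wellFounded        : WellFounded (flip _≻_)
    label                : (ρ : Rule R) → .(¬ C ρ) → L

module Hot {S : Signature} {R : TRS S} (lab : RuleLabelling R) where
  open RuleLabelling lab

  -- A finite set is a list up to _↭_; that the list has no duplicates is
  -- part of _HasLabel_.
  data HotLabel : Set where
    term : Term S ℕ → HotLabel
    set  : List L → HotLabel

  infix 4 _≈_ _≻°_ _⪰°_ _HasLabel_

  data _≈_ : Rel HotLabel 0ℓ where
    term : ∀ {t s} → t ≡ s → term t ≈ term s
    set  : ∀ {M N} → M ↭ N → set M ≈ set N

  data _≻°_ : Rel HotLabel 0ℓ where
    term     : ∀ {t s} → TransClosure (Step (subsystem R C)) t s → term t ≻° term s
    set      : ∀ {M N} → MultisetExtension _≻_ M N → set M ≻° set N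
    set≻term : ∀ {M t} → set M ≻° term t

  _⪰°_ : Rel HotLabel 0ℓ
  α ⪰° β = α ≻° β ⊎ α ≈ β

  module _ {t s : Term S ℕ} (Φ : Multistep R t s) where

    LabelIn : L → Set
    LabelIn a = ∃[ ρ ] Σ (¬ C ρ) λ ρ∉C → RuleIn R ρ (proofterm Φ) × a ≡ label ρ ρ∉C

    MaximalLabelIn : L → Set
    MaximalLabelIn a = LabelIn a × (∀ {b} → LabelIn b → ¬ b ≻ a)

    OnlyC : Set
    OnlyC = ∀ ρ → RuleIn R ρ (proofterm Φ) → C ρ

  data _HasLabel_ {t s : Term S ℕ} (Φ : Multistep R t s) : HotLabel → Set where
    term : OnlyC Φ → Φ HasLabel term t
    set  : ∀ {M} → ¬ OnlyC Φ → Unique M → (∀ a → a ∈ M ⇔ MaximalLabelIn Φ a) →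
           Φ HasLabel set M

  Labelled : HotLabel → Rel (Term S ℕ) 0ℓ
  Labelled α t s = Σ (Multistep R t s) (_HasLabel α)

  LabelledBy : Pred HotLabel 0ℓ → Rel (Term S ℕ) 0ℓ
  LabelledBy J t s = ∃[ α ] (J α × Labelled α t s)

  ↓_ : HotLabel → Pred HotLabel 0ℓ
  (↓ α) β = α ≻° β

  Conversion : Pred HotLabel 0ℓ → Rel (Term S ℕ) 0ℓ
  Conversion J = EqClosure (LabelledBy J)

  DecreasingConversion : (α β : HotLabel) → Rel (Term S ℕ) 0ℓ
  DecreasingConversion α β =
    Conversion (↓ α) ⨾ ReflClosure (Labelled β) ⨾ Conversion (↓ α ∪ ↓ β) ⨾
    flip (ReflClosure (Labelled α)) ⨾ Conversion (↓ β)

  OuterInnerConversion : (α : HotLabel) → Rel (Term S ℕ) 0ℓ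
  OuterInnerConversion α =
    Conversion (↓ α) ⨾ flip (LabelledBy (α ⪰°_))

  AllCriticalPeaksDecreasing : Set
  AllCriticalPeaksDecreasing =
    ∀ {s t u} {Φ : Multistep R t s} {Ψ : Multistep R t u} → CriticalPeak R Φ Ψ →
    ∀ α β → Φ HasLabel α → Ψ HasLabel β → DecreasingConversion α β s u

  OuterInnerCondition : Set
  OuterInnerCondition =
    ∀ {s t u} {Φ : Multistep R t s} {Ψ : Multistep R t u} → OuterInner R Φ Ψ →
    ∀ α → Φ HasLabel α → OuterInnerConversion α s u

record HotDecreasing {S : Signature} (R : TRS S) : Set₁ where
  field
    labelling           : RuleLabelling R
    decreasing          : Hot.AllCriticalPeaksDecreasing labelling
    outerInnerCondition : Hot.OuterInnerCondition labelling

{-# OPTIONS --safe #-}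

-- The labels are replaced by their ranks in the hot-order, which are totally
-- preordered; thus a single rank a bounds all labels of a multistep.  By
-- decreasing diagrams it suffices that every peak of multisteps Φ, Ψ is
-- decreasing.  This is shown by induction on the positions that belong to the
-- patterns of redexes of both Φ and Ψ.  Without such positions the peak is
-- orthogonal.  Otherwise, consider a deepest overlap.  If it is an overlay, Φ
-- and Ψ are composed of a peak of contexts with fewer shared positions, an
-- overlay critical peak, and orthogonal peaks in its substitution, and decreasing
-- peaks are closed under composition.  If a redex φ of Φ overlaps a redex ψ of Ψ
-- strictly beneath it, then ψ is contracted in Ψ, and φ is replaced in Φ by the
-- multistep that closes the critical peak.  The target of Ψ stays the same, that
-- of Φ changes by a conversion below the label of Φ, and at least one shared
-- position disappears while none is created.

module Submission where

open import Axiom.ExcludedMiddle using (ExcludedMiddle)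
open import Level using (0ℓ)
open import Relation.Binary.Rewriting using (Confluent)
open import Defs

open import Data.Empty using (⊥; ⊥-elim)
open import Data.Fin.Base using (Fin; zero; suc; toℕ; join; splitAt)
open import Data.Fin.Properties
  using (toℕ-injective; splitAt-join; 0≢1+n) renaming (_≟_ to _≟ᶠ_; suc-injective to sucᶠ-injective)
open import Data.List.Base as List using (List; []; _∷_; _++_; length; filter)
open import Data.List.Membership.Propositional using (_∈_)
open import Data.List.Membership.Propositional.Properties
  using (∈-concat⁺′; ∈-tabulate⁺; ∈-map⁺; ∈-filter⁺)
open import Data.List.Properties
  using (++-assoc; ++-identityʳ; ++-cancelˡ; ++-monoid; ∷-injective; length-++; filter-notAll)
open import Data.List.Relation.Binary.Permutation.Propositional using (_↭_; ↭-sym)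
open import Data.List.Relation.Binary.Permutation.Propositional.Properties using (∈-resp-↭; ↭-length)
open import Data.List.Relation.Unary.All as All using (All; []; _∷_)
open import Data.List.Relation.Unary.All.Properties using (++⁺; ++⁻ˡ; ++⁻ʳ)
open import Data.List.Relation.Unary.AllPairs using ([]; _∷_)
open import Data.List.Relation.Unary.Any as Any using (here; there)
open import Data.Nat.Base using (ℕ; zero; suc; _+_; _≤_; _<_; z≤n; s≤s; s≤s⁻¹)
open import Data.Nat.Properties
  using (≤-refl; ≤-trans; ≤-reflexive; ≰⇒>; 1+n≰n; +-monoˡ-≤; +-monoʳ-≤; m≤m+n; m≤n+m;
         +-suc; +-assoc; +-identityʳ; module ≤-Reasoning)
open import Data.Nat.Solver using (module +-*-Solver)
open import Data.Product.Base using (Σ; ∃; ∃₂; _×_; _,_; proj₁; proj₂)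
open import Data.Sum.Base as Sum using (_⊎_; inj₁; inj₂; [_,_]′)
open import Data.Unit.Base using (⊤; tt)
open import Data.Vec.Base using (Vec; []; _∷_; lookup; tabulate; _[_]≔_)
open import Data.Vec.Properties
  using (lookup∘update; lookup∘update′; []≔-lookup; []≔-idempotent; lookup∘tabulate; tabulate∘lookup;
         tabulate-cong; ∷-injectiveˡ; ∷-injectiveʳ)
open import Function.Base using (_∘_; flip; id)
open import Function.Bundles using (mk⇔; module Equivalence)
open import Induction.WellFounded using (WellFounded; Acc; acc)
open import Relation.Binary.Construct.Closure.Equivalence as Eq using (EqClosure)
open import Relation.Binary.Construct.Closure.Reflexive as Refl using (ReflClosure)
open import Relation.Binary.Construct.Closure.ReflexiveTransitive as Star using (Star; ε; _◅_; _◅◅_)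
open import Relation.Binary.Construct.Closure.Symmetric using (fwd; bwd)
open import Relation.Binary.Construct.Closure.Transitive as Trans using (TransClosure; [_]; _∷_; _∷ʳ_)
open import Relation.Binary.Core using (Rel)
open import Relation.Binary.PropositionalEquality
  using (_≡_; _≢_; refl; sym; trans; cong; cong₂; subst; subst₂; module ≡-Reasoning)
open import Relation.Binary.Structures using (module IsStrictPartialOrder)
open import Relation.Nullary.Decidable.Core using (Dec; yes; no)
open import Relation.Nullary.Negation.Core using (¬_)

-- The obstacle is that a multistep of `C`-rules is labelled by its source, which changes under
-- contexts and substitutions, whereas labels from `L` do not. A peak is therefore decreasing
-- relative to its source `t`, and conversions below a term label record that the sources of their
-- steps are reachable from `t` by `C`-steps. This makes composition possible: the single steps of
-- all components merge into one multistep, while the conversions are performed one component after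
-- the other. The outer-inner condition is used in two ways. Its last part is a single multistep, so
-- it can take the place of the outer redex inside Φ and the result is again one multistep.
-- Moreover, if the outer rule is in `C`, the bound on the label of that multistep forces its
-- source, the result of the inner step, to be a `C`-reduct of `t`, even if the inner rule is
-- outside `C`. Excluded middle makes ranks comparable, so every nonempty finite collection of
-- labels has one of greatest rank. Linearity lets a redex be cut out of a multistep at a single
-- position, and lets a multistep factor through a pattern in which none of its redexes starts.

by-contradiction : ExcludedMiddle 0ℓ → {P : Set} → ¬ ¬ P → P
by-contradiction em {P} ¬¬p with em {P}
... | yes p = p
... | no ¬p = ⊥-elim (¬¬p ¬p)

-- Ordinal ranks in a well-founded relation

module Rank (em : ExcludedMiddle 0ℓ) {A : Set} (_<_ : Rel A 0ℓ) where

  infix 4 _≼_ _≺_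

  -- The ordinal rank of a in the well-founded relation _<_ is at most that of b.
  data _≼_ (a b : A) : Set where
    intro : (∀ {a′} → a′ < a → ∃ λ b′ → b′ < b × a′ ≼ b′) → a ≼ b

  _≺_ : Rel A 0ℓ
  a ≺ b = ¬ b ≼ a

  ≼-trans : ∀ {a b c} → a ≼ b → b ≼ c → a ≼ c
  ≼-trans (intro f) (intro g) = intro λ a′<a →
    let b′ , b′<b , a′≼b′ = f a′<a
        c′ , c′<c , b′≼c′ = g b′<b
    in c′ , c′<c , ≼-trans a′≼b′ b′≼c′

  module _ (wf : WellFounded _<_) where

    ≼-refl : ∀ {a} → a ≼ a
    ≼-refl {a} = go (wf a)
      where
      go : ∀ {a} → Acc _<_ a → a ≼ a
      go (acc rs) = intro λ a′<a → _ , a′<a , go (rs a′<a)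

    <⇒≼ : ∀ {a b} → a < b → a ≼ b
    <⇒≼ {a} = go (wf a)
      where
      go : ∀ {a b} → Acc _<_ a → a < b → a ≼ b
      go (acc rs) a<b = intro λ a′<a → _ , a<b , go (rs a′<a) a′<a

    -- This is the comparability of ordinals. If `a ≼ b` fails, some `a′ < a` is dominated by no
    -- `b′ < b`; by induction on `a`, each `b′ < b` is then dominated by an element under `a′`, so
    -- `b ≼ a′`.
    ≺⇒≼< : ∀ {a b} → b ≺ a → ∃ λ a′ → a′ < a × b ≼ a′
    ≺⇒≼< {a} = go (wf a)
      where
      go : ∀ {a b} → Acc _<_ a → ¬ a ≼ b → ∃ λ a′ → a′ < a × b ≼ a′
      go {a} {b} (acc rs) a⋠b with em {∃ λ a′ → a′ < a × (∀ {b′} → b′ < b → ¬ a′ ≼ b′)}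
      ... | yes (a′ , a′<a , f) = a′ , a′<a , intro λ b′<b → go (rs a′<a) (f b′<b)
      ... | no ¬ex = ⊥-elim (a⋠b (intro λ {a′} a′<a → by-contradiction em λ ¬b′ →
              ¬ex (a′ , a′<a , λ b′<b a′≼b′ → ¬b′ (_ , b′<b , a′≼b′))))

    ≺⇒≼ : ∀ {a b} → a ≺ b → a ≼ b
    ≺⇒≼ a≺b = let b′ , b′<b , a≼b′ = ≺⇒≼< a≺b in ≼-trans a≼b′ (<⇒≼ b′<b)

    ≼⊎≺ : ∀ a b → a ≼ b ⊎ b ≺ a
    ≼⊎≺ a b with em {a ≼ b}
    ... | yes a≼b = inj₁ a≼b
    ... | no  a⋠b = inj₂ a⋠b

    -- Accessibility of `b` in `_<_` serves all `a ≼ b` at once: from `c ≺ a`, the element of `a`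
    -- that dominates `c` is itself dominated by some `b′ < b`.
    ≺-wellFounded : WellFounded _≺_
    ≺-wellFounded b = go (wf b) ≼-refl
      where
      go : ∀ {a b} → Acc _<_ b → a ≼ b → Acc _≺_ a
      go (acc rs) (intro f) = acc λ c≺a →
        let a′ , a′<a , c≼a′ = ≺⇒≼< c≺a
            b′ , b′<b , a′≼b′ = f a′<a
        in go (rs b′<b) (≼-trans c≼a′ a′≼b′)

    -- If also `b ≼ a`, some `a′ < a` has `a ≼ a′`, and the argument repeats with `a′` in place of
    -- `a`: an infinite descent.
    <⇒≺ : ∀ {a b} → a < b → a ≺ b
    <⇒≺ {a} = go (wf a)
      where
      go : ∀ {a b} → Acc _<_ a → a < b → a ≺ b
      go (acc rs) a<b (intro f) =
        let a′ , a′<a , a≼a′ = f a<b in go (rs a′<a) a′<a a≼a′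

    ≺-≼-trans : ∀ {a b c} → a ≺ b → b ≼ c → a ≺ c
    ≺-≼-trans a≺b b≼c c≼a = a≺b (≼-trans b≼c c≼a)

    ≼-≺-trans : ∀ {a b c} → a ≼ b → b ≺ c → a ≺ c
    ≼-≺-trans a≼b b≺c c≼a = b≺c (≼-trans c≼a a≼b)

-- Decreasing diagrams

module DecreasingDiagrams (em : ExcludedMiddle 0ℓ) {Λ : Set} (_<_ : Rel Λ 0ℓ)
                          (wf : WellFounded _<_) where

  open Rank em _<_

  -- A conversion is described by the word of its labels; fw α is a step
  -- from left to right, bw α one from right to left.
  data Letter : Set where
    fw bw : Λ → Letter

  open import Algebra.Solver.Monoid (++-monoid Letter) using (solve; _⊕_; _⊜_) renaming (id to 𝟙)

  lab : Letter → Λ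
  lab (fw α) = α
  lab (bw α) = α

  Word : Set
  Word = List Letter

  Below : Λ → Word → Set
  Below α = All λ l → lab l ≺ α

  AtMost : Λ → Word → Set
  AtMost α = All λ l → lab l ≼ α

  data Optional (l : Letter) : Word → Set where
    none : Optional l []
    some : Optional l (l ∷ [])

  data Decreasing (α β : Λ) : Word → Set where
    decreasing : ∀ {u o v o′ w} →
      Below α u → Optional (fw β) o → All (λ l → lab l ≺ α ⊎ lab l ≺ β) v →
      Optional (bw α) o′ → Below β w → Decreasing α β (u ++ o ++ v ++ o′ ++ w)

  infix 4 _⇒_

  -- Church-Rosser only performs `peak` steps. `shrink` is added for the termination proof: when one
  -- letter of a peak survives, the word on the side of the other letter is a `shrink`-reduct of
  -- what was there before.
  data _⇒_ : Word → Word → Set where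
    shrink : ∀ l {v w} → Below (lab l) w → l ∷ v ⇒ w ++ v
    peak   : ∀ {α β v w} → Decreasing α β w → bw α ∷ fw β ∷ v ⇒ w ++ v
    there  : ∀ {l v w} → v ⇒ w → l ∷ v ⇒ l ∷ w

  ⇒-++ˡ : ∀ u {v w} → v ⇒ w → u ++ v ⇒ u ++ w
  ⇒-++ˡ []      s = s
  ⇒-++ˡ (l ∷ u) s = there (⇒-++ˡ u s)

  SN : Word → Set
  SN = Acc (flip _⇒_)

  -- A letter `bw` takes part in a peak only with its right neighbour, and `fw` only with its left
  -- one. Hence for a fixed `l` one of the two peak cases is void.
  data Split (u : Word) (l : Letter) (v : Word) : Word → Set where
    left      : ∀ {u′} → u ⇒ u′ → Split u l v (u′ ++ l ∷ v)
    right     : ∀ {v′} → v ⇒ v′ → Split u l v (u ++ l ∷ v′)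
    middle    : ∀ {w} → Below (lab l) w → Split u l v (u ++ w ++ v)
    leftPeak  : ∀ {α β u₀ w} → u ≡ u₀ ++ bw α ∷ [] → l ≡ fw β → Decreasing α β w →
                Split u l v (u₀ ++ w ++ v)
    rightPeak : ∀ {α β v₀ w} → l ≡ bw α → v ≡ fw β ∷ v₀ → Decreasing α β w →
                Split u l v (u ++ w ++ v₀)

  Split-assoc : ∀ {u l v} w u′ → Split u l v ((w ++ u′) ++ l ∷ v) → Split u l v (w ++ u′ ++ l ∷ v)
  Split-assoc {u} {l} {v} w u′ = subst (Split u l v) (++-assoc w u′ (l ∷ v))

  Split-∷ : ∀ {x u l v y} → Split u l v y → Split (x ∷ u) l v (x ∷ y)
  Split-∷ (left s)             = left (there s)
  Split-∷ (right s)            = right s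
  Split-∷ (middle b)           = middle b
  Split-∷ (leftPeak refl e d)  = leftPeak refl e d
  Split-∷ (rightPeak e e′ d)   = rightPeak e e′ d

  split : ∀ u {l v y} → u ++ l ∷ v ⇒ y → Split u l v y
  split []          (shrink l b)  = middle b
  split []          (peak d)      = rightPeak refl refl d
  split []          (there s)     = right s
  split (x ∷ [])    (shrink _ {w = w} b) = Split-assoc w [] (left (shrink x b))
  split (x ∷ [])    (peak d)      = leftPeak {u₀ = []} refl refl d
  split (x ∷ [])    (there s)     = Split-∷ (split [] s)
  split (x ∷ y ∷ u) (shrink _ {w = w} b) = Split-assoc w (y ∷ u) (left (shrink x b))
  split (x ∷ y ∷ u) (peak {w = w} d) = Split-assoc w u (left (peak d))
  split (x ∷ y ∷ u) (there s)     = Split-∷ (split (y ∷ u) s)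

  AtMost-⇒ : ∀ {α v w} → AtMost α v → v ⇒ w → AtMost α w
  AtMost-⇒ (p ∷ ps)     (shrink l b) = ++⁺ (All.map (λ q → ≼-trans (≺⇒≼ wf q) p) b) ps
  AtMost-⇒ (p ∷ q ∷ ps) (peak (decreasing a o b o′ c)) =
    ++⁺ (++⁺ (All.map (λ r → ≼-trans (≺⇒≼ wf r) p) a)
        (++⁺ (optional o q)
        (++⁺ (All.map [ (λ r → ≼-trans (≺⇒≼ wf r) p) , (λ r → ≼-trans (≺⇒≼ wf r) q) ]′ b)
        (++⁺ (optional o′ p)
             (All.map (λ r → ≼-trans (≺⇒≼ wf r) q) c))))) ps
    where
    optional : ∀ {α l o} → Optional l o → lab l ≼ α → AtMost α o
    optional none r = []
    optional some r = r ∷ []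
  AtMost-⇒ (p ∷ ps)     (there s)    = p ∷ AtMost-⇒ ps s

  -- Since ranks are comparable, a nonempty word has a letter of greatest rank, which still lies
  -- strictly below `α`. This permits the induction on a single bounding label.
  Below⇒AtMost : ∀ {α} w → Below α w → w ≡ [] ⊎ ∃ λ β → β ≺ α × AtMost β w
  Below⇒AtMost []      []       = inj₁ refl
  Below⇒AtMost (l ∷ w) (p ∷ ps) with Below⇒AtMost w ps
  ... | inj₁ refl           = inj₂ (lab l , p , ≼-refl wf ∷ [])
  ... | inj₂ (β , β≺α , qs) with ≼⊎≺ wf (lab l) β
  ...   | inj₁ l≼β = inj₂ (β , β≺α , l≼β ∷ qs)
  ...   | inj₂ β≺l = inj₂ (lab l , p , ≼-refl wf ∷ All.map (λ q → ≼-trans q (≺⇒≼ wf β≺l)) qs)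

  -- Termination at level α: by induction on the number of letters of rank α,
  -- which no step increases.
  module AtLevel (α : Λ) (ih : ∀ {β} → β ≺ α → ∀ {w} → AtMost β w → SN w) where

    below-SN : ∀ {w} → Below α w → SN w
    below-SN {w} b with Below⇒AtMost w b
    ... | inj₁ refl           = acc λ ()
    ... | inj₂ (β , β≺α , ps) = ih β≺α ps

    weight : Letter → ℕ
    weight l with ≼⊎≺ wf α (lab l)
    ... | inj₁ _ = 1
    ... | inj₂ _ = 0

    weight-≺ : ∀ l → lab l ≺ α → weight l ≡ 0
    weight-≺ l l≺α with ≼⊎≺ wf α (lab l)
    ... | inj₁ α≼l = ⊥-elim (l≺α α≼l)
    ... | inj₂ _   = refl

    count : Word → ℕ
    count []      = 0
    count (l ∷ w) = weight l + count w

    count-++ : ∀ u v → count (u ++ v) ≡ count u + count v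
    count-++ []      v = refl
    count-++ (l ∷ u) v = trans (cong (weight l +_) (count-++ u v)) (sym (+-assoc (weight l) _ _))

    count-below : ∀ {w} → Below α w → count w ≡ 0
    count-below []           = refl
    count-below {l ∷ w} (p ∷ ps) rewrite weight-≺ l p = count-below ps

    count-below-++ : ∀ {u} v → Below α u → count (u ++ v) ≡ count v
    count-below-++ {u} v b = trans (count-++ u v) (cong (_+ count v) (count-below b))

    count-optional : ∀ {l o} v → Optional l o → count (o ++ v) ≤ weight l + count v
    count-optional {l} v none = m≤n+m (count v) (weight l)
    count-optional     v some = ≤-refl

    module _ {β γ : Λ} (β≼α : β ≼ α) (γ≼α : γ ≼ α) where

      below-middle : ∀ {v} → All (λ l → lab l ≺ β ⊎ lab l ≺ γ) v → Below α v
      below-middle = All.map [ (λ p → ≺-≼-trans wf p β≼α) , (λ p → ≺-≼-trans wf p γ≼α) ]′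

      -- At most one copy of each of the two letters of the peak survives; all other letters created
      -- are strictly below `β` or `γ`, hence below `α`, and weigh nothing.
      count-peak : ∀ {w} → Decreasing β γ w → ∀ v → count (w ++ v) ≤ weight (bw β) + (weight (fw γ) + count v)
      count-peak (decreasing {u} {o} {m} {o′} {w} b op bm op′ bw′) v = begin
        count ((u ++ o ++ m ++ o′ ++ w) ++ v) ≡⟨ count-++ (u ++ o ++ m ++ o′ ++ w) v ⟩
        count (u ++ o ++ m ++ o′ ++ w) + count v
          ≡⟨ cong (_+ count v) (count-below-++ (o ++ m ++ o′ ++ w) (All.map (λ p → ≺-≼-trans wf p β≼α) b)) ⟩
        count (o ++ m ++ o′ ++ w) + count v
          ≤⟨ +-monoˡ-≤ (count v) (count-optional (m ++ o′ ++ w) op) ⟩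
        weight (fw γ) + count (m ++ o′ ++ w) + count v
          ≡⟨ cong (λ x → weight (fw γ) + x + count v) (count-below-++ (o′ ++ w) (below-middle bm)) ⟩
        weight (fw γ) + count (o′ ++ w) + count v
          ≤⟨ +-monoˡ-≤ (count v) (+-monoʳ-≤ (weight (fw γ)) (count-optional w op′)) ⟩
        weight (fw γ) + (weight (bw β) + count w) + count v
          ≡⟨ cong (λ x → weight (fw γ) + (weight (bw β) + x) + count v)
               (count-below (All.map (λ p → ≺-≼-trans wf p γ≼α) bw′)) ⟩
        weight (fw γ) + (weight (bw β) + 0) + count v
          ≡⟨ shuffle (weight (fw γ)) (weight (bw β)) (count v) ⟩
        weight (bw β) + (weight (fw γ) + count v) ∎
        where
        open ≤-Reasoning
        open +-*-Solver using (_:+_; _:=_; con) renaming (solve to solve-ℕ)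
        shuffle : ∀ x y z → x + (y + 0) + z ≡ y + (x + z)
        shuffle = solve-ℕ 3 (λ x y z → x :+ (y :+ con 0) :+ z := y :+ (x :+ z)) refl

    count-⇒ : ∀ {v w} → AtMost α v → v ⇒ w → count w ≤ count v
    count-⇒ (p ∷ ps) (shrink l {v} b) =
      ≤-trans (≤-reflexive (count-below-++ v (All.map (λ q → ≺-≼-trans wf q p) b))) (m≤n+m _ (weight l))
    count-⇒ (p ∷ q ∷ ps) (peak {v = v} d) = count-peak p q d v
    count-⇒ (p ∷ ps) (there {l} s) = +-monoʳ-≤ (weight l) (count-⇒ ps s)

    Heavy : Letter → Set
    Heavy l = α ≼ lab l

    weight-heavy : ∀ l → Heavy l → weight l ≡ 1
    weight-heavy l h with ≼⊎≺ wf α (lab l)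
    ... | inj₁ _ = refl
    ... | inj₂ q = ⊥-elim (q h)

    find-heavy : ∀ w → Below α w ⊎ ∃ λ u → ∃ λ l → ∃ λ v → w ≡ u ++ l ∷ v × Heavy l
    find-heavy [] = inj₁ []
    find-heavy (l ∷ w) with ≼⊎≺ wf α (lab l)
    ... | inj₁ h = inj₂ ([] , l , w , refl , h)
    ... | inj₂ p with find-heavy w
    ...   | inj₁ b = inj₁ (p ∷ b)
    ...   | inj₂ (u , l′ , v , refl , h) = inj₂ (l ∷ u , l′ , v , refl , h)

    count-middle : ∀ u {w} v → Below α w → count (u ++ w ++ v) ≡ count u + count v
    count-middle u v b = trans (count-++ u _) (cong (count u +_) (count-below-++ v b))

    atMost : ∀ {w} → Below α w → AtMost α w
    atMost = All.map (≺⇒≼ wf)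

    optional-atMost : ∀ {l o} → lab l ≼ α → Optional l o → AtMost α o
    optional-atMost p none = []
    optional-atMost p some = p ∷ []

    module Heavier (k : ℕ) (ihk : ∀ {w} → AtMost α w → count w ≤ k → SN w) where

      -- bw β can only interact with the head of v: then v gets smaller, and u is
      -- replaced by a word with fewer heavy letters than the whole word.
      backward : ∀ {β} → β ≼ α → ∀ {v} → SN v → ∀ {u} → SN u → AtMost α u → AtMost α v →
                 count u + count v ≤ k → SN (u ++ bw β ∷ v)
      backward {β} β≼α {v} (acc rv) = inner
        where
        inner : ∀ {u} → SN u → AtMost α u → AtMost α v → count u + count v ≤ k → SN (u ++ bw β ∷ v)
        inner {u} (acc ru) au av c = acc λ s → go (split u s)
          where
          go : ∀ {y} → Split u (bw β) v y → SN y
          go (left s)  = inner (ru s) (AtMost-⇒ au s) av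
                           (≤-trans (+-monoˡ-≤ (count v) (count-⇒ au s)) c)
          go (right s) = backward β≼α (rv s) (acc ru) au (AtMost-⇒ av s)
                           (≤-trans (+-monoʳ-≤ (count u) (count-⇒ av s)) c)
          go (middle b) = ihk (++⁺ au (++⁺ (atMost b′) av)) (≤-trans (≤-reflexive (count-middle u v b′)) c)
            where b′ = All.map (λ p → ≺-≼-trans wf p β≼α) b
          go (leftPeak _ () _)
          go (rightPeak {β = γ} {v₀ = v₀} refl refl (decreasing {a} {o} {m} {w = w} ba op bm op′ bw′)) =
            finish op′
            where
            γ≼α = All.head av
            ba′ = All.map (λ p → ≺-≼-trans wf p β≼α) ba
            bm′ = below-middle β≼α γ≼α bm
            bw″ = All.map (λ p → ≺-≼-trans wf p γ≼α) bw′
            u′ = u ++ a ++ o ++ m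
            au′ : AtMost α u′
            au′ = ++⁺ au (++⁺ (atMost ba′) (++⁺ (optional-atMost γ≼α op) (atMost bm′)))
            av′ : AtMost α (w ++ v₀)
            av′ = ++⁺ (atMost bw″) (All.tail av)
            c′ : count u′ + count (w ++ v₀) ≤ k
            c′ = begin
              count u′ + count (w ++ v₀)
                ≡⟨ cong₂ _+_ (count-middle u (o ++ m) ba′) (count-below-++ v₀ bw″) ⟩
              count u + count (o ++ m) + count v₀
                ≤⟨ +-monoˡ-≤ (count v₀) (+-monoʳ-≤ (count u) (count-optional m op)) ⟩
              count u + (weight (fw γ) + count m) + count v₀
                ≡⟨ cong (λ x → count u + x + count v₀) (trans (cong (weight (fw γ) +_) (count-below bm′)) (+-identityʳ _)) ⟩
              count u + weight (fw γ) + count v₀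
                ≡⟨ +-assoc (count u) _ _ ⟩
              count u + count (fw γ ∷ v₀)
                ≤⟨ c ⟩
              k ∎
              where open ≤-Reasoning
            reassoc : ∀ u a o m x w v → (u ++ a ++ o ++ m) ++ x ++ w ++ v ≡ u ++ (a ++ o ++ m ++ x ++ w) ++ v
            reassoc = solve 7 (λ u a o m x w v → (u ⊕ a ⊕ o ⊕ m) ⊕ x ⊕ w ⊕ v ⊜ u ⊕ (a ⊕ o ⊕ m ⊕ x ⊕ w) ⊕ v) refl
            finish : ∀ {o′} → Optional (bw β) o′ → SN (u ++ (a ++ o ++ m ++ o′ ++ w) ++ v₀)
            finish none = subst SN (reassoc u a o m [] w v₀)
              (ihk (++⁺ au′ av′) (≤-trans (≤-reflexive (count-++ u′ _)) c′))
            finish some = subst SN (reassoc u a o m (bw β ∷ []) w v₀)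
              (backward β≼α (rv (shrink (fw γ) bw′)) (ihk au′ (≤-trans (m≤m+n _ _) c′)) au′ av′ c′)

      -- The mirror image of `backward`: `fw γ` reacts only with the last letter of `u`, so now `u`
      -- comes first in the lexicographic induction and `v` may be replaced by any word with at most
      -- `k` heavy letters.
      forward : ∀ {γ} → γ ≼ α → ∀ {u} → SN u → ∀ {v} → SN v → AtMost α u → AtMost α v →
                count u + count v ≤ k → SN (u ++ fw γ ∷ v)
      forward {γ} γ≼α {u} (acc ru) = inner
        where
        inner : ∀ {v} → SN v → AtMost α u → AtMost α v → count u + count v ≤ k → SN (u ++ fw γ ∷ v)
        inner {v} (acc rv) au av c = acc λ s → go (split u s)
          where
          go : ∀ {y} → Split u (fw γ) v y → SN y
          go (left s)  = forward γ≼α (ru s) (acc rv) (AtMost-⇒ au s) av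
                           (≤-trans (+-monoˡ-≤ (count v) (count-⇒ au s)) c)
          go (right s) = inner (rv s) au (AtMost-⇒ av s)
                           (≤-trans (+-monoʳ-≤ (count u) (count-⇒ av s)) c)
          go (middle b) = ihk (++⁺ au (++⁺ (atMost b′) av)) (≤-trans (≤-reflexive (count-middle u v b′)) c)
            where b′ = All.map (λ p → ≺-≼-trans wf p γ≼α) b
          go (rightPeak () _ _)
          go (leftPeak {α = β} {u₀ = u₀} refl refl (decreasing {a} {v = m} {o′ = o′} {w = w} ba op bm op′ bw′)) =
            finish op
            where
            β≼α = All.head (++⁻ʳ u₀ au)
            ba′ = All.map (λ p → ≺-≼-trans wf p β≼α) ba
            bm′ = below-middle β≼α γ≼α bm
            bw″ = All.map (λ p → ≺-≼-trans wf p γ≼α) bw′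
            v′ = m ++ o′ ++ w ++ v
            au′ : AtMost α (u₀ ++ a ++ [])
            au′ = ++⁺ (++⁻ˡ u₀ au) (++⁺ (atMost ba′) [])
            av′ : AtMost α v′
            av′ = ++⁺ (atMost bm′) (++⁺ (optional-atMost β≼α op′) (++⁺ (atMost bw″) av))
            c′ : count (u₀ ++ a ++ []) + count v′ ≤ k
            c′ = begin
              count (u₀ ++ a ++ []) + count v′
                ≡⟨ cong₂ _+_ (count-middle u₀ [] ba′) (count-below-++ (o′ ++ w ++ v) bm′) ⟩
              count u₀ + 0 + count (o′ ++ w ++ v)
                ≤⟨ +-monoʳ-≤ (count u₀ + 0) (count-optional (w ++ v) op′) ⟩
              count u₀ + 0 + (weight (bw β) + count (w ++ v))
                ≡⟨ cong (λ x → count u₀ + 0 + (weight (bw β) + x)) (count-below-++ v bw″) ⟩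
              count u₀ + 0 + (weight (bw β) + count v)
                ≡⟨ shuffle (count u₀) (weight (bw β)) (count v) ⟩
              count u₀ + (weight (bw β) + 0) + count v
                ≡⟨ cong (_+ count v) (count-++ u₀ (bw β ∷ [])) ⟨
              count (u₀ ++ bw β ∷ []) + count v
                ≤⟨ c ⟩
              k ∎
              where
              open ≤-Reasoning
              open +-*-Solver using (_:+_; _:=_; con) renaming (solve to solve-ℕ)
              shuffle : ∀ x y z → x + 0 + (y + z) ≡ x + (y + 0) + z
              shuffle = solve-ℕ 3 (λ x y z → x :+ con 0 :+ (y :+ z) := x :+ (y :+ con 0) :+ z) refl
            reassoc : ∀ u a x m o w v → (u ++ a ++ []) ++ x ++ m ++ o ++ w ++ v ≡ u ++ (a ++ x ++ m ++ o ++ w) ++ v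
            reassoc = solve 7 (λ u a x m o w v →
              (u ⊕ a ⊕ 𝟙) ⊕ x ⊕ m ⊕ o ⊕ w ⊕ v ⊜ u ⊕ (a ⊕ x ⊕ m ⊕ o ⊕ w) ⊕ v) refl
            finish : ∀ {o} → Optional (fw γ) o → SN (u₀ ++ (a ++ o ++ m ++ o′ ++ w) ++ v)
            finish none = subst SN (reassoc u₀ a [] m o′ w v)
              (ihk (++⁺ au′ av′) (≤-trans (≤-reflexive (count-++ (u₀ ++ a ++ []) _)) c′))
            finish some = subst SN (reassoc u₀ a (fw γ ∷ []) m o′ w v)
              (forward γ≼α (ru (⇒-++ˡ u₀ (shrink (bw β) ba))) (ihk av′ (≤-trans (m≤n+m _ _) c′)) au′ av′ c′)

    -- A heavy letter splits the word into two sides that together have fewer heavy letters, so both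
    -- terminate by induction on `k`; it remains to put the letter back between them.
    atMost-SN : ∀ k {w} → AtMost α w → count w ≤ k → SN w
    atMost-SN k {w} aw c with find-heavy w
    ... | inj₁ b = below-SN b
    ... | inj₂ (u , l , v , refl , h) = go k l h aw (≤-trans (≤-reflexive (trans (sym eq) (sym (count-++ u _)))) c)
      where
      eq : count u + count (l ∷ v) ≡ suc (count u + count v)
      eq = trans (cong (λ x → count u + (x + count v)) (weight-heavy l h)) (+-suc (count u) (count v))
      go : ∀ k l → Heavy l → AtMost α (u ++ l ∷ v) → suc (count u + count v) ≤ k → SN (u ++ l ∷ v)
      go (suc k) l h a (s≤s c) with ++⁻ˡ u a | ++⁻ʳ u a
      ... | au | p ∷ av = arrow l p
        where
        open Heavier k (atMost-SN k)
        snu = atMost-SN k au (≤-trans (m≤m+n _ _) c)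
        snv = atMost-SN k av (≤-trans (m≤n+m _ _) c)
        arrow : ∀ l → lab l ≼ α → SN (u ++ l ∷ v)
        arrow (fw γ) p = forward p snu snv au av c
        arrow (bw β) p = backward p snv snu au av c

  atMost-SN : ∀ α {w} → AtMost α w → SN w
  atMost-SN α = go (≺-wellFounded wf α)
    where
    go : ∀ {α} → Acc _≺_ α → ∀ {w} → AtMost α w → SN w
    go {α} (acc rs) {w} a = AtLevel.atMost-SN α (λ β≺α → go (rs β≺α)) _ a ≤-refl

  word-SN : ∀ w → SN w
  word-SN w with atMost-max w
    where
    atMost-max : ∀ w → w ≡ [] ⊎ ∃ λ α → AtMost α w
    atMost-max [] = inj₁ refl
    atMost-max (l ∷ w) with atMost-max w
    ... | inj₁ refl = inj₂ (lab l , ≼-refl wf ∷ [])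
    ... | inj₂ (α , a) with ≼⊎≺ wf (lab l) α
    ...   | inj₁ l≼α = inj₂ (α , l≼α ∷ a)
    ...   | inj₂ α≺l = inj₂ (lab l , ≼-refl wf ∷ All.map (λ p → ≼-trans p (≺⇒≼ wf α≺l)) a)
  ... | inj₁ refl    = acc λ ()
  ... | inj₂ (α , a) = atMost-SN α a

  module Conversions {X : Set} (LStep : Λ → Rel X 0ℓ) where

    infixr 5 _∷_

    data Conversion : Word → Rel X 0ℓ where
      []    : ∀ {x} → Conversion [] x x
      _∷_   : ∀ {α w x y z} → LStep α x y → Conversion w y z → Conversion (fw α ∷ w) x z
      _∷⁻_  : ∀ {α w x y z} → LStep α y x → Conversion w y z → Conversion (bw α ∷ w) x z

    infixr 5 _∷⁻_ _◅◅ᶜ_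

    _◅◅ᶜ_ : ∀ {v w x y z} → Conversion v x y → Conversion w y z → Conversion (v ++ w) x z
    []       ◅◅ᶜ d = d
    (s ∷ c)  ◅◅ᶜ d = s ∷ (c ◅◅ᶜ d)
    (s ∷⁻ c) ◅◅ᶜ d = s ∷⁻ (c ◅◅ᶜ d)

    LocallyDecreasing : Set
    LocallyDecreasing = ∀ {α β x y z} → LStep α x y → LStep β x z →
      ∃ λ w → Decreasing α β w × Conversion w y z

    private
      _⟶_ : Rel X 0ℓ
      x ⟶ y = ∃ λ α → LStep α x y

    -- The index of `valley` demands an initial forward step. A conversion that starts with two
    -- backward steps therefore cannot have a valley as the outcome of its tail, and one that starts
    -- with a peak is reducible at once.
    data Outcome (x y : X) : Word → Set where
      backward  : ∀ {w} → Star _⟶_ y x → Outcome x y w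
      valley    : ∀ {α w z} → Star _⟶_ x z → Star _⟶_ y z → Outcome x y (fw α ∷ w)
      reducible : ∀ {w w′} → w ⇒ w′ → Conversion w′ x y → Outcome x y w

    outcome : LocallyDecreasing → ∀ {w x y} → Conversion w x y → Outcome x y w
    outcome ld [] = backward ε
    outcome ld (s ∷ c) with outcome ld c
    ... | backward q     = valley ((_ , s) ◅ ε) q
    ... | valley p q     = valley ((_ , s) ◅ p) q
    ... | reducible r c′ = reducible (there r) (s ∷ c′)
    outcome ld (s ∷⁻ (t ∷ c)) = let w , dec , d = ld s t in reducible (peak dec) (d ◅◅ᶜ c)
    outcome ld (s ∷⁻ []) = backward ((_ , s) ◅ ε)
    outcome ld (s ∷⁻ c@(_ ∷⁻ _)) with outcome ld c
    ... | backward q     = backward (q ◅◅ (_ , s) ◅ ε)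
    ... | reducible r c′ = reducible (there r) (s ∷⁻ c′)

    churchRosser : LocallyDecreasing → ∀ {w x y} → Conversion w x y → ∃ λ z → Star _⟶_ x z × Star _⟶_ y z
    churchRosser ld {w} = go (word-SN w)
      where
      go : ∀ {w x y} → SN w → Conversion w x y → ∃ λ z → Star _⟶_ x z × Star _⟶_ y z
      go (acc rs) c with outcome ld c
      ... | backward q     = _ , ε , q
      ... | valley p q     = _ , p , q
      ... | reducible r c′ = go (rs r) c′

-- Positions

lookup-ext : ∀ {A : Set} {n} {xs ys : Vec A n} → (∀ i → lookup xs i ≡ lookup ys i) → xs ≡ ys
lookup-ext {xs = xs} {ys} h =
  trans (sym (tabulate∘lookup xs)) (trans (tabulate-cong h) (tabulate∘lookup ys))

-- Entries are exchanged from left to right. Every intermediate vector has its entries from `xs` and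
-- `ys`, so the invariant `J` holds throughout.
entrywise : ∀ {A : Set} {n} (P : Vec A n → Vec A n → Set) →
            (∀ {xs} → P xs xs) → (∀ {xs ys zs} → P xs ys → P ys zs → P xs zs) →
            (J : Fin n → A → Set) (xs ys : Vec A n) →
            (∀ i → J i (lookup xs i)) → (∀ i → J i (lookup ys i)) →
            (∀ zs i → (∀ j → J j (lookup zs j)) → lookup zs i ≡ lookup xs i → P zs (zs [ i ]≔ lookup ys i)) →
            P xs ys
entrywise P P-refl P-trans J []       []       _  _  _    = P-refl
entrywise P P-refl P-trans J (x ∷ xs) (y ∷ ys) jx jy step = P-trans
  (step (x ∷ xs) zero jx refl)
  (entrywise (λ zs zs′ → P (y ∷ zs) (y ∷ zs′)) P-refl P-trans (J ∘ suc) xs ys (jx ∘ suc) (jy ∘ suc)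
    λ zs i j e → step (y ∷ zs) (suc i) (λ { zero → jy zero ; (suc k) → j k }) e)

-- Unlike `Pos t`, paths do not depend on a term, so positions in the sources of different
-- multisteps can be compared, concatenated and counted.
Path : Set
Path = List ℕ

module _ {S : Signature} where

  term-induction : ∀ {ℓ} {V : Set} (P : Term S V → Set ℓ) → (∀ x → P (var x)) →
                   (∀ f ts → (∀ i → P (lookup ts i)) → P (fn f ts)) → ∀ t → P t
  term-induction {V = V} P P-var P-fn = go
    where
    mutual
      go : ∀ t → P t
      go (var x)   = P-var x
      go (fn f ts) = P-fn f ts (go* ts)

      go* : ∀ {n} (ts : Vec (Term S V) n) i → P (lookup ts i)
      go* (t ∷ ts) zero    = go t
      go* (t ∷ ts) (suc i) = go* ts i

  fn-injective : ∀ {V f g ts us} → fn {S} {V} f ts ≡ fn g us →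
                 ∃ λ (e : f ≡ g) → subst (λ h → Vec (Term S V) (arity S h)) e ts ≡ us
  fn-injective refl = refl , refl

  ·*-lookup : ∀ {V W n} (ts : Vec (Term S V) n) {us} {σ : V → Term S W} →
              (∀ i → lookup ts i · σ ≡ lookup us i) → ts ·* σ ≡ us
  ·*-lookup ts {σ = σ} h = lookup-ext λ i → trans (lookup-·* ts σ i) (h i)

  ·-var : ∀ {V} (t : Term S V) → t · var ≡ t
  ·-var {V} = term-induction (λ t → t · var ≡ t) (λ _ → refl) λ f ts ih → cong (fn f) (·*-lookup ts ih)

  ·*-update : ∀ {V W n} (ts : Vec (Term S V) n) i u (σ : V → Term S W) →
              (ts [ i ]≔ u) ·* σ ≡ (ts ·* σ) [ i ]≔ (u · σ)
  ·*-update (t ∷ ts) zero    u σ = refl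
  ·*-update (t ∷ ts) (suc i) u σ = cong (t · σ ∷_) (·*-update ts i u σ)

  ·*-var : ∀ {V n} (ts : Vec (Term S V) n) → ts ·* var ≡ ts
  ·*-var ts = ·*-lookup ts λ i → ·-var (lookup ts i)

  data At {V : Set} : Term S V → Path → Term S V → Set where
    []  : ∀ {t} → At t [] t
    arg : ∀ {f ts k π u} i → k ≡ toℕ i → At (lookup ts i) π u → At (fn f ts) (k ∷ π) u

  At-functional : ∀ {V π} {t u v : Term S V} → At t π u → At t π v → u ≡ v
  At-functional []             []             = refl
  At-functional (arg i refl p) (arg j e q) with toℕ-injective e
  ... | refl = At-functional p q

  At-++ : ∀ {V π π′} {t u v : Term S V} → At t π u → At u π′ v → At t (π ++ π′) v
  At-++ []          q = q
  At-++ (arg i e p) q = arg i e (At-++ p q)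

  At-++⁻ : ∀ {V} π {π′} {t v : Term S V} → At t (π ++ π′) v → ∃ λ u → At t π u × At u π′ v
  At-++⁻ []      p           = _ , [] , p
  At-++⁻ (k ∷ π) (arg i e p) = let u , q , r = At-++⁻ π p in u , arg i e q , r

  At-suffix : ∀ {V} π {π′} {t u v : Term S V} → At t π u → At t (π ++ π′) v → At u π′ v
  At-suffix π p q with At-++⁻ π q
  ... | u , p′ , r with At-functional p p′
  ...   | refl = r

  At-var : ∀ {V π x} {u : Term S V} → At (var x) π u → π ≡ [] × u ≡ var x
  At-var [] = refl , refl

  var-At-prefix : ∀ {V} π {π′ x f us} {t : Term S V} → At t π (var x) → ¬ At t (π ++ π′) (fn f us)
  var-At-prefix π p q with At-var (At-suffix π p q)
  ... | _ , ()

  var-At-unique : ∀ {V} π π′ {ϖ ϖ′ x y} {t : Term S V} → At t π (var x) → At t π′ (var y) →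
                  π ++ ϖ ≡ π′ ++ ϖ′ → π ≡ π′ × x ≡ y × ϖ ≡ ϖ′
  var-At-unique []      []       []          []            e = refl , refl , e
  var-At-unique (_ ∷ π) (_ ∷ π′) (arg i refl p) (arg j e′ q) e with ∷-injective e
  ... | refl , e₂ with toℕ-injective e′
  ...   | refl with var-At-unique π π′ p q e₂
  ...     | refl , x≡y , ϖ≡ϖ′ = refl , x≡y , ϖ≡ϖ′

  At-· : ∀ {V W π} {t u : Term S V} (σ : V → Term S W) → At t π u → At (t · σ) π (u · σ)
  At-· σ []          = []
  At-· σ (arg {ts = ts} i e p) = arg i e (subst (λ t → At t _ _) (sym (lookup-·* ts σ i)) (At-· σ p))

  data AtSubst {V W : Set} (t : Term S V) (σ : V → Term S W) (u : Term S W) : Path → Set where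
    inside  : ∀ {π f ts} → At t π (fn f ts) → u ≡ fn f ts · σ → AtSubst t σ u π
    beneath : ∀ {π π′ x} → At t π (var x) → At (σ x) π′ u → AtSubst t σ u (π ++ π′)

  At-·⁻ : ∀ {V W} π (t : Term S V) {σ : V → Term S W} {u} → At (t · σ) π u → AtSubst t σ u π
  At-·⁻ π       (var x)   p  = beneath [] p
  At-·⁻ []      (fn f ts) [] = inside [] refl
  At-·⁻ (k ∷ π) (fn f ts) {σ} (arg i e p)
    with At-·⁻ π (lookup ts i) (subst (λ t → At t _ _) (lookup-·* ts σ i) p)
  ... | inside q e′ = inside (arg i e q) e′
  ... | beneath q r = beneath (arg i e q) r

  Fun : {V : Set} → Term S V → Path → Set
  Fun t π = ∃₂ λ f ts → At t π (fn f ts)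

  Fun-prefix : ∀ {V} π {π′} {t : Term S V} → Fun t (π ++ π′) → Fun t π
  Fun-prefix π (f , ts , p) with At-++⁻ π p
  ... | fn g us , q , _  = g , us , q
  ... | var x   , q , () 

  Fun-· : ∀ {V W π} {t : Term S V} (σ : V → Term S W) → Fun t π → Fun (t · σ) π
  Fun-· σ (f , ts , p) = f , _ , At-· σ p

  Occurs : {V : Set} → V → Term S V → Set
  Occurs x t = ∃ λ π → At t π (var x)

  ·-cong⁻ : ∀ {V W x} (t : Term S V) {σ τ : V → Term S W} → t · σ ≡ t · τ → Occurs x t → σ x ≡ τ x
  ·-cong⁻ t {σ} {τ} e (π , p) = At-functional (subst (λ u → At u π _) e (At-· σ p)) (At-· τ p)

  ·-cong-occurs : ∀ {V W} (t : Term S V) {σ τ : V → Term S W} →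
                  (∀ x → Occurs x t → σ x ≡ τ x) → t · σ ≡ t · τ
  ·-cong-occurs {V} = term-induction (λ t → ∀ {σ τ} → (∀ x → Occurs x t → σ x ≡ τ x) → t · σ ≡ t · τ)
    (λ x h → h x ([] , []))
    λ f ts ih {σ} {τ} h → cong (fn f) (lookup-ext λ i → begin
      lookup (ts ·* σ) i ≡⟨ lookup-·* ts σ i ⟩
      lookup ts i · σ    ≡⟨ ih i (λ x (π , p) → h x (_ , arg i refl p)) ⟩
      lookup ts i · τ    ≡⟨ lookup-·* ts τ i ⟨
      lookup (ts ·* τ) i ∎)
    where open ≡-Reasoning

  Lin : {V : Set} → Term S V → Set
  Lin t = ∀ {x π π′} → At t π (var x) → At t π′ (var x) → π ≡ π′

  Lin-At : ∀ {V π} {t u : Term S V} → Lin t → At t π u → Lin u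
  Lin-At {π = π} lin p q q′ = ++-cancelˡ π _ _ (lin (At-++ p q) (At-++ p q′))

  path : ∀ {V} {t : Term S V} → Pos t → Path
  path root      = []
  path (arg i p) = toℕ i ∷ path p

  path-At : ∀ {V} {t : Term S V} (p : Pos t) → At t (path p) (t ∣ p)
  path-At root      = []
  path-At (arg i p) = arg i refl (path-At p)

  At-pos : ∀ {V π} {t u : Term S V} → At t π u → ∃ λ p → path p ≡ π × t ∣ p ≡ u
  At-pos []             = root , refl , refl
  At-pos (arg i refl p) = let q , e , e′ = At-pos p in arg i q , cong (toℕ i ∷_) e , e′

  path-root : ∀ {V} {t : Term S V} (p : Pos t) → path p ≡ [] → p ≡ root
  path-root root _ = refl

  Linear⇒Lin : ∀ {V} {t : Term S V} → Linear t → Lin t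
  Linear⇒Lin lin p q with At-pos p | At-pos q
  ... | a , refl , e | b , refl , e′ = cong path (lin _ a b e e′)

  -- The graph of replacement at a path. Two terms that arise from one term by the same replacement
  -- are equal; in this way the sources of modified multisteps are identified.
  data Rep {V : Set} : Term S V → Path → Term S V → Term S V → Set where
    []  : ∀ {t u} → Rep t [] u u
    arg : ∀ {f ts k π u v} i → k ≡ toℕ i → Rep (lookup ts i) π u v →
          Rep (fn f ts) (k ∷ π) u (fn f (ts [ i ]≔ v))

  Rep-functional : ∀ {V π} {t u v v′ : Term S V} → Rep t π u v → Rep t π u v′ → v ≡ v′
  Rep-functional []             []            = refl
  Rep-functional (arg i refl p) (arg j e q) with toℕ-injective e
  ... | refl with Rep-functional p q
  ...   | refl = refl

  Rep-++ : ∀ {V π π′} {t u u′ v t′ : Term S V} → At t π u → Rep u π′ v u′ → Rep t π u′ t′ → Rep t (π ++ π′) v t′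
  Rep-++ []             r []          = r
  Rep-++ (arg i refl p) r (arg j e q) with toℕ-injective e
  ... | refl = arg i refl (Rep-++ p r q)

  Rep-· : ∀ {V W π} {t u t′ : Term S V} (σ : V → Term S W) → Rep t π u t′ → Rep (t · σ) π (u · σ) (t′ · σ)
  Rep-· σ [] = []
  Rep-· σ (arg {ts = ts} {v = v} i e r) = subst (Rep _ _ _) (cong (fn _) (sym (·*-update ts i v σ)))
    (arg i e (subst (λ t → Rep t _ _ _) (sym (lookup-·* ts σ i)) (Rep-· σ r)))

  Rep-At : ∀ {V π} {t u t′ : Term S V} → Rep t π u t′ → At t′ π u
  Rep-At []                        = []
  Rep-At (arg {ts = ts} {v = v} i e r) =
    arg i e (subst (λ t → At t _ _) (sym (lookup∘update i ts v)) (Rep-At r))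

  Rep-replace : ∀ {V} {t : Term S V} (p : Pos t) u → Rep t (path p) u (replace t p u)
  Rep-replace root      u = []
  Rep-replace (arg i p) u = arg i refl (Rep-replace p u)

  data SameHead {V : Set} : Term S V → Term S V → Set where
    same-var : ∀ {x} → SameHead (var x) (var x)
    same-fn  : ∀ {f ts us} → SameHead (fn f ts) (fn f us)

  SameHead-refl : ∀ {V} (t : Term S V) → SameHead t t
  SameHead-refl (var x)   = same-var
  SameHead-refl (fn f ts) = same-fn

  -- At a position above `π` the subterm itself changes, so only its head symbol can be recovered.
  Rep-elsewhere : ∀ {V π ϖ} {t u t′ v : Term S V} → Rep t π u t′ → At t′ ϖ v →
                  (∃ λ π′ → ϖ ≡ π ++ π′) ⊎ (∃ λ v′ → At t ϖ v′ × SameHead v′ v)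
  Rep-elsewhere []          q  = inj₁ (_ , refl)
  Rep-elsewhere (arg i e r) [] = inj₂ (_ , [] , same-fn)
  Rep-elsewhere (arg {ts = ts} {v = w} i refl r) (arg j e q) with j ≟ᶠ i
  ... | no j≢i = inj₂ (_ , arg j e (subst (λ t → At t _ _) (lookup∘update′ j≢i ts w) q) , SameHead-refl _)
  ... | yes refl with Rep-elsewhere r (subst (λ t → At t _ _) (lookup∘update i ts w) q)
  ...   | inj₁ (π′ , refl)  = inj₁ (π′ , cong (_∷ _) e)
  ...   | inj₂ (v′ , p , h) = inj₂ (v′ , arg j e p , h)

  Rep-elsewhere-var : ∀ {V π ϖ x} {t u t′ : Term S V} → Rep t π u t′ → At t′ ϖ (var x) →
                      (∃ λ π′ → ϖ ≡ π ++ π′) ⊎ At t ϖ (var x)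
  Rep-elsewhere-var r p with Rep-elsewhere r p
  ... | inj₁ b             = inj₁ b
  ... | inj₂ (_ , q , same-var) = inj₂ q

  Rep-elsewhere-fun : ∀ {V π ϖ} {t u t′ : Term S V} → Rep t π u t′ → Fun t′ ϖ →
                      (∃ λ π′ → ϖ ≡ π ++ π′) ⊎ Fun t ϖ
  Rep-elsewhere-fun r (f , ts , p) with Rep-elsewhere r p
  ... | inj₁ b            = inj₁ b
  ... | inj₂ (_ , q , same-fn) = inj₂ (f , _ , q)

  -- As `x` occurs only once in `t`, changing the substitution at `x` alone changes the instance at
  -- a single place.
  Rep-Lin : ∀ {V W π π′ x} {t : Term S V} {σ τ : V → Term S W} {u} → Lin t → At t π (var x) →
            (∀ {y} → y ≢ x → σ y ≡ τ y) → Rep (σ x) π′ u (τ x) → Rep (t · σ) (π ++ π′) u (t · τ)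
  Rep-Lin lin [] h r = r
  Rep-Lin {σ = σ} {τ} lin (arg {ts = ts} i refl p) h r = subst (Rep _ _ _) (cong (fn _) (lookup-ext eq))
    (arg i refl (subst (λ t → Rep t _ _ _) (sym (lookup-·* ts σ i)) (Rep-Lin (λ q q′ → Lin-At lin (arg i refl []) q q′) p h r)))
    where
    eq : ∀ j → lookup ((ts ·* σ) [ i ]≔ (lookup ts i · τ)) j ≡ lookup (ts ·* τ) j
    eq j with j ≟ᶠ i
    ... | yes refl = trans (lookup∘update j (ts ·* σ) _) (sym (lookup-·* ts τ j))
    ... | no j≢i = begin
      lookup ((ts ·* σ) [ i ]≔ (lookup ts i · τ)) j ≡⟨ lookup∘update′ j≢i (ts ·* σ) _ ⟩
      lookup (ts ·* σ) j ≡⟨ lookup-·* ts σ j ⟩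
      lookup ts j · σ    ≡⟨ ·-cong-occurs (lookup ts j) (λ y (ϖ , q) → h λ { refl →
                              j≢i (toℕ-injective (proj₁ (∷-injective (lin (arg j refl q) (arg i refl p))))) }) ⟩
      lookup ts j · τ    ≡⟨ lookup-·* ts τ j ⟨
      lookup (ts ·* τ) j ∎
      where open ≡-Reasoning

  mutual
    size : ∀ {V} → Term S V → ℕ
    size (var x)   = 0
    size (fn f ts) = suc (size* ts)

    size* : ∀ {V n} → Vec (Term S V) n → ℕ
    size* []       = 0
    size* (t ∷ ts) = size t + size* ts

  size-lookup : ∀ {V n} (ts : Vec (Term S V) n) i → size (lookup ts i) ≤ size* ts
  size-lookup (t ∷ ts) zero    = m≤m+n _ _
  size-lookup (t ∷ ts) (suc i) = ≤-trans (size-lookup ts i) (m≤n+m _ _)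

  At-size : ∀ {V π} {t u : Term S V} → At t π u → length π + size u ≤ size t
  At-size []                   = ≤-refl
  At-size (arg {ts = ts} i e p) = s≤s (≤-trans (At-size p) (size-lookup ts i))

  paths-finite : ∀ {V} (t : Term S V) → ∃ λ πs → ∀ {π u} → At t π u → π ∈ πs
  paths-finite = term-induction _ (λ x → [] ∷ [] , λ { [] → here refl }) λ f ts ih →
    [] ∷ List.concat (List.tabulate λ i → List.map (toℕ i ∷_) (proj₁ (ih i))) , λ where
      []             → here refl
      (arg i refl p) → there (∈-concat⁺′ (∈-map⁺ (toℕ i ∷_) (proj₂ (ih i) p))
                                         (∈-tabulate⁺ {f = λ i → List.map (toℕ i ∷_) (proj₁ (ih i))} i))

-- Redexes of proofterms

module Proofterms {S : Signature} (R : TRS S) where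

  private
    variable
      V W : Set

  Sides : Set
  Sides = (ρ : Rule R) → Term S (Fin (vars R ρ))

  unfold-redex : ∀ (side : Sides) ρ (Φs : Vec (Proofterm R V) _) →
                 unfold R side (fn (inj₂ ρ) Φs) ≡ side ρ · (unfold R side ∘ lookup Φs)
  unfold-redex side ρ Φs = ·-cong (side ρ) (lookup-unfold* R side Φs)

  -- The path is a position of the source, not of the proofterm: passing an argument of a rule
  -- symbol appends the path of the corresponding variable in the left-hand side. Redexes of two
  -- proofterms with the same source thus become comparable.
  data Red {V : Set} : Proofterm R V → Path → (ρ : Rule R) → Vec (Proofterm R V) (vars R ρ) → Set where
    here : ∀ {ρ Φs} → Red (fn (inj₂ ρ) Φs) [] ρ Φs
    fun  : ∀ {f Φs k π ρ Ψs} i → k ≡ toℕ i → Red (lookup Φs i) π ρ Ψs → Red (fn (inj₁ f) Φs) (k ∷ π) ρ Ψs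
    arg  : ∀ {θ Φs π π′ x ρ Ψs} → At (lhs R θ) π (var x) → Red (lookup Φs x) π′ ρ Ψs →
           Red (fn (inj₂ θ) Φs) (π ++ π′) ρ Ψs

  At-src-redex : ∀ {ρ π x π′ u} (Φs : Vec (Proofterm R V) _) → At (lhs R ρ) π (var x) →
                 At (src R (lookup Φs x)) π′ u → At (src R (fn (inj₂ ρ) Φs)) (π ++ π′) u
  At-src-redex Φs p q = subst (λ t → At t _ _) (sym (unfold-redex (lhs R) _ Φs)) (At-++ (At-· _ p) q)

  Red-src : ∀ {Φ : Proofterm R V} {π ρ Φs} → Red Φ π ρ Φs → At (src R Φ) π (src R (fn (inj₂ ρ) Φs))
  Red-src here                    = []
  Red-src (fun {Φs = Φs} i e r)   = arg i e (subst (λ t → At t _ _) (sym (lookup-unfold* R (lhs R) Φs i)) (Red-src r))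
  Red-src (arg {Φs = Φs} p r)     = At-src-redex Φs p (Red-src r)

  Red-· : ∀ {Φ : Proofterm R V} {π ρ Φs} (δ : V → Proofterm R W) → Red Φ π ρ Φs → Red (Φ · δ) π ρ (Φs ·* δ)
  Red-· δ here                  = here
  Red-· δ (fun {Φs = Φs} i e r) = fun i e (subst (λ Φ → Red Φ _ _ _) (sym (lookup-·* Φs δ i)) (Red-· δ r))
  Red-· δ (arg {Φs = Φs} {x = x} p r) = arg p (subst (λ Φ → Red Φ _ _ _) (sym (lookup-·* Φs δ x)) (Red-· δ r))

  Red-beneath : ∀ (Φ : Proofterm R V) {π π′ z ρ Φs} (δ : V → Proofterm R W) →
                At (src R Φ) π (var z) → Red (δ z) π′ ρ Φs → Red (Φ · δ) (π ++ π′) ρ Φs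
  Red-beneath {V} {W} = term-induction _ (λ { x δ [] r → r }) λ where
      (inj₁ f) Φs ih δ (arg i e p) r → fun i e (subst (λ Φ → Red Φ _ _ _) (sym (lookup-·* Φs δ i))
        (ih i δ (subst (λ t → At t _ _) (lookup-unfold* R (lhs R) Φs i) p) r))
      (inj₂ θ) Φs ih {π} {π′} δ p r → below Φs ih δ (At-·⁻ π (lhs R θ) p) r
    where
    below : ∀ {θ} Φs →
            (∀ i → ∀ {π π′ z ρ Ψs} (δ : V → Proofterm R W) → At (src R (lookup Φs i)) π (var z) →
                   Red (δ z) π′ ρ Ψs → Red (lookup Φs i · δ) (π ++ π′) ρ Ψs) →
            ∀ {π π′ z ρ Ψs} (δ : V → Proofterm R W) →
            AtSubst (lhs R θ) (lookup (unfold* R (lhs R) Φs)) (var z) π →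
            Red (δ z) π′ ρ Ψs → Red (fn (inj₂ θ) Φs · δ) (π ++ π′) ρ Ψs
    below Φs ih δ (inside p ()) r
    below {θ} Φs ih δ (beneath {π} {π₁} {x} p q) r = subst (λ π → Red _ π _ _) (sym (++-assoc π π₁ _))
      (arg p (subst (λ Φ → Red Φ _ _ _) (sym (lookup-·* Φs δ x))
        (ih x δ (subst (λ t → At t _ _) (lookup-unfold* R (lhs R) Φs x) q) r)))

  data RedSubst (Φ : Proofterm R V) (δ : V → Proofterm R W) (ρ : Rule R) (Φs : Vec (Proofterm R W) (vars R ρ)) :
                Path → Set where
    within  : ∀ {π Ψs} → Red Φ π ρ Ψs → Φs ≡ Ψs ·* δ → RedSubst Φ δ ρ Φs π
    beneath : ∀ {π π′ z} → At (src R Φ) π (var z) → Red (δ z) π′ ρ Φs → RedSubst Φ δ ρ Φs (π ++ π′)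

  Red-·⁻ : ∀ (Φ : Proofterm R V) {δ : V → Proofterm R W} {π ρ Φs} → Red (Φ · δ) π ρ Φs → RedSubst Φ δ ρ Φs π
  Red-·⁻ = term-induction _ (λ x r → beneath [] r) λ where
      (inj₁ f) Φs ih {δ} (fun i e r) → funʳ {Φs = Φs} i e (ih i (subst (λ Φ → Red Φ _ _ _) (lookup-·* Φs δ i) r))
      (inj₂ θ) Φs ih here            → within here refl
      (inj₂ θ) Φs ih {δ} (arg {x = x} p r) → argʳ {Φs = Φs} p (ih x (subst (λ Φ → Red Φ _ _ _) (lookup-·* Φs δ x) r))
    where
    funʳ : ∀ {f Φs k} {δ : V → Proofterm R W} {π ρ Ψs} i → k ≡ toℕ i → RedSubst (lookup Φs i) δ ρ Ψs π →
           RedSubst (fn (inj₁ f) Φs) δ ρ Ψs (k ∷ π)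
    funʳ i e (within r eq) = within (fun i e r) eq
    funʳ {Φs = Φs} i e (beneath p r) =
      beneath (arg i e (subst (λ t → At t _ _) (sym (lookup-unfold* R (lhs R) Φs i)) p)) r
    argʳ : ∀ {θ Φs x π₀} {δ : V → Proofterm R W} {π ρ Ψs} → At (lhs R θ) π₀ (var x) →
           RedSubst (lookup Φs x) δ ρ Ψs π → RedSubst (fn (inj₂ θ) Φs) δ ρ Ψs (π₀ ++ π)
    argʳ p (within r eq) = within (arg p r) eq
    argʳ {Φs = Φs} {π₀ = π₀} p (beneath {π} {π′} q r) =
      subst (RedSubst _ _ _ _) (++-assoc π₀ π π′) (beneath (At-src-redex Φs p q) r)

  Red-++ : ∀ {Φ : Proofterm R V} {π ρ Φs π′ θ Ψs} →
           Red Φ π ρ Φs → Red (fn (inj₂ ρ) Φs) π′ θ Ψs → Red Φ (π ++ π′) θ Ψs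
  Red-++ here          r = r
  Red-++ (fun i e q)   r = fun i e (Red-++ q r)
  Red-++ (arg {π = π₀} {π′} p q) r = subst (λ π → Red _ π _ _) (sym (++-assoc π₀ π′ _)) (arg p (Red-++ q r))

  lookup-⌈⌉* : ∀ {n} (ts : Vec (Term S V) n) i → lookup (⌈_⌉* R ts) i ≡ ⌈_⌉ R (lookup ts i)
  lookup-⌈⌉* (t ∷ ts) zero    = refl
  lookup-⌈⌉* (t ∷ ts) (suc i) = lookup-⌈⌉* ts i

  Red-⌈⌉ : ∀ (t : Term S V) {π ρ Φs} → ¬ Red (⌈_⌉ R t) π ρ Φs
  Red-⌈⌉ = term-induction _ (λ _ ()) λ { f ts ih (fun i e r) → ih i (subst (λ Φ → Red Φ _ _ _) (lookup-⌈⌉* ts i) r) }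

  -- The symbol of src Φ at the given position belongs to the left-hand side of
  -- a redex of Φ.
  data Mark {V : Set} (Φ : Proofterm R V) : Path → Set where
    mark : ∀ {π π′ ρ Φs} → Red Φ π ρ Φs → Fun (lhs R ρ) π′ → Mark Φ (π ++ π′)

  Mark-Fun : ∀ {Φ : Proofterm R V} {π} → Mark Φ π → Fun (src R Φ) π
  Mark-Fun (mark r p) = let f , ts , q = Fun-· _ p in f , ts , At-++ (Red-src r) q

  Mark-· : ∀ {Φ : Proofterm R V} {π} (δ : V → Proofterm R W) → Mark Φ π → Mark (Φ · δ) π
  Mark-· δ (mark r p) = mark (Red-· δ r) p

  Mark-beneath : ∀ (Φ : Proofterm R V) {π π′ z} (δ : V → Proofterm R W) →
                 At (src R Φ) π (var z) → Mark (δ z) π′ → Mark (Φ · δ) (π ++ π′)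
  Mark-beneath Φ {π} δ p (mark {π₁} {π₂} r q) = subst (Mark _) (++-assoc π π₁ π₂) (mark (Red-beneath Φ δ p r) q)

  data MarkSubst (Φ : Proofterm R V) (δ : V → Proofterm R W) : Path → Set where
    within  : ∀ {π} → Mark Φ π → MarkSubst Φ δ π
    beneath : ∀ {π π′ z} → At (src R Φ) π (var z) → Mark (δ z) π′ → MarkSubst Φ δ (π ++ π′)

  Mark-·⁻ : ∀ (Φ : Proofterm R V) {δ : V → Proofterm R W} {π} → Mark (Φ · δ) π → MarkSubst Φ δ π
  Mark-·⁻ Φ {δ} (mark {π} {π′} r p) with Red-·⁻ Φ r
  ... | within r′ _ = within (mark r′ p)
  ... | beneath {π₁} {π₂} q r′ = subst (MarkSubst Φ δ) (sym (++-assoc π₁ π₂ π′)) (beneath q (mark r′ p))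

  Mark-++ : ∀ {Φ : Proofterm R V} {π ρ Φs π′} → Red Φ π ρ Φs → Mark (fn (inj₂ ρ) Φs) π′ → Mark Φ (π ++ π′)
  Mark-++ {π = π} r (mark {π₁} {π₂} q p) = subst (Mark _) (++-assoc π π₁ π₂) (mark (Red-++ r q) p)

  Mark-⌈⌉ : ∀ (t : Term S V) {π} → ¬ Mark (⌈_⌉ R t) π
  Mark-⌈⌉ t (mark r _) = Red-⌈⌉ t r

  data Only {V : Set} (Q : Rule R → Set) : Proofterm R V → Set where
    only-var : ∀ {x} → Only Q (var x)
    fun  : ∀ {f Φs} → (∀ i → Only Q (lookup Φs i)) → Only Q (fn (inj₁ f) Φs)
    rule : ∀ {ρ Φs} → Q ρ → (∀ x → Only Q (lookup Φs x)) → Only Q (fn (inj₂ ρ) Φs)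

  Only-map : ∀ {P Q : Rule R → Set} {Φ : Proofterm R V} → (∀ {ρ} → P ρ → Q ρ) → Only P Φ → Only Q Φ
  Only-map h only-var    = only-var
  Only-map h (fun os)    = fun λ i → Only-map h (os i)
  Only-map h (rule q os) = rule (h q) λ x → Only-map h (os x)

  Only-· : ∀ {Q} {Φ : Proofterm R V} {δ : V → Proofterm R W} → Only Q Φ → (∀ z → Only Q (δ z)) → Only Q (Φ · δ)
  Only-· only-var h                   = h _
  Only-· (fun {Φs = Φs} os) h    = fun λ i → subst (Only _) (sym (lookup-·* Φs _ i)) (Only-· (os i) h)
  Only-· (rule {Φs = Φs} q os) h = rule q λ i → subst (Only _) (sym (lookup-·* Φs _ i)) (Only-· (os i) h)

  Only-⌈⌉ : ∀ {Q} (t : Term S V) → Only Q (⌈_⌉ R t)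
  Only-⌈⌉ = term-induction _ (λ _ → only-var) λ f ts ih → fun λ i → subst (Only _) (sym (lookup-⌈⌉* ts i)) (ih i)

  Only-Red : ∀ {Q} {Φ : Proofterm R V} {π ρ Φs} → Only Q Φ → Red Φ π ρ Φs → Q ρ × (∀ x → Only Q (lookup Φs x))
  Only-Red (rule q os) here        = q , os
  Only-Red (fun os)    (fun i e r) = Only-Red (os i) r
  Only-Red (rule q os) (arg p r)   = Only-Red (os _) r

  Only-update : ∀ {Q n} (Φs : Vec (Proofterm R V) n) i {Φ} → (∀ j → Only Q (lookup Φs j)) → Only Q Φ →
                ∀ j → Only Q (lookup (Φs [ i ]≔ Φ) j)
  Only-update Φs i {Φ} os o j with j ≟ᶠ i
  ... | yes refl = subst (Only _) (sym (lookup∘update j Φs Φ)) o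
  ... | no j≢i   = subst (Only _) (sym (lookup∘update′ j≢i Φs Φ)) (os j)

  -- Contexts are proofterms in which the variable 0 marks the hole and all
  -- other variables are shifted by one.
  fill : ∀ {T : Signature} → Term T ℕ → ℕ → Term T ℕ
  fill t zero    = t
  fill t (suc n) = var n

  ↑ : ∀ {T : Signature} → ℕ → Term T ℕ
  ↑ n = var (suc n)

  unfold-fill : ∀ (side : Sides) A X → unfold R side (A · fill X) ≡ unfold R side A · fill (unfold R side X)
  unfold-fill side A X = trans (unfold-· R side A (fill X)) (·-cong (unfold R side A) λ { zero → refl ; (suc n) → refl })

  ↑-fill : ∀ {T : Signature} (t u : Term T ℕ) → t · ↑ · fill u ≡ t
  ↑-fill t u = trans (·-assoc t ↑ (fill u)) (·-var t)

  ↑*-fill : ∀ {T : Signature} {n} (ts : Vec (Term T ℕ) n) u → ts ·* ↑ ·* fill u ≡ ts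
  ↑*-fill ts u = trans (·*-assoc ts ↑ (fill u)) (·*-var ts)

  unfold-↑ : ∀ (side : Sides) Φ → unfold R side (Φ · ↑) ≡ unfold R side Φ · ↑
  unfold-↑ side Φ = unfold-· R side Φ ↑

  unfold*-↑-update : ∀ (side : Sides) {n} (Φs : Vec (Proofterm R ℕ) n) i A →
                     unfold* R side ((Φs ·* ↑) [ i ]≔ A) ≡ (unfold* R side Φs ·* ↑) [ i ]≔ unfold R side A
  unfold*-↑-update side (Φ ∷ Φs) zero    A = cong (unfold R side A ∷_) (unfold*-·* R side Φs ↑)
  unfold*-↑-update side (Φ ∷ Φs) (suc i) A = cong₂ _∷_ (unfold-↑ side Φ) (unfold*-↑-update side Φs i A)

  -- `hole` determines the source of the context from the source of Φ and the path alone; contexts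
  -- cut out of two coinitial multisteps at the same path therefore have equal sources.
  record Context (Φ : Proofterm R ℕ) (π : Path) (ρ : Rule R) (Φs : Vec (Proofterm R ℕ) (vars R ρ)) : Set₁ where
    field
      context  : Proofterm R ℕ
      filled   : context · fill (fn (inj₂ ρ) Φs) ≡ Φ
      hole     : Rep (src R Φ · ↑) π (var 0) (src R context)
      only     : ∀ {Q} → Only Q Φ → Only Q context

    Rep-src : ∀ X → Rep (src R Φ) π (src R X) (src R (context · fill X))
    Rep-src X = subst₂ (λ t u → Rep t π (src R X) u) (↑-fill (src R Φ) (src R X)) (sym (unfold-fill (lhs R) context X))
                     (Rep-· (fill (src R X)) hole)

  update-filled : ∀ {T : Signature} {n} (ts : Vec (Term T ℕ) n) i {A X} → A · fill X ≡ lookup ts i →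
                  ((ts ·* ↑) [ i ]≔ A) ·* fill X ≡ ts
  update-filled ts i {A} {X} e = begin
    ((ts ·* ↑) [ i ]≔ A) ·* fill X            ≡⟨ ·*-update (ts ·* ↑) i A (fill X) ⟩
    (ts ·* ↑ ·* fill X) [ i ]≔ (A · fill X)   ≡⟨ cong₂ (λ us u → us [ i ]≔ u) (↑*-fill ts X) e ⟩
    ts [ i ]≔ lookup ts i                     ≡⟨ []≔-lookup ts i ⟩
    ts                                        ∎
    where open ≡-Reasoning

  Only-↑ : ∀ {Q n} (Φs : Vec (Proofterm R ℕ) n) → (∀ i → Only Q (lookup Φs i)) → ∀ i → Only Q (lookup (Φs ·* ↑) i)
  Only-↑ Φs os i = subst (Only _) (sym (lookup-·* Φs ↑ i)) (Only-· (os i) λ _ → only-var)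

  module _ (linear : ∀ ρ → Lin (lhs R ρ)) where

    -- Beneath a rule symbol linearity is essential: a repeated variable of the left-hand side would
    -- copy the hole to several positions of the source.
    toContext : ∀ {Φ π ρ Φs} → Red Φ π ρ Φs → Context Φ π ρ Φs
    toContext here = record { context = var 0 ; filled = refl ; hole = [] ; only = λ _ → only-var }
    toContext (fun {f} {Φs} {π = π} i e r) = record
      { context = fn (inj₁ f) ((Φs ·* ↑) [ i ]≔ context)
      ; filled  = cong (fn (inj₁ f)) (update-filled Φs i filled)
      ; hole    = subst (Rep _ _ _) (cong (fn f) (sym (unfold*-↑-update (lhs R) Φs i context)))
                    (arg i e (subst (λ t → Rep t π (var 0) (src R context)) eq hole))
      ; only    = λ { (fun os) → fun (Only-update (Φs ·* ↑) i (Only-↑ Φs os) (only (os i))) }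
      }
      where
      open Context (toContext r)
      eq : src R (lookup Φs i) · ↑ ≡ lookup (unfold* R (lhs R) Φs ·* ↑) i
      eq = trans (cong (_· ↑) (sym (lookup-unfold* R (lhs R) Φs i))) (sym (lookup-·* (unfold* R (lhs R) Φs) ↑ i))
    toContext (arg {θ} {Φs} {π} {π′} {x} p r) = record
      { context = fn (inj₂ θ) ((Φs ·* ↑) [ x ]≔ context)
      ; filled  = cong (fn (inj₂ θ)) (update-filled Φs x filled)
      ; hole    = subst₂ (λ t u → Rep t (π ++ π′) (var 0) u)
                    (sym (·-assoc (lhs R θ) (lookup ss) ↑))
                    (cong (λ ts → lhs R θ · lookup ts) (sym (unfold*-↑-update (lhs R) Φs x context)))
                    (Rep-Lin (linear θ) p
                      (λ {y} y≢x → trans (sym (lookup-·* ss ↑ y)) (sym (lookup∘update′ y≢x (ss ·* ↑) (src R context))))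
                      (subst₂ (λ t u → Rep t π′ (var 0) u)
                        (cong (_· ↑) (sym (lookup-unfold* R (lhs R) Φs x)))
                        (sym (lookup∘update x (ss ·* ↑) (src R context))) hole))
      ; only    = λ { (rule q os) → rule q (Only-update (Φs ·* ↑) x (Only-↑ Φs os) (only (os x))) }
      }
      where
      open Context (toContext r)
      ss = unfold* R (lhs R) Φs

-- Matching and unification of linear terms

module Unification (em : ExcludedMiddle 0ℓ) {S : Signature} (R : TRS S) where

  open Proofterms R

  mutual
    ⌈⌉-· : ∀ {V W : Set} (t : Term S V) (σ : V → Term S W) → ⌈_⌉ R (t · σ) ≡ ⌈_⌉ R t · (⌈_⌉ R ∘ σ)
    ⌈⌉-· (var x)   σ = refl
    ⌈⌉-· (fn f ts) σ = cong (fn (inj₁ f)) (⌈⌉*-·* ts σ)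

    ⌈⌉*-·* : ∀ {V W : Set} {n} (ts : Vec (Term S V) n) (σ : V → Term S W) →
             ⌈_⌉* R (ts ·* σ) ≡ ⌈_⌉* R ts ·* (⌈_⌉ R ∘ σ)
    ⌈⌉*-·* []       σ = refl
    ⌈⌉*-·* (t ∷ ts) σ = cong₂ _∷_ (⌈⌉-· t σ) (⌈⌉*-·* ts σ)

  unfold-⌈⌉· : ∀ {V W : Set} (side : Sides) (t : Term S V) (δ : V → Proofterm R W) →
               unfold R side (⌈_⌉ R t · δ) ≡ t · (unfold R side ∘ δ)
  unfold-⌈⌉· side t δ = trans (unfold-· R side (⌈_⌉ R t) δ) (cong (_· _) (unfold-⌈⌉ R side t))

  At-Only : ∀ {W : Set} {Q} {X Y : Proofterm R W} {π} → Only Q X → At X π Y → Only Q Y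
  At-Only o           []          = o
  At-Only (fun os)    (arg i _ p) = At-Only (os i) p
  At-Only (rule _ os) (arg i _ p) = At-Only (os i) p

  module _ {V W : Set} where

    Apart : Proofterm R W → Term S V → Set
    Apart X p = ∀ {π ρ Φs} → Red X π ρ Φs → ¬ Fun p π

    data RootView {σ : V → Term S W} {f ts} : Proofterm R W → Set where
      function : ∀ {Φs} → (∀ i → src R (lookup Φs i) ≡ lookup ts i · σ) → RootView {σ} {f} {ts} (fn (inj₁ f) Φs)

    rootView : ∀ X {σ f ts} → src R X ≡ fn f ts · σ → Apart X (fn f ts) → RootView {σ} {f} {ts} X
    rootView (fn (inj₁ g) Φs) {σ} {f} {ts} e apart with fn-injective e
    ... | refl , e′ = function λ i → trans (sym (lookup-unfold* R (lhs R) Φs i))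
                        (trans (cong (λ us → lookup us i) e′) (lookup-·* ts σ i))
    rootView (fn (inj₂ ρ) Φs) e apart = ⊥-elim (apart here (_ , _ , []))

    Apart-arg : ∀ {f Φs ts} → Apart (fn (inj₁ f) Φs) (fn f ts) → ∀ i → Apart (lookup Φs i) (lookup ts i)
    Apart-arg apart i r (g , us , p) = apart (fun i refl r) (g , us , arg i refl p)

    subproofterm : ∀ X {p σ π x} → src R X ≡ p · σ → Apart X p → At p π (var x) → ∃ λ Y → At X π Y
    subproofterm X e apart [] = X , []
    subproofterm X e apart (arg i e′ a) with rootView X e apart
    ... | function es = let Y , b = subproofterm _ (es i) (Apart-arg apart i) a in Y , arg i e′ b

    factor : ∀ X p {σ} (Xs : V → Proofterm R W) → src R X ≡ p · σ → Apart X p →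
             (∀ {π x} → At p π (var x) → At X π (Xs x)) → X ≡ ⌈_⌉ R p · Xs
    factor X (var x) Xs e apart h with h []
    ... | [] = refl
    factor X (fn f ts) Xs e apart h with rootView X e apart
    ... | function {Φs} es = cong (fn (inj₁ f)) (go Φs ts es (Apart-arg apart)
      λ i a → At-suffix (toℕ i ∷ []) (arg i refl []) (h (arg i refl a)))
      where
      go : ∀ {n} (Φs : Vec _ n) ts → (∀ i → src R (lookup Φs i) ≡ lookup ts i · _) →
           (∀ i → Apart (lookup Φs i) (lookup ts i)) →
           (∀ i {π x} → At (lookup ts i) π (var x) → At (lookup Φs i) π (Xs x)) → Φs ≡ ⌈_⌉* R ts ·* Xs
      go []       []       es apart h = refl
      go (Φ ∷ Φs) (t ∷ ts) es apart h = cong₂ _∷_ (factor Φ t Xs (es zero) (apart zero) (h zero))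
        (go Φs ts (es ∘ suc) (apart ∘ suc) (λ i → h (suc i)))

    -- Variables absent from `p` are unconstrained by `factors`; `default` gives them empty
    -- multisteps, which contribute no marks.
    record Match (Q : Rule R → Set) (X : Proofterm R W) (p : Term S V) (σ : V → Term S W) : Set where
      field
        arguments : V → Proofterm R W
        factors   : X ≡ ⌈_⌉ R p · arguments
        sources   : ∀ x → src R (arguments x) ≡ σ x
        only      : ∀ x → Only Q (arguments x)
        default   : ∀ x → ¬ Occurs x p → arguments x ≡ ⌈_⌉ R (σ x)

    -- If no redex of `X` starts at a function position of `p`, the symbols of `X` along `p` are the
    -- function symbols of `p`, so the variable positions of `p` are also positions of `X`. By
    -- linearity each variable reads off its argument at only one of them.
    match : ∀ {Q} X p {σ} → Lin p → Only Q X → src R X ≡ p · σ → Apart X p → Match Q X p σ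
    match {Q} X p {σ} lin o e apart = record
      { arguments = λ x → proj₁ (args x)
      ; factors   = X≡
      ; sources   = srcs
      ; only      = λ x → only (args x)
      ; default   = λ x ∉p → default (args x) ∉p
      }
      where
      Argument : V → Proofterm R W → Set
      Argument x Y = (∃ λ π → At p π (var x) × At X π Y) ⊎ (¬ Occurs x p × Y ≡ ⌈_⌉ R (σ x))

      args : ∀ x → ∃ (Argument x)
      args x with em {Occurs x p}
      ... | yes (π , a) = let Y , b = subproofterm X e apart a in Y , inj₁ (π , a , b)
      ... | no ∉p       = _ , inj₂ (∉p , refl)

      located : ∀ {π x} → At p π (var x) → At X π (proj₁ (args x))
      located {x = x} a with args x
      ... | Y , inj₁ (π , b , c) = subst (λ π → At X π Y) (lin b a) c
      ... | Y , inj₂ (∉p , _)    = ⊥-elim (∉p (_ , a))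

      X≡ : X ≡ ⌈_⌉ R p · (λ x → proj₁ (args x))
      X≡ = factor X p _ e apart located

      only : ∀ {x} (a : ∃ (Argument x)) → Only Q (proj₁ a)
      only (Y , inj₁ (_ , _ , b)) = At-Only o b
      only (Y , inj₂ (_ , refl))  = Only-⌈⌉ _

      default : ∀ {x} (a : ∃ (Argument x)) → ¬ Occurs x p → proj₁ a ≡ ⌈_⌉ R (σ x)
      default (Y , inj₁ (π , a , _)) ∉p = ⊥-elim (∉p (π , a))
      default (Y , inj₂ (_ , e))     ∉p = e

      srcs : ∀ x → src R (proj₁ (args x)) ≡ σ x
      srcs x = go em
        where
        go : Dec (Occurs x p) → src R (proj₁ (args x)) ≡ σ x
        go (yes ∈p) = ·-cong⁻ p (trans (sym (unfold-⌈⌉· (lhs R) p _)) (trans (cong (src R) (sym X≡)) e)) ∈p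
        go (no ∉p)  = trans (cong (src R) (default (args x) ∉p)) (unfold-⌈⌉ R (lhs R) (σ x))

  module _ {V W : Set} where

    OccursIn : ∀ {n} → V → Vec (Term S V) n → Set
    OccursIn z ts = ∃ λ i → Occurs z (lookup ts i)

    LinAll : ∀ {n} → Vec (Term S V) n → Set
    LinAll ts = ∀ {z i j π π′} → At (lookup ts i) π (var z) → At (lookup ts j) π′ (var z) → i ≡ j × π ≡ π′

    Lin⇒LinAll : ∀ {f ts} → Lin {S = S} (fn f ts) → LinAll ts
    Lin⇒LinAll lin {i = i} {j} p q with ∷-injective (lin (arg i refl p) (arg j refl q))
    ... | e , e′ = toℕ-injective e , e′

    LinAll-tail : ∀ {n t} {ts : Vec (Term S V) n} → LinAll (t ∷ ts) → LinAll ts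
    LinAll-tail lin {i = i} {j} p q with lin {i = suc i} {suc j} p q
    ... | e , e′ = sucᶠ-injective e , e′

    -- Generality is stated for solutions in proofterms, because the multisteps themselves and not
    -- just their sources have to factor through the unifier. `support` says that the unifier leaves
    -- all other variables alone.
    record Unified (p g : Term S V) : Set where
      field
        σ        : V → Term S V
        unifies  : p · σ ≡ g · σ
        general  : ∀ (Θ : V → Proofterm R W) → ⌈_⌉ R p · Θ ≡ ⌈_⌉ R g · Θ → ∀ z → Θ z ≡ ⌈_⌉ R (σ z) · Θ
        support  : ∀ z → ¬ Occurs z p → ¬ Occurs z g → σ z ≡ var z

    record Unified* {n} (ps gs : Vec (Term S V) n) : Set where
      field
        σ        : V → Term S V
        unifies  : ps ·* σ ≡ gs ·* σ
        general  : ∀ (Θ : V → Proofterm R W) → ⌈_⌉* R ps ·* Θ ≡ ⌈_⌉* R gs ·* Θ → ∀ z → Θ z ≡ ⌈_⌉ R (σ z) · Θ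
        support  : ∀ z → ¬ OccursIn z ps → ¬ OccursIn z gs → σ z ≡ var z

    _↦_ : V → Term S V → V → Term S V
    (x ↦ t) z with em {z ≡ x}
    ... | yes _ = t
    ... | no _  = var z

    ↦-here : ∀ x t → (x ↦ t) x ≡ t
    ↦-here x t with em {x ≡ x}
    ... | yes _ = refl
    ... | no x≢x = ⊥-elim (x≢x refl)

    ↦-elsewhere : ∀ {x t z} → z ≢ x → (x ↦ t) z ≡ var z
    ↦-elsewhere {x} {z = z} z≢x with em {z ≡ x}
    ... | yes z≡x = ⊥-elim (z≢x z≡x)
    ... | no _    = refl

    ·-fixed : ∀ (t : Term S V) {σ} → (∀ z → Occurs z t → σ z ≡ var z) → t · σ ≡ t
    ·-fixed t h = trans (·-cong-occurs t h) (·-var t)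

    bind : ∀ x t → ¬ Occurs x t → Unified (var x) t
    bind x t ∉t = record
      { σ       = x ↦ t
      ; unifies = trans (↦-here x t) (sym (·-fixed t λ { z (π , p) → ↦-elsewhere λ { refl → ∉t (π , p) } }))
      ; general = general
      ; support = λ { z ∉x _ → ↦-elsewhere λ { refl → ∉x ([] , []) } }
      }
      where
      general : ∀ (Θ : V → Proofterm R W) → Θ x ≡ ⌈_⌉ R t · Θ → ∀ z → Θ z ≡ ⌈_⌉ R ((x ↦ t) z) · Θ
      general Θ e z with em {z ≡ x}
      ... | yes refl = e
      ... | no _     = refl

    swap-unified : ∀ {p g} → Unified p g → Unified g p
    swap-unified u = record
      { σ       = σ
      ; unifies = sym unifies
      ; general = λ Θ e → general Θ (sym e)
      ; support = λ z ∉g ∉p → support z ∉p ∉g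
      }
      where open Unified u

    -- As the terms are linear and have no variables in common, the arguments
    -- can be unified independently of each other.
    mutual
      unify : ∀ p g → Lin p → Lin g → (∀ z → Occurs z p → ¬ Occurs z g) →
              (Θ : V → Proofterm R W) → ⌈_⌉ R p · Θ ≡ ⌈_⌉ R g · Θ → Unified p g
      -- Disjointness of the variables takes the place of an occurs check.
      unify (var x) g lp lg disj Θ e = bind x g (disj x ([] , []))
      unify p@(fn _ _) (var y) lp lg disj Θ e = swap-unified (bind y p λ ∈p → disj y ∈p ([] , []))
      -- The given solution `Θ` excludes a clash of the two function symbols.
      unify (fn f ps) (fn g gs) lp lg disj Θ e with fn-injective e
      ... | refl , e′ = record
        { σ       = σ
        ; unifies = cong (fn f) unifies
        ; general = λ { Θ e → general Θ (fn-args e) }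
        ; support = λ z ∉p ∉g → support z (λ (i , π , p) → ∉p (_ , arg i refl p)) (λ (i , π , p) → ∉g (_ , arg i refl p))
        }
        where
        fn-args : ∀ {W} {Φs Ψs : Vec (Proofterm R W) _} → fn {withRules S R} (inj₁ f) Φs ≡ fn (inj₁ f) Ψs → Φs ≡ Ψs
        fn-args refl = refl
        open Unified* (unify* ps gs (Lin⇒LinAll lp) (Lin⇒LinAll lg)
          (λ z (i , π , p) (j , π′ , q) → disj z (_ , arg i refl p) (_ , arg j refl q)) Θ e′)

      unify* : ∀ {n} (ps gs : Vec (Term S V) n) → LinAll ps → LinAll gs → (∀ z → OccursIn z ps → ¬ OccursIn z gs) →
               (Θ : V → Proofterm R W) → ⌈_⌉* R ps ·* Θ ≡ ⌈_⌉* R gs ·* Θ → Unified* ps gs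
      unify* [] [] _ _ _ _ _ = record { σ = var ; unifies = refl ; general = λ _ _ _ → refl ; support = λ _ _ _ → refl }
      unify* (p ∷ ps) (g ∷ gs) lp lg disj Θ e = record
        { σ       = λ z → U.σ z · U*.σ
        ; unifies = cong₂ _∷_
            (trans (sym (·-assoc p U.σ U*.σ)) (trans (cong (_· U*.σ) U.unifies) (·-assoc g U.σ U*.σ)))
            -- By linearity and disjointness the variables of the remaining arguments do not occur
            -- in `p` or `g`, so the first unifier fixes them.
            (trans (later ps (λ z i → fresh lp (λ ∈g → disj z (suc (proj₁ i) , proj₂ i) (zero , ∈g)) i))
              (trans U*.unifies (sym (later gs λ z i → fresh′ lg (λ ∈p → disj z (zero , ∈p) (suc (proj₁ i) , proj₂ i)) i))))
        ; general = λ Θ e z → begin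
            Θ z                                    ≡⟨ U.general Θ (∷-injectiveˡ e) z ⟩
            ⌈_⌉ R (U.σ z) · Θ                      ≡⟨ ·-cong (⌈_⌉ R (U.σ z)) (U*.general Θ (∷-injectiveʳ e)) ⟩
            ⌈_⌉ R (U.σ z) · (λ y → ⌈_⌉ R (U*.σ y) · Θ) ≡⟨ ·-assoc (⌈_⌉ R (U.σ z)) (⌈_⌉ R ∘ U*.σ) Θ ⟨
            ⌈_⌉ R (U.σ z) · (⌈_⌉ R ∘ U*.σ) · Θ     ≡⟨ cong (_· Θ) (⌈⌉-· (U.σ z) U*.σ) ⟨
            ⌈_⌉ R (U.σ z · U*.σ) · Θ               ∎
        ; support = λ z ∉ps ∉gs → trans
            (cong (_· U*.σ) (U.support z (λ o → ∉ps (zero , o)) (λ o → ∉gs (zero , o))))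
            (U*.support z (λ (i , o) → ∉ps (suc i , o)) (λ (i , o) → ∉gs (suc i , o)))
        }
        where
        open ≡-Reasoning
        module U = Unified (unify p g (λ a b → proj₂ (lp {i = zero} {zero} a b)) (λ a b → proj₂ (lg {i = zero} {zero} a b))
          (λ z o o′ → disj z (zero , o) (zero , o′)) Θ (∷-injectiveˡ e))
        module U* = Unified* (unify* ps gs (LinAll-tail lp) (LinAll-tail lg)
          (λ z (i , o) (j , o′) → disj z (suc i , o) (suc j , o′)) Θ (∷-injectiveʳ e))
        fresh : ∀ {z} → LinAll (p ∷ ps) → ¬ Occurs z g → OccursIn z ps → U.σ z ≡ var z
        fresh lin ∉g (i , π , a) = U.support _ (λ (π′ , b) → 0≢1+n (proj₁ (lin {i = zero} {suc i} b a))) ∉g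
        fresh′ : ∀ {z} → LinAll (g ∷ gs) → ¬ Occurs z p → OccursIn z gs → U.σ z ≡ var z
        fresh′ lin ∉p (i , π , a) = U.support _ ∉p (λ (π′ , b) → 0≢1+n (proj₁ (lin {i = zero} {suc i} b a)))
        later : ∀ (ts : Vec (Term S V) _) → (∀ z → OccursIn z ts → U.σ z ≡ var z) →
                ts ·* (λ z → U.σ z · U*.σ) ≡ ts ·* U*.σ
        later ts h = ·*-lookup ts λ i → trans
          (·-cong-occurs (lookup ts i) λ z o → cong (_· U*.σ) (h z (i , o)))
          (sym (lookup-·* ts U*.σ i))

-- Decreasing peaks

⁺⇒* : {A : Set} {_∼_ : Rel A 0ℓ} {x y : A} → TransClosure _∼_ x y → Star _∼_ x y
⁺⇒* [ s ]    = s ◅ ε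
⁺⇒* (s ∷ ss) = s ◅ ⁺⇒* ss

_*++⁺_ : {A : Set} {_∼_ : Rel A 0ℓ} {x y z : A} → Star _∼_ x y → TransClosure _∼_ y z → TransClosure _∼_ x z
ε        *++⁺ ts = ts
(s ◅ ss) *++⁺ ts = s ∷ (ss *++⁺ ts)

*⇒≡⊎⁺ : {A : Set} {_∼_ : Rel A 0ℓ} {x y : A} → Star _∼_ x y → x ≡ y ⊎ TransClosure _∼_ x y
*⇒≡⊎⁺ ε        = inj₁ refl
*⇒≡⊎⁺ (s ◅ ss) with *⇒≡⊎⁺ ss
... | inj₁ refl = inj₂ [ s ]
... | inj₂ ts   = inj₂ (s ∷ ts)

⁺-gmap : {A B : Set} {_∼_ : Rel A 0ℓ} {_≈_ : Rel B 0ℓ} (f : A → B) → (∀ {x y} → x ∼ y → f x ≈ f y) →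
         ∀ {x y} → TransClosure _∼_ x y → TransClosure _≈_ (f x) (f y)
⁺-gmap f h [ s ]    = [ h s ]
⁺-gmap f h (s ∷ ss) = h s ∷ ⁺-gmap f h ss

module _ {S : Signature} (T : TRS S) where

  Step-· : ∀ {t s} (σ : ℕ → Term S ℕ) → Step T t s → Step T (t · σ) (s · σ)
  Step-· σ (contract ρ τ)          = subst₂ (Step T) (sym (·-assoc (lhs T ρ) τ σ)) (sym (·-assoc (rhs T ρ) τ σ))
                                       (contract ρ (λ x → τ x · σ))
  Step-· σ (inside f ts i {u} s)   = subst (Step T _) (cong (fn f) (sym (·*-update ts i u σ)))
    (inside f (ts ·* σ) i (subst (λ t → Step T t (u · σ)) (sym (lookup-·* ts σ i)) (Step-· σ s)))

  Step-arg : ∀ f ts i {u v} → Step T u v → Step T (fn f (ts [ i ]≔ u)) (fn f (ts [ i ]≔ v))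
  Step-arg f ts i {u} {v} s = subst (Step T _) (cong (fn f) ([]≔-idempotent ts i))
    (inside f (ts [ i ]≔ u) i (subst (λ t → Step T t v) (sym (lookup∘update i ts u)) s))

  Star-arg : ∀ f ts i {u} → Star (Step T) (lookup ts i) u → Star (Step T) (fn f ts) (fn f (ts [ i ]≔ u))
  Star-arg f ts i {u} ss = subst (λ us → Star (Step T) (fn f us) (fn f (ts [ i ]≔ u))) ([]≔-lookup ts i)
    (Star.gmap (λ u → fn f (ts [ i ]≔ u)) (Step-arg f ts i) ss)

  Star-fn : ∀ f {ts us} → (∀ i → Star (Step T) (lookup ts i) (lookup us i)) → Star (Step T) (fn f ts) (fn f us)
  Star-fn f {ts} {us} h = entrywise (λ xs ys → Star (Step T) (fn f xs) (fn f ys)) ε _◅◅_ (λ _ _ → ⊤) ts us _ _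
    λ xs i _ e → Star-arg f xs i (subst (λ x → Star (Step T) x _) (sym e) (h i))

  Star-·-cong : ∀ {V} (t : Term S V) {σ τ : V → Term S ℕ} → (∀ z → Star (Step T) (σ z) (τ z)) →
                Star (Step T) (t · σ) (t · τ)
  Star-·-cong t {σ} {τ} h = term-induction (λ t → Star (Step T) (t · σ) (t · τ)) h
    (λ f ts ih → Star-fn f λ i → subst₂ (Star (Step T)) (sym (lookup-·* ts σ i)) (sym (lookup-·* ts τ i)) (ih i)) t

  module _ (R : TRS S) where
    open Proofterms R

    Only⇒Star : ∀ {Q} → (∀ {ρ} → Q ρ → ∀ σ → Step T (lhs R ρ · σ) (rhs R ρ · σ)) →
                ∀ {Φ} → Only Q Φ → Star (Step T) (src R Φ) (tgt R Φ)
    Only⇒Star h only-var = ε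
    Only⇒Star h (fun {f} {Φs} os) = Star-fn f λ i →
      subst₂ (Star (Step T)) (sym (lookup-unfold* R (lhs R) Φs i)) (sym (lookup-unfold* R (rhs R) Φs i)) (Only⇒Star h (os i))
    Only⇒Star h (rule {ρ} {Φs} q os) = Star-·-cong (lhs R ρ) (λ x →
      subst₂ (Star (Step T)) (sym (lookup-unfold* R (lhs R) Φs x)) (sym (lookup-unfold* R (rhs R) Φs x)) (Only⇒Star h (os x)))
      ◅◅ h q (lookup (unfold* R (rhs R) Φs)) ◅ ε

module Peaks (em : ExcludedMiddle 0ℓ) {S : Signature} (R : TRS S) (labelling : RuleLabelling R) where

  open Proofterms R
  open Unification em R
  open RuleLabelling labelling

  private
    T : Set
    T = Term S ℕ

    Cstep : Rel T 0ℓ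
    Cstep = Step (subsystem R C)

  infix 4 _⊏_

  -- The converse of the hot-order with a single label in place of each set of maximal labels; ranks
  -- are taken in this relation.
  data _⊏_ : Rel (T ⊎ L) 0ℓ where
    terms      : ∀ {t s} → TransClosure Cstep t s → inj₁ s ⊏ inj₁ t
    labels     : ∀ {a b} → a ≻ b → inj₂ b ⊏ inj₂ a
    term⊏label : ∀ {t a} → inj₁ t ⊏ inj₂ a

  ⊏-wellFounded : WellFounded _⊏_
  ⊏-wellFounded = λ { (inj₁ t) → acc-term t ; (inj₂ a) → acc-label (≻-wellFounded a) }
    where
    ⁺-flip : ∀ {t s} → TransClosure Cstep t s → TransClosure (flip Cstep) s t
    ⁺-flip [ s ]    = [ s ]
    ⁺-flip (s ∷ ss) = ⁺-flip ss ∷ʳ s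

    acc-term : ∀ t → Acc _⊏_ (inj₁ t)
    acc-term t = go (Trans.wellFounded _ C-terminating t)
      where
      go : ∀ {t} → Acc (TransClosure (flip Cstep)) t → Acc _⊏_ (inj₁ t)
      go (acc rs) = acc λ { (terms ss) → go (rs (⁺-flip ss)) }

    acc-label : ∀ {a} → Acc (flip _≻_) a → Acc _⊏_ (inj₂ a)
    acc-label (acc rs) = acc λ { (labels a≻b) → acc-label (rs a≻b) ; term⊏label → acc-term _ }

  open Rank em _⊏_

  record MStep (Q : Rule R → Set) (t s : T) : Set where
    constructor mstep
    field
      multistep : Proofterm R ℕ
      onlyQ     : Only Q multistep
      src≡      : src R multistep ≡ t
      tgt≡      : tgt R multistep ≡ s

  open MStep

  MStep-map : ∀ {P Q t s} → (∀ {ρ} → P ρ → Q ρ) → MStep P t s → MStep Q t s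
  MStep-map h (mstep Φ o e e′) = mstep Φ (Only-map h o) e e′

  MStep-refl : ∀ {Q t} → MStep Q t t
  MStep-refl {t = t} = mstep (⌈_⌉ R t) (Only-⌈⌉ t) (unfold-⌈⌉ R _ t) (unfold-⌈⌉ R _ t)

  MStep-rule : ∀ {Q} ρ → Q ρ → ∀ σ → MStep Q (lhs R ρ · σ) (rhs R ρ · σ)
  MStep-rule ρ q σ = mstep (fn (inj₂ ρ) Φs)
    (rule q λ x → subst (Only _) (sym (lookup∘tabulate (⌈_⌉ R ∘ σ) x)) (Only-⌈⌉ (σ x))) (eq (lhs R)) (eq (rhs R))
    where
    Φs = tabulate (⌈_⌉ R ∘ σ)
    eq : ∀ side → unfold R side (fn (inj₂ ρ) Φs) ≡ side ρ · σ
    eq side = trans (unfold-redex side ρ Φs) (·-cong (side ρ) λ x →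
      trans (cong (unfold R side) (lookup∘tabulate (⌈_⌉ R ∘ σ) x)) (unfold-⌈⌉ R side (σ x)))

  MStep-· : ∀ {Q t s σ τ} → MStep Q t s → (∀ z → MStep Q (σ z) (τ z)) → MStep Q (t · σ) (s · τ)
  MStep-· (mstep Φ o refl refl) h = mstep (Φ · (multistep ∘ h)) (Only-· o (onlyQ ∘ h))
    (trans (unfold-· R (lhs R) Φ _) (·-cong (src R Φ) (src≡ ∘ h)))
    (trans (unfold-· R (rhs R) Φ _) (·-cong (tgt R Φ) (tgt≡ ∘ h)))

  MStep-arg : ∀ {Q} f ts i {u v} → MStep Q u v → MStep Q (fn f (ts [ i ]≔ u)) (fn f (ts [ i ]≔ v))
  MStep-arg f ts i (mstep Φ o refl refl) = mstep (fn (inj₁ f) (⌈_⌉* R ts [ i ]≔ Φ))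
    (fun (Only-update (⌈_⌉* R ts) i (λ j → subst (Only _) (sym (lookup-⌈⌉* ts j)) (Only-⌈⌉ _)) o))
    (cong (fn f) (unfold*-update R (lhs R) ts i Φ)) (cong (fn f) (unfold*-update R (rhs R) ts i Φ))

  -- cold: only rules in C, and every source has to be reachable by them from
  -- a given term; hot: only rules satisfying Q.
  data Kind : Set₁ where
    cold : Kind
    hot  : (Q : Rule R → Set) → Kind

  class : Kind → Rule R → Set
  class cold    = C
  class (hot Q) = Q

  -- Only term labels depend on the source of a step, so reachability carries no information for hot
  -- kinds. In the cold case `R⁺` is exactly what makes the label of one source smaller than that of
  -- another.
  R* R⁺ : Kind → Rel T 0ℓ
  R* cold    = Star Cstep
  R* (hot _) = λ _ _ → ⊤
  R⁺ cold    = TransClosure Cstep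
  R⁺ (hot _) = λ _ _ → ⊤

  R*-refl : ∀ k {t} → R* k t t
  R*-refl cold    = ε
  R*-refl (hot _) = tt

  R*-trans : ∀ k {t s u} → R* k t s → R* k s u → R* k t u
  R*-trans cold    = _◅◅_
  R*-trans (hot _) = _

  R*-R⁺-trans : ∀ k {t s u} → R* k t s → R⁺ k s u → R⁺ k t u
  R*-R⁺-trans cold    = _*++⁺_
  R*-R⁺-trans (hot _) = _

  R⁺⇒R* : ∀ k {t s} → R⁺ k t s → R* k t s
  R⁺⇒R* cold    = ⁺⇒*
  R⁺⇒R* (hot _) = _

  R*-· : ∀ k {t s} σ → R* k t s → R* k (t · σ) (s · σ)
  R*-· cold    σ = Star.gmap (_· σ) (Step-· _ σ)
  R*-· (hot _) σ = _

  R⁺-· : ∀ k {t s} σ → R⁺ k t s → R⁺ k (t · σ) (s · σ)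
  R⁺-· cold    σ = ⁺-gmap (_· σ) (Step-· _ σ)
  R⁺-· (hot _) σ = _

  R*-·-cong : ∀ k {V} (t : Term S V) {σ τ} → (∀ z → R* k (σ z) (τ z)) → R* k (t · σ) (t · τ)
  R*-·-cong cold    t h = Star-·-cong _ t h
  R*-·-cong (hot _) t h = tt

  R*-fn : ∀ k f {ts us} → (∀ i → R* k (lookup ts i) (lookup us i)) → R* k (fn f ts) (fn f us)
  R*-fn cold    f h = Star-fn _ f h
  R*-fn (hot _) f h = tt

  R⁺-arg : ∀ k f ts i {u v} → R⁺ k u v → R⁺ k (fn f (ts [ i ]≔ u)) (fn f (ts [ i ]≔ v))
  R⁺-arg cold    f ts i = ⁺-gmap (λ u → fn f (ts [ i ]≔ u)) (Step-arg _ f ts i)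
  R⁺-arg (hot _) f ts i = _

  MStep⇒R* : ∀ k {t s} → MStep (class k) t s → R* k t s
  MStep⇒R* cold    (mstep Φ o refl refl) = Only⇒Star (subsystem R C) R (λ c σ → contract (_ , c) σ) o
  MStep⇒R* (hot _) _                     = tt

  Below : Kind → T → Rel T 0ℓ
  Below k t x y = R⁺ k t x × MStep (class k) x y

  Conv : Kind → T → Rel T 0ℓ
  Conv k t = EqClosure (Below k t)

  Conv-sym : ∀ k {t x y} → Conv k t x y → Conv k t y x
  Conv-sym k = Eq.symmetric _

  Conv-weaken : ∀ k {t s x y} → R* k t s → Conv k s x y → Conv k t x y
  Conv-weaken k r = Eq.map λ (r′ , m) → R*-R⁺-trans k r r′ , m

  -- A forward step is itself a sequence of `C`-steps in the cold case; a backward step leads to its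
  -- own source, which is reachable by definition of `Below`.
  Conv-reach : ∀ k {t x y} → R* k t x → Conv k t x y → R* k t y
  Conv-reach k r ε                     = r
  Conv-reach k r (fwd (r′ , m) ◅ c)    = Conv-reach k (R*-trans k r (MStep⇒R* k m)) c
  Conv-reach k r (bwd (r′ , m) ◅ c)    = Conv-reach k (R⁺⇒R* k r′) c

  Conv-· : ∀ k {t x y} σ → Conv k t x y → Conv k (t · σ) (x · σ) (y · σ)
  Conv-· k σ = Eq.gmap (_· σ) λ (r , m) → R⁺-· k σ r , MStep-· m λ _ → MStep-refl

  -- Arguments are converted one at a time. While argument `i` is converted, strict reachability
  -- from `fn f ts` is obtained by first rewriting the other arguments, with entry `i` still
  -- `lookup ts i`, and then using strict reachability inside argument `i`.
  Conv-fn : ∀ k f {ts xs ys} → (∀ i → R* k (lookup ts i) (lookup xs i)) →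
            (∀ i → Conv k (lookup ts i) (lookup xs i) (lookup ys i)) → Conv k (fn f ts) (fn f xs) (fn f ys)
  Conv-fn k f {ts} {xs} {ys} r c =
    entrywise (λ us vs → Conv k (fn f ts) (fn f us) (fn f vs)) ε _◅◅_ (λ i u → R* k (lookup ts i) u) xs ys
      r (λ i → Conv-reach k (r i) (c i)) λ zs i rs e →
      subst (λ us → Conv k (fn f ts) (fn f us) _) (trans (cong (zs [ i ]≔_) (sym e)) ([]≔-lookup zs i))
        (Eq.gmap (λ u → fn f (zs [ i ]≔ u))
          (λ {u} (r⁺ , m) → R*-R⁺-trans k (reach zs i rs) (R⁺-arg k f zs i r⁺) , MStep-arg f zs i m) (c i))
    where
    reach : ∀ zs i → (∀ j → R* k (lookup ts j) (lookup zs j)) → R* k (fn f ts) (fn f (zs [ i ]≔ lookup ts i))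
    reach zs i rs = R*-fn k f λ j → go j
      where
      go : ∀ j → R* k (lookup ts j) (lookup (zs [ i ]≔ lookup ts i) j)
      go j with j ≟ᶠ i
      ... | yes refl = subst (R* k _) (sym (lookup∘update j zs _)) (R*-refl k)
      ... | no j≢i   = subst (R* k _) (sym (lookup∘update′ j≢i zs _)) (rs j)

  Conv-·-cong : ∀ k {V} (t : Term S V) {τ σ σ′} → (∀ z → R* k (τ z) (σ z)) →
                (∀ z → Conv k (τ z) (σ z) (σ′ z)) → Conv k (t · τ) (t · σ) (t · σ′)
  Conv-·-cong k t {τ} {σ} {σ′} r c = term-induction (λ t → Conv k (t · τ) (t · σ) (t · σ′)) c
    (λ f ts ih → Conv-fn k f
      (λ i → subst₂ (R* k) (sym (lookup-·* ts τ i)) (sym (lookup-·* ts σ i)) (R*-·-cong k (lookup ts i) r))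
      (λ i → subst₂ (λ x (y , z) → Conv k x y z) (sym (lookup-·* ts τ i))
        (cong₂ _,_ (sym (lookup-·* ts σ i)) (sym (lookup-·* ts σ′ i))) (ih i))) t

  -- The mode of a multistep: only rules in C, or only rules in C and rules
  -- whose label has at most the rank of a.
  data Mode : Set where
    cold : Mode
    hot  : L → Mode

  Allowed : Mode → Rule R → Set
  Allowed cold    ρ = C ρ
  Allowed (hot a) ρ = ∀ (ρ∉C : ¬ C ρ) → inj₂ (label ρ ρ∉C) ≼ inj₂ a

  below : Mode → Kind
  below cold    = cold
  below (hot a) = hot λ ρ → ∀ (ρ∉C : ¬ C ρ) → inj₂ (label ρ ρ∉C) ≺ inj₂ a

  -- Meant for kinds of the form `below m`: the hot ones among them contain all `C`-rules, so they
  -- absorb the cold kind.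
  joint : Kind → Kind → Kind
  joint cold    k       = k
  joint (hot P) cold    = hot P
  joint (hot P) (hot Q) = hot λ ρ → P ρ ⊎ Q ρ

  C⇒class : ∀ m {ρ} → C ρ → class (below m) ρ
  C⇒class cold    c = c
  C⇒class (hot a) c = λ ρ∉C → ⊥-elim (ρ∉C c)

  Allowed⇒R* : ∀ m {t s} → MStep (Allowed m) t s → R* (below m) t s
  Allowed⇒R* cold    = MStep⇒R* cold
  Allowed⇒R* (hot _) = _

  R*-jointˡ : ∀ k k′ {t s} → R* k t s → R* (joint k k′) t s
  R*-jointˡ cold    cold    r = r
  R*-jointˡ cold    (hot _) r = tt
  R*-jointˡ (hot _) cold    r = tt
  R*-jointˡ (hot _) (hot _) r = tt

  R*-jointʳ : ∀ k k′ {t s} → R* k′ t s → R* (joint k k′) t s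
  R*-jointʳ cold    k′      r = r
  R*-jointʳ (hot _) cold    r = tt
  R*-jointʳ (hot _) (hot _) r = tt

  Conv-joint-comm : ∀ k k′ {t x y} → Conv (joint k k′) t x y → Conv (joint k′ k) t x y
  Conv-joint-comm cold    cold    = id
  Conv-joint-comm cold    (hot _) = id
  Conv-joint-comm (hot _) cold    = id
  Conv-joint-comm (hot _) (hot _) = Eq.map λ (r , m) → r , MStep-map Sum.swap m

  -- step₁ and step₂ need not have a label equivalent to that of the peak: if it
  -- is smaller, they become part of the conversions.
  record Decreasing (m n : Mode) (t s u : T) : Set where
    field
      {s′ v w u′} : T
      conv₁  : Conv (below m) t s s′
      step₁  : MStep (Allowed n) s′ v
      conv₂  : Conv (joint (below m) (below n)) t v w
      step₂  : MStep (Allowed m) u′ w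
      conv₃  : Conv (below n) t u u′
      reach₁ : R* (below m) t s
      reach₂ : R* (below n) t u

    reach-s′ : R* (below m) t s′
    reach-s′ = Conv-reach (below m) reach₁ conv₁

    reach-v : R* (joint (below m) (below n)) t v
    reach-v = R*-trans (joint (below m) (below n)) (R*-jointˡ (below m) (below n) reach-s′)
                (R*-jointʳ (below m) (below n) (Allowed⇒R* n step₁))

    reach-u′ : R* (below n) t u′
    reach-u′ = Conv-reach (below n) reach₂ conv₃

  open Decreasing

  Decreasing-sym : ∀ {m n t s u} → Decreasing m n t s u → Decreasing n m t u s
  Decreasing-sym {m} {n} d = record
    { conv₁  = conv₃ d
    ; step₁  = step₂ d
    ; conv₂  = Conv-joint-comm (below m) (below n) (Conv-sym (joint (below m) (below n)) (conv₂ d))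
    ; step₂  = step₁ d
    ; conv₃  = conv₁ d
    ; reach₁ = reach₂ d
    ; reach₂ = reach₁ d
    }

  Decreasing-refl : ∀ {m n t} → Decreasing m n t t t
  Decreasing-refl {m} {n} = record
    { conv₁ = ε ; step₁ = MStep-refl ; conv₂ = ε ; step₂ = MStep-refl ; conv₃ = ε
    ; reach₁ = R*-refl (below m) ; reach₂ = R*-refl (below n) }

  -- First the substitution is converted under the fixed term `x`, then `x` is converted under the
  -- final substitution `σ′`. The second part refers to `t · σ′`, which is reachable from `t · τ`.
  Conv-∘ : ∀ k {t x y} {τ σ σ′ : ℕ → T} → R* k t x → Conv k t x y → (∀ z → R* k (τ z) (σ z)) →
           (∀ z → Conv k (τ z) (σ z) (σ′ z)) → Conv k (t · τ) (x · σ) (y · σ′)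
  Conv-∘ k {t} {x} {y} {τ} {σ} {σ′} r c rs cs =
    Conv-weaken k (R*-· k τ r) (Conv-·-cong k x rs cs) ◅◅
    Conv-weaken k (R*-·-cong k t λ z → Conv-reach k (rs z) (cs z)) (Conv-· k σ′ c)

  -- A substitution instance of a multistep by multisteps is one multistep, so `step₁` and `step₂`
  -- of all the peaks combine in parallel, while the three conversions are composed by `Conv-∘`.
  Decreasing-· : ∀ {m n t s u} {τ σ υ : ℕ → T} → Decreasing m n t s u →
                 (∀ z → Decreasing m n (τ z) (σ z) (υ z)) → Decreasing m n (t · τ) (s · σ) (u · υ)
  Decreasing-· {m} {n} {t} {s} {u} {τ} {σ} {υ} d ds = record
    { conv₁  = Conv-∘ (below m) (reach₁ d) (conv₁ d) (λ z → reach₁ (ds z)) (λ z → conv₁ (ds z))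
    ; step₁  = MStep-· (step₁ d) (λ z → step₁ (ds z))
    ; conv₂  = Conv-∘ (joint (below m) (below n)) (reach-v d) (conv₂ d) (λ z → reach-v (ds z)) (λ z → conv₂ (ds z))
    ; step₂  = MStep-· (step₂ d) (λ z → step₂ (ds z))
    ; conv₃  = Conv-∘ (below n) (reach₂ d) (conv₃ d) (λ z → reach₂ (ds z)) (λ z → conv₃ (ds z))
    ; reach₁ = R*-trans (below m) (R*-· (below m) τ (reach₁ d)) (R*-·-cong (below m) s λ z → reach₁ (ds z))
    ; reach₂ = R*-trans (below n) (R*-· (below n) τ (reach₂ d)) (R*-·-cong (below n) u λ z → reach₂ (ds z))
    }

  OverlaysDecreasing : Set
  OverlaysDecreasing = ∀ {m n} (o : Overlap R) → let open Overlap o in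
    p ≡ root → Allowed m ρ → Allowed n θ → Decreasing m n (ℓ · σ) (r · σ) (replace ℓ p d · σ)

  -- The reachability component is vacuous for hot modes. In the cold mode it permits conversions
  -- that refer to the source after the inner step to be referred back to the original source.
  OuterInnerConversions : Set
  OuterInnerConversions = ∀ {m} (o : Overlap R) → let open Overlap o in
    p ≢ root → Allowed m ρ → R* (below m) (ℓ · σ) (replace ℓ p d · σ) ×
      ∃ λ w → Conv (below m) (ℓ · σ) (r · σ) w × MStep (Allowed m) (replace ℓ p d · σ) w

-- Auxiliary facts on lists, paths and functions

++-compare : ∀ {A : Set} (as bs : List A) {cs ds} → as ++ cs ≡ bs ++ ds →
             (∃ λ es → bs ≡ as ++ es × cs ≡ es ++ ds) ⊎ (∃ λ es → as ≡ bs ++ es × ds ≡ es ++ cs)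
++-compare []       bs       e = inj₁ (bs , refl , e)
++-compare (a ∷ as) []       e = inj₂ (a ∷ as , refl , sym e)
++-compare (a ∷ as) (b ∷ bs) e with ∷-injective e
... | refl , e′ with ++-compare as bs e′
...   | inj₁ (es , p , q) = inj₁ (es , cong (a ∷_) p , q)
...   | inj₂ (es , p , q) = inj₂ (es , cong (a ∷_) p , q)

module _ (em : ExcludedMiddle 0ℓ) where

  -- The fuel `k` bounds by how much the current path can still be outgrown, and each improvement
  -- uses up at least one unit.
  longest : (P : Path → Set) (N : ℕ) → (∀ {π} → P π → length π ≤ N) → ∃ P →
            ∃ λ π → P π × (∀ {π′} → P π′ → length π′ ≤ length π)
  longest P N bounded (π , p) = go N p (m≤n+m N (length π))
    where
    go : ∀ k {π} → P π → N ≤ length π + k → ∃ λ π → P π × (∀ {π′} → P π′ → length π′ ≤ length π)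
    go zero {π} p N≤ = π , p , λ q → ≤-trans (bounded q) (≤-trans N≤ (≤-reflexive (+-identityʳ (length π))))
    go (suc k) {π} p N≤ with em {∃ λ π′ → P π′ × length π < length π′}
    ... | yes (π′ , q , π<π′) = go k q (≤-trans N≤ (≤-trans (≤-reflexive (+-suc (length π) k)) (+-monoˡ-≤ k π<π′)))
    ... | no ¬longer = π , p , λ {π′} q → by-contradiction em λ π′≰π → ¬longer (π′ , q , ≰⇒> π′≰π)

  module _ {Z A : Set} (ι : Z → ℕ) where

    -- Peaks are over terms with variables in ℕ. Rule variables are embedded by `ι`, and a
    -- substitution for them is extended by a default outside the image.
    extend : (Z → A) → (ℕ → A) → ℕ → A
    extend g d n with em {∃ λ z → ι z ≡ n}
    ... | yes (z , _) = g z
    ... | no _        = d n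

    extend-ι : (∀ {y z} → ι y ≡ ι z → y ≡ z) → ∀ g d z → extend g d (ι z) ≡ g z
    extend-ι inj g d z with em {∃ λ y → ι y ≡ ι z}
    ... | yes (y , e) = cong g (inj e)
    ... | no ∄        = ⊥-elim (∄ (z , refl))

    extend-elim₂ : ∀ {P : A → A → Set} {g h d d′} → (∀ z → P (g z) (h z)) → (∀ n → P (d n) (d′ n)) →
                   ∀ n → P (extend g d n) (extend h d′ n)
    extend-elim₂ pz pn n with em {∃ λ z → ι z ≡ n}
    ... | yes (z , _) = pz z
    ... | no _        = pn n

    extend-elim : ∀ {P : A → Set} {g d} → (∀ z → P (g z)) → (∀ n → P (d n)) → ∀ n → P (extend g d n)
    extend-elim {P} {g} {d} = extend-elim₂ {λ a _ → P a} {g} {g} {d} {d}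

-- Orthogonal peaks of multisteps

module Orthogonality (em : ExcludedMiddle 0ℓ) {S : Signature} (R : TRS S) (labelling : RuleLabelling R)
                     (linear : ∀ ρ → Lin (lhs R ρ)) where

  open Proofterms R
  open Unification em R
  open Peaks em R labelling

  lhs-Fun : ∀ ρ → Fun (lhs R ρ) []
  lhs-Fun ρ with lhs R ρ in e
  ... | var x   = ⊥-elim (non-var R ρ x e)
  ... | fn f ts = f , ts , []

  lhs-occurs : ∀ ρ x → Occurs x (lhs R ρ)
  lhs-occurs ρ x = let p , e = occurs R ρ x in path p , subst (At _ _) e (path-At p)

  src-redex≢var : ∀ {V ρ x} (Φs : Vec (Proofterm R V) _) → src R (fn (inj₂ ρ) Φs) ≢ var x
  src-redex≢var {ρ = ρ} Φs e with lhs R ρ | lhs-Fun ρ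
  src-redex≢var Φs () | fn f ts | _

  Mark-root : ∀ {V} {Φ : Proofterm R V} {π ρ Φs} → Red Φ π ρ Φs → Mark Φ π
  Mark-root {ρ = ρ} r = subst (Mark _) (++-identityʳ _) (mark r (lhs-Fun ρ))

  Disjoint : ∀ {V} → Proofterm R V → Proofterm R V → Set
  Disjoint Φ Ψ = ∀ {π} → Mark Φ π → ¬ Mark Ψ π

  ⌈⌉-rename : ∀ {V W U : Set} (t : Term S V) (h : V → W) (δ : W → Proofterm R U) →
              ⌈_⌉ R (t · (var ∘ h)) · δ ≡ ⌈_⌉ R t · (δ ∘ h)
  ⌈⌉-rename t h δ = trans (cong (_· δ) (⌈⌉-· t (var ∘ h))) (·-assoc (⌈_⌉ R t) (var ∘ h) δ)

  redex-· : ∀ {V W : Set} ρ (h : Fin (vars R ρ) → V) (δ : V → Proofterm R W) {Φs} →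
            (∀ x → δ (h x) ≡ lookup Φs x) → fn (inj₂ ρ) (tabulate (var ∘ h)) · δ ≡ fn (inj₂ ρ) Φs
  redex-· ρ h δ e = cong (fn (inj₂ ρ)) (·*-lookup (tabulate (var ∘ h)) λ x →
    trans (cong (_· δ) (lookup∘tabulate (var ∘ h) x)) (e x))

  ⌈fn⌉-lookup : ∀ {V} f (Φs : Vec (Proofterm R V) _) →
                ⌈_⌉ R (fn f (tabulate var)) · lookup Φs ≡ fn (inj₁ f) Φs
  ⌈fn⌉-lookup f Φs = cong (fn (inj₁ f)) (·*-lookup (⌈_⌉* R (tabulate var)) λ i →
    cong (_· lookup Φs) (trans (lookup-⌈⌉* (tabulate var) i) (cong (⌈_⌉ R) (lookup∘tabulate var i))))

  Decreasing-proofterm-· : ∀ {m n} Φ Ψ {δ δ′ : ℕ → Proofterm R ℕ} → Decreasing m n (src R Φ) (tgt R Φ) (tgt R Ψ) →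
    (∀ z → Decreasing m n (src R (δ z)) (tgt R (δ z)) (tgt R (δ′ z))) →
    Decreasing m n (src R (Φ · δ)) (tgt R (Φ · δ)) (tgt R (Ψ · δ′))
  Decreasing-proofterm-· Φ Ψ {δ} {δ′} d ds =
    subst₂ (λ t (s , u) → Decreasing _ _ t s u) (sym (unfold-· R (lhs R) Φ δ))
      (cong₂ _,_ (sym (unfold-· R (rhs R) Φ δ)) (sym (unfold-· R (rhs R) Ψ δ′))) (Decreasing-· d ds)

  Peak : ∀ (m n : Mode) (Φ Ψ : Proofterm R ℕ) → Set
  Peak m n Φ Ψ = Decreasing m n (src R Φ) (tgt R Φ) (tgt R Ψ)

  toℕ-extend : ∀ {k} {A : Set} → (Fin k → A) → (ℕ → A) → ℕ → A
  toℕ-extend = extend em toℕ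

  toℕ-extend-toℕ : ∀ {k} {A : Set} (g : Fin k → A) d i → toℕ-extend g d (toℕ i) ≡ g i
  toℕ-extend-toℕ = extend-ι em toℕ toℕ-injective

  ⌈⌉-toℕ : ∀ {k} (t : Term S (Fin k)) (g : Fin k → Proofterm R ℕ) →
           ⌈_⌉ R (t · (var ∘ toℕ)) · toℕ-extend g var ≡ ⌈_⌉ R t · g
  ⌈⌉-toℕ t g = trans (⌈⌉-rename t toℕ (toℕ-extend g var)) (·-cong (⌈_⌉ R t) (toℕ-extend-toℕ g var))

  -- A case of closure under composition: the trivial peak at `f` applied to distinct variables is
  -- instantiated by the peaks of the arguments.
  Peak-fn : ∀ {m n} f Φs Ψs → (∀ i → Peak m n (lookup Φs i) (lookup Ψs i)) →
            Peak m n (fn (inj₁ f) Φs) (fn (inj₁ f) Ψs)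
  Peak-fn {m} {n} f Φs Ψs peaks = subst₂ (Peak m n) (eq Φs) (eq Ψs)
    (Decreasing-proofterm-· (⌈_⌉ R t) (⌈_⌉ R t)
      (subst₂ (λ s u → Decreasing m n s u u) (sym (unfold-⌈⌉ R (lhs R) t)) (sym (unfold-⌈⌉ R (rhs R) t)) Decreasing-refl)
      (extend-elim₂ em toℕ {P = Peak m n} {lookup Φs} {lookup Ψs} {var} {var} peaks λ _ → Decreasing-refl))
    where
    t = fn f (tabulate var) · (var ∘ toℕ)
    eq : ∀ Φs → ⌈_⌉ R t · toℕ-extend (lookup Φs) var ≡ fn (inj₁ f) Φs
    eq Φs = trans (⌈⌉-toℕ (fn f (tabulate var)) (lookup Φs)) (⌈fn⌉-lookup f Φs)

  -- The composed outer peak contracts `ρ` on one side and is empty on the other; it is closed by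
  -- contracting `ρ` from the empty side.
  Peak-rule : ∀ {m n} ρ Φs (Ψs : Fin (vars R ρ) → Proofterm R ℕ) → Allowed m ρ → (∀ x → Peak m n (lookup Φs x) (Ψs x)) →
              Peak m n (fn (inj₂ ρ) Φs) (⌈_⌉ R (lhs R ρ) · Ψs)
  Peak-rule {m} {n} ρ Φs Ψs q peaks =
    subst₂ (Peak m n) (redex-· ρ toℕ (toℕ-extend (lookup Φs) var) {Φs} (toℕ-extend-toℕ (lookup Φs) var)) (⌈⌉-toℕ (lhs R ρ) Ψs)
      (Decreasing-proofterm-· (fn (inj₂ ρ) (tabulate (var ∘ toℕ))) (⌈_⌉ R (lhs R ρ · (var ∘ toℕ)))
        (subst₂ (λ t (s , u) → Decreasing m n t s u) (sym (unfold-rule R (lhs R) ρ toℕ))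
          (cong₂ _,_ (sym (unfold-rule R (rhs R) ρ toℕ)) (sym (unfold-⌈⌉ R (rhs R) (lhs R ρ · (var ∘ toℕ))))) step)
        (extend-elim₂ em toℕ {P = Peak m n} {lookup Φs} {Ψs} {var} {var} peaks λ _ → Decreasing-refl))
    where
    contracted : MStep (Allowed m) (lhs R ρ · (var ∘ toℕ)) (rhs R ρ · (var ∘ toℕ))
    contracted = MStep-rule ρ q (var ∘ toℕ)
    step : Decreasing m n (lhs R ρ · (var ∘ toℕ)) (rhs R ρ · (var ∘ toℕ)) (lhs R ρ · (var ∘ toℕ))
    step = record { conv₁ = ε ; step₁ = MStep-refl ; conv₂ = ε ; step₂ = contracted ; conv₃ = ε
                  ; reach₁ = Allowed⇒R* m contracted ; reach₂ = R*-refl (below n) }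

  Mark-arg : ∀ {V ρ} {Φs : Vec (Proofterm R V) _} {π x π′} → At (lhs R ρ) π (var x) → Mark (lookup Φs x) π′ →
             Mark (fn (inj₂ ρ) Φs) (π ++ π′)
  Mark-arg {π = π} p (mark {π₁} {π₂} r q) = subst (Mark _) (++-assoc π π₁ π₂) (mark (arg p r) q)

  Mark-fun : ∀ {V f} {Φs : Vec (Proofterm R V) _} i {π} → Mark (lookup Φs i) π → Mark (fn (inj₁ f) Φs) (toℕ i ∷ π)
  Mark-fun i (mark r p) = mark (fun i refl r) p

  Mark-⌈⌉· : ∀ {V W : Set} (t : Term S V) (δ : V → Proofterm R W) {π π′ x} → At t π (var x) → Mark (δ x) π′ →
             Mark (⌈_⌉ R t · δ) (π ++ π′)
  Mark-⌈⌉· t δ p = Mark-beneath (⌈_⌉ R t) δ (subst (λ t → At t _ _) (sym (unfold-⌈⌉ R (lhs R) t)) p)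

  At-size-< : ∀ {V k π} {t u : Term S V} → At t (k ∷ π) u → size u < size t
  At-size-< p = ≤-trans (s≤s (m≤n+m _ _)) (At-size p)

  src-arg-size : ∀ {V} ρ (Φs : Vec (Proofterm R V) _) x → size (src R (lookup Φs x)) < size (src R (fn (inj₂ ρ) Φs))
  src-arg-size ρ Φs x with lhs-occurs ρ x
  ... | k ∷ π , p = At-size-< (At-src-redex Φs p [])
  ... | []    , p with At-functional p (proj₂ (proj₂ (lhs-Fun ρ)))
  ...   | ()

  -- The induction is on the size of the common source, a measure symmetric in Φ and Ψ, since their
  -- roles are exchanged when only Ψ starts with a rule symbol.
  Disjoint⇒Peak : ∀ {m n} k Φ Ψ → size (src R Φ) ≤ k → src R Φ ≡ src R Ψ →
                  Only (Allowed m) Φ → Only (Allowed n) Ψ → Disjoint Φ Ψ → Peak m n Φ Ψ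
  Disjoint⇒Peak-rule : ∀ {m n} k ρ Φs Ψ → size (src R (fn (inj₂ ρ) Φs)) ≤ k → src R (fn (inj₂ ρ) Φs) ≡ src R Ψ →
                  Only (Allowed m) (fn (inj₂ ρ) Φs) → Only (Allowed n) Ψ → Disjoint (fn (inj₂ ρ) Φs) Ψ →
                  Peak m n (fn (inj₂ ρ) Φs) Ψ

  Disjoint⇒Peak k (var x) (var y)          le refl oΦ oΨ disj = Decreasing-refl
  Disjoint⇒Peak k (var x) (fn (inj₁ g) Ψs) le ()   oΦ oΨ disj
  Disjoint⇒Peak k (var x) (fn (inj₂ θ) Ψs) le e    oΦ oΨ disj = ⊥-elim (src-redex≢var Ψs (sym e))
  Disjoint⇒Peak k (fn (inj₁ f) Φs) (var y) le ()   oΦ oΨ disj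
  Disjoint⇒Peak (suc k) (fn (inj₁ f) Φs) (fn (inj₁ g) Ψs) (s≤s le) e (fun oΦ) (fun oΨ) disj with fn-injective e
  ... | refl , e′ = Peak-fn f Φs Ψs λ i → Disjoint⇒Peak k (lookup Φs i) (lookup Ψs i)
    (≤-trans (subst (λ t → size t ≤ _) (lookup-unfold* R (lhs R) Φs i) (size-lookup (unfold* R (lhs R) Φs) i)) le)
    (trans (sym (lookup-unfold* R (lhs R) Φs i)) (trans (cong (λ ts → lookup ts i) e′) (lookup-unfold* R (lhs R) Ψs i)))
    (oΦ i) (oΨ i) λ m m′ → disj (Mark-fun i m) (Mark-fun i m′)
  Disjoint⇒Peak {m} {n} k Φ@(fn (inj₁ f) Φs) Ψ@(fn (inj₂ θ) Ψs) le e oΦ oΨ disj =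
    subst (λ t → Decreasing m n t (tgt R Φ) (tgt R Ψ)) (sym e) (Decreasing-sym
      (Disjoint⇒Peak-rule k θ Ψs Φ (subst (λ t → size t ≤ k) e le) (sym e) oΨ oΦ λ m m′ → disj m′ m))
  Disjoint⇒Peak k (fn (inj₂ ρ) Φs) Ψ le e oΦ oΨ disj = Disjoint⇒Peak-rule k ρ Φs Ψ le e oΦ oΨ disj

  Disjoint⇒Peak-rule zero ρ Φs Ψ le e oΦ oΨ disj with src R (fn (inj₂ ρ) Φs) in eq
  Disjoint⇒Peak-rule zero ρ Φs Ψ z≤n e oΦ oΨ disj | var x = ⊥-elim (src-redex≢var {ρ = ρ} Φs eq)
  Disjoint⇒Peak-rule {m} {n} (suc k) ρ Φs Ψ le e (rule q oΦ) oΨ disj =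
    subst (Peak m n (fn (inj₂ ρ) Φs)) (sym factors) (Peak-rule ρ Φs arguments q λ x →
      Disjoint⇒Peak k (lookup Φs x) (arguments x) (s≤s⁻¹ (≤-trans (src-arg-size ρ Φs x) le)) (sym (sources x)) (oΦ x) (only x)
        λ m m′ → let π , p = lhs-occurs ρ x in
          disj (Mark-arg {ρ = ρ} {Φs} p m) (subst (λ Ψ → Mark Ψ _) (sym factors) (Mark-⌈⌉· (lhs R ρ) arguments p m′)))
    where
    open Match (match Ψ (lhs R ρ) {src R ∘ lookup Φs} (linear ρ) oΨ (trans (sym e) (unfold-redex (lhs R) ρ Φs))
      -- A redex of Ψ starting inside the pattern of `ρ` would be a shared mark, so Ψ factors
      -- through that pattern.
      λ r p → disj (mark here p) (Mark-root r))

-- Renaming apart and the resolution of overlaps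

module _ {S : Signature} where

  At-rename⁻ : ∀ {V W : Set} {h : V → W} {π z} (t : Term S V) → At (t · (var ∘ h)) π (var z) →
               ∃ λ x → At t π (var x) × z ≡ h x
  At-rename⁻ {h = h} {π} t p with At-·⁻ π t p
  ... | inside _ ()
  ... | beneath {π₁} {x = x} q r with At-var {x = h x} r
  ...   | refl , refl = _ , subst (λ π → At t π _) (sym (++-identityʳ π₁)) q , refl

  Lin-rename : ∀ {V W : Set} {h : V → W} {t : Term S V} → (∀ {x y} → h x ≡ h y → x ≡ y) → Lin t → Lin (t · (var ∘ h))
  Lin-rename {h = h} {t} inj lin p q with At-rename⁻ {h = h} t p | At-rename⁻ {h = h} t q
  ... | x , p′ , e | y , q′ , e′ with inj {x} {y} (trans (sym e) e′)
  ...   | refl = lin p′ q′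

  ·-rename : ∀ {V W U : Set} (t : Term S V) (h : V → W) (σ : W → Term S U) → t · (var ∘ h) · σ ≡ t · (σ ∘ h)
  ·-rename t h σ = ·-assoc t (var ∘ h) σ

module OverlapResolution
  (em : ExcludedMiddle 0ℓ) {S : Signature} (R : TRS S) (labelling : RuleLabelling R)
  (linear : ∀ ρ → Lin (lhs R ρ))
  (overlay : Peaks.OverlaysDecreasing em R labelling)
  (outerInner : Peaks.OuterInnerConversions em R labelling)
  where

  open Proofterms R
  open Unification em R
  open Peaks em R labelling
  open Orthogonality em R labelling linear

  OverlapAt : Proofterm R ℕ → Proofterm R ℕ → Path → Set
  OverlapAt Φ Ψ π = (∃₂ λ ρ Φs → Red Φ π ρ Φs × Mark Ψ π) ⊎ (∃₂ λ ρ Ψs → Red Ψ π ρ Ψs × Mark Φ π)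

  OverlapAt-sym : ∀ {Φ Ψ π} → OverlapAt Φ Ψ π → OverlapAt Ψ Φ π
  OverlapAt-sym = Sum.swap

  -- Of two redexes whose patterns share a position, the root of the lower one lies in the pattern
  -- of the upper one.
  Marks⇒OverlapAt : ∀ {Φ Ψ π} → Mark Φ π → Mark Ψ π → ∃ (OverlapAt Φ Ψ)
  Marks⇒OverlapAt m m′ = go m m′ refl
    where
    go : ∀ {Φ Ψ π π′} → Mark Φ π → Mark Ψ π′ → π ≡ π′ → ∃ (OverlapAt Φ Ψ)
    go (mark {a} {p} r f) (mark {b} {q} r′ f′) e with ++-compare a b e
    ... | inj₁ (c , refl , refl) = _ , inj₂ (_ , _ , r′ , mark r (Fun-prefix c f))
    ... | inj₂ (c , refl , refl) = _ , inj₁ (_ , _ , r , mark r′ (Fun-prefix c f′))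

  Mark-context : ∀ {Φ π ρ Φs ϖ} (A : Context Φ π ρ Φs) → Mark (Context.context A) ϖ →
                 Mark Φ ϖ × (∀ ϖ′ → ϖ ≢ π ++ ϖ′)
  Mark-context A m = subst (λ Φ → Mark Φ _) filled (Mark-· _ m) , λ { ϖ′ refl →
    let _ , _ , p = Mark-Fun m in var-At-prefix _ (Rep-At hole) p }
    where open Context A

  Mark-fill : ∀ {Φ π ρ Φs ϖ} (A : Context Φ π ρ Φs) Y → Mark (Context.context A · fill Y) ϖ →
              Mark (Context.context A) ϖ ⊎ (∃ λ ϖ′ → ϖ ≡ π ++ ϖ′ × Mark Y ϖ′)
  Mark-fill {Φ} {π} A Y m with Mark-·⁻ (Context.context A) m
  ... | within m′ = inj₁ m′
  ... | beneath {z = suc n} p (mark () _)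
  ... | beneath {π₁} {π₂} {zero} p m′ with Rep-elsewhere-var (Context.hole A) p
  ...   | inj₂ q with At-rename⁻ {h = suc} (src R Φ) q
  ...     | _ , _ , ()
  Mark-fill {Φ} {π} A Y m | beneath {π₁} {π₂} {zero} p m′ | inj₁ (π′ , refl)
    with At-var (At-suffix π (Rep-At (Context.hole A)) p)
  ... | refl , _ = inj₂ (π₂ , cong (_++ π₂) (++-identityʳ π) , m′)

  Mark-⌈⌉·⁻ : ∀ {V W : Set} (t : Term S V) {δ : V → Proofterm R W} {π} → Mark (⌈_⌉ R t · δ) π →
              ∃₂ λ π₁ π₂ → ∃ λ x → π ≡ π₁ ++ π₂ × At t π₁ (var x) × Mark (δ x) π₂
  Mark-⌈⌉·⁻ t m with Mark-·⁻ (⌈_⌉ R t) m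
  ... | within m′      = ⊥-elim (Mark-⌈⌉ t m′)
  ... | beneath p m′ = _ , _ , _ , refl , subst (λ t → At t _ _) (unfold-⌈⌉ R (lhs R) t) p , m′

  Red-⌈⌉·⁻ : ∀ {V W : Set} (t : Term S V) {δ : V → Proofterm R W} {π ρ Φs} → Red (⌈_⌉ R t · δ) π ρ Φs →
             ∃₂ λ π₁ π₂ → ∃ λ x → π ≡ π₁ ++ π₂ × At t π₁ (var x) × Red (δ x) π₂ ρ Φs
  Red-⌈⌉·⁻ t r with Red-·⁻ (⌈_⌉ R t) r
  ... | within r′ _   = ⊥-elim (Red-⌈⌉ t r′)
  ... | beneath p r′ = _ , _ , _ , refl , subst (λ t → At t _ _) (unfold-⌈⌉ R (lhs R) t) p , r′

  Red-⌈⌉·-root : ∀ {V W : Set} {t : Term S V} {δ : V → Proofterm R W} {ρ Φs} → Fun t [] → ¬ Red (⌈_⌉ R t · δ) [] ρ Φs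
  Red-⌈⌉·-root (f , ts , []) ()

  plug-root : ∀ {V} {t : Term S V} (p : Pos t) Φ → p ≡ root → plug R t p Φ ≡ Φ
  plug-root root Φ _ = refl

  -- As no overlap is deeper than that of the redex of Ψ at a ++ p with the
  -- redex of Φ at a, neither redex is overlapped from beneath, and both
  -- multisteps factor through the most general unifier.
  module Deepest
    {m n : Mode} {Φ Ψ : Proofterm R ℕ} (same-src : src R Φ ≡ src R Ψ) (oΦ : Only (Allowed m) Φ) (oΨ : Only (Allowed n) Ψ)
    {a p : Path} {ρ : Rule R} {Φs : Vec (Proofterm R ℕ) (vars R ρ)}
    {θ : Rule R} {Ψs : Vec (Proofterm R ℕ) (vars R θ)}
    {f : Symbol S} {ts : Vec (Term S (Fin (vars R ρ))) (arity S f)}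
    (rΦ : Red Φ a ρ Φs) (rΨ : Red Ψ (a ++ p) θ Ψs) (fp : At (lhs R ρ) p (fn f ts))
    (deepest : ∀ {π} → OverlapAt Φ Ψ π → length π ≤ length (a ++ p))
    (ih : ∀ Φ′ Ψ′ → src R Φ′ ≡ src R Ψ′ → Only (Allowed m) Φ′ → Only (Allowed n) Ψ′ →
          (∀ {π} → Mark Φ′ π → Mark Ψ′ π → Mark Φ π × Mark Ψ π × π ≢ a ++ p) → Peak m n Φ′ Ψ′)
    where

    b : Path
    b = a ++ p

    ℓρ = lhs R ρ
    ℓθ = lhs R θ

    ℓp : Term S (Fin (vars R ρ))
    ℓp = fn f ts

    σ : Fin (vars R ρ) → Term S ℕ
    σ x = src R (lookup Φs x)

    τ : Fin (vars R θ) → Term S ℕ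
    τ y = src R (lookup Ψs y)

    -- `X₁` and `X₂` are what remains of Φ and Ψ on the subterm at `b` when the two overlapping
    -- redexes are left uncontracted. They have the same source, and depth makes each of them free
    -- of redexes that start in the pattern of the other.
    redexΦ redexΨ X₁ X₂ : Proofterm R ℕ
    redexΦ = fn (inj₂ ρ) Φs
    redexΨ = fn (inj₂ θ) Ψs
    X₁     = ⌈_⌉ R ℓp · lookup Φs
    X₂     = ⌈_⌉ R ℓθ · lookup Ψs

    allowedρ : Allowed m ρ
    allowedρ = proj₁ (Only-Red oΦ rΦ)

    allowedθ : Allowed n θ
    allowedθ = proj₁ (Only-Red oΨ rΨ)

    only-Φs : ∀ x → Only (Allowed m) (lookup Φs x)
    only-Φs = proj₂ (Only-Red oΦ rΦ)

    only-Ψs : ∀ y → Only (Allowed n) (lookup Ψs y)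
    only-Ψs = proj₂ (Only-Red oΨ rΨ)

    src-redexΦ : src R redexΦ ≡ ℓρ · σ
    src-redexΦ = unfold-redex (lhs R) ρ Φs

    src-redexΨ : src R redexΨ ≡ ℓθ · τ
    src-redexΨ = unfold-redex (lhs R) θ Ψs

    At-a : At (src R Φ) a (ℓρ · σ)
    At-a = subst (At (src R Φ) a) src-redexΦ (Red-src rΦ)

    overlapping : ℓp · σ ≡ ℓθ · τ
    overlapping = At-functional (At-++ At-a (At-· σ fp))
      (subst₂ (λ t u → At t b u) (sym same-src) src-redexΨ (Red-src rΨ))

    src-X₁ : src R X₁ ≡ ℓθ · τ
    src-X₁ = trans (unfold-⌈⌉· (lhs R) ℓp (lookup Φs)) overlapping

    src-X₂ : src R X₂ ≡ ℓp · σ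
    src-X₂ = trans (unfold-⌈⌉· (lhs R) ℓθ (lookup Ψs)) (sym overlapping)

    nothing-deeper : ∀ {π} → π ≢ [] → ¬ OverlapAt Φ Ψ (b ++ π)
    nothing-deeper {[]}    π≢[] o = π≢[] refl
    nothing-deeper {k ∷ π} π≢[] o = 1+n≰n (≤-trans (s≤s (m≤m+n (length b) (length π)))
      (≤-trans (≤-reflexive (trans (sym (+-suc (length b) (length π))) (sym (length-++ b)))) (deepest o)))

    Red-X₁ : ∀ {π ρ′ Φs′} → Red X₁ π ρ′ Φs′ → Red Φ (b ++ π) ρ′ Φs′
    Red-X₁ r with Red-⌈⌉·⁻ ℓp r
    ... | π₁ , π₂ , x , refl , q , r′ = subst (λ π → Red Φ π _ _) eq (Red-++ rΦ (arg (At-++ fp q) r′))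
      where
      eq : a ++ (p ++ π₁) ++ π₂ ≡ b ++ π₁ ++ π₂
      eq = trans (cong (a ++_) (++-assoc p π₁ π₂)) (sym (++-assoc a p (π₁ ++ π₂)))

    Red-X₂ : ∀ {π ρ′ Φs′} → Red X₂ π ρ′ Φs′ → Red Ψ (b ++ π) ρ′ Φs′
    Red-X₂ r with Red-⌈⌉·⁻ ℓθ r
    ... | π₁ , π₂ , y , refl , q , r′ = Red-++ rΨ (arg q r′)

    Mark-X₁ : ∀ {π} → Mark X₁ π → Mark Φ (b ++ π)
    Mark-X₁ (mark {π} {π′} r q) = subst (Mark Φ) (++-assoc b π π′) (mark (Red-X₁ r) q)

    Mark-X₂ : ∀ {π} → Mark X₂ π → Mark Ψ (b ++ π)
    Mark-X₂ (mark {π} {π′} r q) = subst (Mark Ψ) (++-assoc b π π′) (mark (Red-X₂ r) q)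

    Red-X₁≢[] : ∀ {π ρ′ Φs′} → Red X₁ π ρ′ Φs′ → π ≢ []
    Red-X₁≢[] r refl = Red-⌈⌉·-root {t = ℓp} (f , ts , []) r

    Red-X₂≢[] : ∀ {π ρ′ Φs′} → Red X₂ π ρ′ Φs′ → π ≢ []
    Red-X₂≢[] r refl = Red-⌈⌉·-root {t = ℓθ} (lhs-Fun θ) r

    apart₁ : Apart X₁ ℓθ
    apart₁ r q = nothing-deeper (Red-X₁≢[] r) (inj₁ (_ , _ , Red-X₁ r , mark rΨ q))

    apart₂ : Apart X₂ ℓp
    apart₂ {π} r (h , us , q) = nothing-deeper (Red-X₂≢[] r)
      (inj₂ (_ , _ , Red-X₂ r , subst (Mark Φ) (sym (++-assoc a p π)) (mark rΦ (h , us , At-++ fp q))))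

    disjoint-X : Disjoint X₁ X₂
    disjoint-X m₁ m₂ with Marks⇒OverlapAt m₁ m₂
    ... | π , inj₁ (_ , _ , r , m) = nothing-deeper (Red-X₁≢[] r) (inj₁ (_ , _ , Red-X₁ r , Mark-X₂ m))
    ... | π , inj₂ (_ , _ , r , m) = nothing-deeper (Red-X₂≢[] r) (inj₂ (_ , _ , Red-X₂ r , Mark-X₁ m))

    abstract
      match₁ : Match (Allowed m) X₁ ℓθ τ
      match₁ = match X₁ ℓθ {τ} (linear θ) (Only-· (Only-⌈⌉ ℓp) only-Φs) src-X₁ apart₁

      match₂ : Match (Allowed n) X₂ ℓp σ
      match₂ = match X₂ ℓp {σ} (Lin-At (linear ρ) fp) (Only-· (Only-⌈⌉ ℓθ) only-Ψs) src-X₂ apart₂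

    module M₁ = Match match₁
    module M₂ = Match match₂

    Var : Set
    Var = Fin (vars R ρ) ⊎ Fin (vars R θ)

    -- Two solutions in proofterms of the unification problem of the overlap: the actions of Φ and
    -- of Ψ on the variables of both rules.
    Θ₁ Θ₂ : Var → Proofterm R ℕ
    Θ₁ = [ lookup Φs , M₁.arguments ]′
    Θ₂ = [ M₂.arguments , lookup Ψs ]′

    src-Θ : ∀ z → src R (Θ₁ z) ≡ src R (Θ₂ z)
    src-Θ (inj₁ x) = sym (M₂.sources x)
    src-Θ (inj₂ y) = M₁.sources y

    only-Θ₁ : ∀ z → Only (Allowed m) (Θ₁ z)
    only-Θ₁ (inj₁ x) = only-Φs x
    only-Θ₁ (inj₂ y) = M₁.only y

    only-Θ₂ : ∀ z → Only (Allowed n) (Θ₂ z)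
    only-Θ₂ (inj₁ x) = M₂.only x
    only-Θ₂ (inj₂ y) = only-Ψs y

    -- A shared mark at a variable of `ℓp` or of `θ` would be one of `X₁` and `X₂`. On the other
    -- variables of `ρ`, `Θ₂` is empty: what Ψ does there stays in the context around its redex.
    disjoint-Θ : ∀ z → Disjoint (Θ₁ z) (Θ₂ z)
    disjoint-Θ (inj₁ x) {π} m₁ m₂ = go em
      where
      go : Dec (Occurs x ℓp) → ⊥
      go (yes (ϖ , q)) = disjoint-X (Mark-⌈⌉· ℓp (lookup Φs) q m₁)
        (subst (λ X → Mark X (ϖ ++ π)) (sym M₂.factors) (Mark-⌈⌉· ℓp M₂.arguments q m₂))
      go (no ∉ℓp)      = Mark-⌈⌉ (σ x) (subst (λ X → Mark X π) (M₂.default x ∉ℓp) m₂)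
    disjoint-Θ (inj₂ y) {π} m₁ m₂ = let ϖ , q = lhs-occurs θ y in
      disjoint-X (subst (λ X → Mark X (ϖ ++ π)) (sym M₁.factors) (Mark-⌈⌉· ℓθ M₁.arguments q m₁))
        (Mark-⌈⌉· ℓθ (lookup Ψs) q m₂)

    ℓ₁ r₁ ℓp₁ g₁ d₁ : Term S Var
    ℓ₁  = ℓρ · (var ∘ inj₁)
    r₁  = rhs R ρ · (var ∘ inj₁)
    ℓp₁ = ℓp · (var ∘ inj₁)
    g₁  = ℓθ · (var ∘ inj₂)
    d₁  = rhs R θ · (var ∘ inj₂)

    unifier₁ : ⌈_⌉ R ℓp₁ · Θ₁ ≡ ⌈_⌉ R g₁ · Θ₁
    unifier₁ = trans (⌈⌉-rename ℓp inj₁ Θ₁) (trans M₁.factors (sym (⌈⌉-rename ℓθ inj₂ Θ₁)))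

    unifier₂ : ⌈_⌉ R ℓp₁ · Θ₂ ≡ ⌈_⌉ R g₁ · Θ₂
    unifier₂ = trans (⌈⌉-rename ℓp inj₁ Θ₂) (trans (sym M₂.factors) (sym (⌈⌉-rename ℓθ inj₂ Θ₂)))

    variable-disjoint : ∀ z → Occurs z ℓp₁ → ¬ Occurs z g₁
    variable-disjoint z (_ , q) (_ , q′) with At-rename⁻ {h = inj₁} ℓp q | At-rename⁻ {h = inj₂} ℓθ q′
    ... | x , _ , refl | y , _ , ()

    Lin-ℓp₁ : Lin ℓp₁
    Lin-ℓp₁ = Lin-rename {h = inj₁} {ℓp} (λ { refl → refl }) (Lin-At (linear ρ) fp)

    Lin-g₁ : Lin g₁
    Lin-g₁ = Lin-rename {h = inj₂} {ℓθ} (λ { refl → refl }) (linear θ)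

    abstract
      unified : Unified {W = ℕ} ℓp₁ g₁
      unified = unify ℓp₁ g₁ Lin-ℓp₁ Lin-g₁ variable-disjoint Θ₁ unifier₁

    module U = Unified unified

    ι : Var → ℕ
    ι z = toℕ (join (vars R ρ) (vars R θ) z)

    ι-injective : ∀ {y z} → ι y ≡ ι z → y ≡ z
    ι-injective {y} {z} e = trans (sym (splitAt-join (vars R ρ) (vars R θ) y))
      (trans (cong (splitAt (vars R ρ)) (toℕ-injective e)) (splitAt-join (vars R ρ) (vars R θ) z))

    σ₀ : Var → Term S ℕ
    σ₀ z = U.σ z · (var ∘ ι)

    δ₁ δ₂ : ℕ → Proofterm R ℕ
    δ₁ = extend em ι Θ₁ var
    δ₂ = extend em ι Θ₂ var

    δ-σ₀ : ∀ Θ → ⌈_⌉ R ℓp₁ · Θ ≡ ⌈_⌉ R g₁ · Θ → ∀ z → ⌈_⌉ R (σ₀ z) · extend em ι Θ var ≡ Θ z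
    δ-σ₀ Θ u z = begin
      ⌈_⌉ R (U.σ z · (var ∘ ι)) · extend em ι Θ var ≡⟨ ⌈⌉-rename (U.σ z) ι _ ⟩
      ⌈_⌉ R (U.σ z) · (extend em ι Θ var ∘ ι)       ≡⟨ ·-cong (⌈_⌉ R (U.σ z)) (extend-ι em ι ι-injective Θ var) ⟩
      ⌈_⌉ R (U.σ z) · Θ                             ≡⟨ U.general Θ u z ⟨
      Θ z                                           ∎
      where open ≡-Reasoning

    src-δ : ∀ k → src R (δ₁ k) ≡ src R (δ₂ k)
    src-δ = extend-elim₂ em ι {P = λ Φ Ψ → src R Φ ≡ src R Ψ} {Θ₁} {Θ₂} {var} {var} src-Θ λ _ → refl

    only-δ₁ : ∀ k → Only (Allowed m) (δ₁ k)
    only-δ₁ = extend-elim em ι {P = Only (Allowed m)} only-Θ₁ λ _ → only-var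

    only-δ₂ : ∀ k → Only (Allowed n) (δ₂ k)
    only-δ₂ = extend-elim em ι {P = Only (Allowed n)} only-Θ₂ λ _ → only-var

    disjoint-δ : ∀ k → Disjoint (δ₁ k) (δ₂ k)
    disjoint-δ = extend-elim₂ em ι {P = λ Φ Ψ → Disjoint Φ Ψ} {Θ₁} {Θ₂} {var} {var} disjoint-Θ λ { _ (mark () _) }

    peak-δ : ∀ k → Peak m n (δ₁ k) (δ₂ k)
    peak-δ k = Disjoint⇒Peak _ (δ₁ k) (δ₂ k) ≤-refl (src-δ k) (only-δ₁ k) (only-δ₂ k) (disjoint-δ k)

    abstract
      q : Pos ℓ₁
      q = proj₁ (At-pos (At-· (var ∘ inj₁) fp))

      path-q : path q ≡ p
      path-q = proj₁ (proj₂ (At-pos (At-· (var ∘ inj₁) fp)))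

      ℓ₁∣q : ℓ₁ ∣ q ≡ ℓp₁
      ℓ₁∣q = proj₂ (proj₂ (At-pos (At-· (var ∘ inj₁) fp)))

    -- A unifier `υ` on terms is a solution in proofterms when read as a family of empty multisteps,
    -- so generality over proofterms covers it.
    mgu : MGU σ₀ ℓp₁ g₁
    mgu = record
      { unifies     = trans (sym (·-assoc ℓp₁ U.σ (var ∘ ι))) (trans (cong (_· (var ∘ ι)) U.unifies) (·-assoc g₁ U.σ (var ∘ ι)))
      ; mostGeneral = λ υ e → extend em ι υ var , λ z → begin
          υ z                                   ≡⟨ unfold-⌈⌉ R (lhs R) (υ z) ⟨
          src R (⌈_⌉ R (υ z))                   ≡⟨ cong (src R) (U.general (⌈_⌉ R ∘ υ)
                                                     (trans (sym (⌈⌉-· ℓp₁ υ)) (trans (cong (⌈_⌉ R) e) (⌈⌉-· g₁ υ))) z) ⟩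
          src R (⌈_⌉ R (U.σ z) · (⌈_⌉ R ∘ υ))   ≡⟨ unfold-⌈⌉· (lhs R) (U.σ z) (⌈_⌉ R ∘ υ) ⟩
          U.σ z · (src R ∘ ⌈_⌉ R ∘ υ)           ≡⟨ ·-cong (U.σ z) (λ y →
                                                     trans (unfold-⌈⌉ R (lhs R) (υ y)) (sym (extend-ι em ι ι-injective υ var y))) ⟩
          U.σ z · (extend em ι υ var ∘ ι)       ≡⟨ ·-rename (U.σ z) ι (extend em ι υ var) ⟨
          σ₀ z · extend em ι υ var              ∎
      }
      where open ≡-Reasoning

    fn≢var : ∀ {V : Set} {h us} {x : V} → fn {S} h us ≢ var x
    fn≢var ()

    nonVar-q : ∀ x → ℓ₁ ∣ q ≢ var x
    nonVar-q x e = fn≢var (trans (sym ℓ₁∣q) e)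

    mgu-q : MGU σ₀ (ℓ₁ ∣ q) g₁
    mgu-q = subst (λ t → MGU σ₀ t g₁) (sym ℓ₁∣q) mgu

    o : Overlap R
    o = record { ρ = ρ ; θ = θ ; p = q ; nonVar = nonVar-q ; σ = σ₀ ; mgu = mgu-q }

    open Overlap o using (rootStep; pStep)

    t₀ s₀ u₀ : Term S ℕ
    t₀ = ℓ₁ · σ₀
    s₀ = r₁ · σ₀
    u₀ = replace ℓ₁ q d₁ · σ₀

    redex-instance : ∀ {θ} (h : Fin (vars R θ) → Var) Θ {Φs} → ⌈_⌉ R ℓp₁ · Θ ≡ ⌈_⌉ R g₁ · Θ →
                     (∀ x → Θ (h x) ≡ lookup Φs x) →
                     fn (inj₂ θ) (tabulate (var ∘ h)) · (⌈_⌉ R ∘ σ₀) · extend em ι Θ var ≡ fn (inj₂ θ) Φs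
    redex-instance {θ} h Θ u e = trans (·-assoc (fn (inj₂ θ) (tabulate (var ∘ h))) (⌈_⌉ R ∘ σ₀) (extend em ι Θ var))
      (redex-· θ h _ λ x → trans (δ-σ₀ Θ u (h x)) (e x))

    rootStep-δ : proofterm rootStep · δ₁ ≡ redexΦ
    rootStep-δ = redex-instance inj₁ Θ₁ unifier₁ λ _ → refl

    src-redexΦ-δ : src R redexΦ ≡ t₀ · (src R ∘ δ₁)
    src-redexΦ-δ = trans (cong (src R) (sym rootStep-δ))
      (trans (unfold-· R (lhs R) (proofterm rootStep) δ₁) (cong (_· (src R ∘ δ₁)) (source rootStep)))

    tgt-redexΦ-δ : tgt R redexΦ ≡ s₀ · (tgt R ∘ δ₁)
    tgt-redexΦ-δ = trans (cong (tgt R) (sym rootStep-δ))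
      (trans (unfold-· R (rhs R) (proofterm rootStep) δ₁) (cong (_· (tgt R ∘ δ₁)) (target rootStep)))

    abstract
      A : Context Φ a ρ Φs
      A = toContext linear rΦ

      B : Context Ψ b θ Ψs
      B = toContext linear rΨ

    module A = Context A
    module B = Context B

    q≡root : p ≡ [] → q ≡ root
    q≡root p≡[] = path-root q (trans path-q p≡[])

    Mark-contexts : ∀ {π} → Mark A.context π → Mark B.context π → Mark Φ π × Mark Ψ π × π ≢ b
    Mark-contexts mA mB =
      proj₁ (Mark-context A mA) , proj₁ (Mark-context B mB) , λ { refl → proj₂ (Mark-context B mB) [] (sym (++-identityʳ b)) }

    module Overlay (p≡[] : p ≡ []) where

      b≡a : b ≡ a
      b≡a = trans (cong (a ++_) p≡[]) (++-identityʳ a)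

      src-contexts : src R A.context ≡ src R B.context
      src-contexts = Rep-functional A.hole
        (subst₂ (λ t π → Rep (t · ↑) π (var 0) (src R B.context)) (sym same-src) b≡a B.hole)

      critical : Decreasing m n t₀ s₀ u₀
      critical = overlay {m} {n} o (q≡root p≡[]) allowedρ allowedθ

      pStep-δ : proofterm pStep · δ₂ ≡ redexΨ
      pStep-δ = trans (cong (λ Φ → Φ · (⌈_⌉ R ∘ σ₀) · δ₂) (plug-root q _ (q≡root p≡[])))
        (redex-instance inj₂ Θ₂ unifier₂ λ _ → refl)

      tgt-redexΨ-δ : tgt R redexΨ ≡ u₀ · (tgt R ∘ δ₂)
      tgt-redexΨ-δ = trans (cong (tgt R) (sym pStep-δ))
        (trans (unfold-· R (rhs R) (proofterm pStep) δ₂) (cong (_· (tgt R ∘ δ₂)) (target pStep)))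

      peak-redexes : Peak m n redexΦ redexΨ
      peak-redexes = subst₂ (λ t (s , u) → Decreasing m n t s u) (sym src-redexΦ-δ)
        (cong₂ _,_ (sym tgt-redexΦ-δ) (sym tgt-redexΨ-δ)) (Decreasing-· critical peak-δ)

      resolved : Peak m n Φ Ψ
      resolved = subst₂ (Peak m n) A.filled B.filled
        (Decreasing-proofterm-· A.context B.context
          (ih A.context B.context src-contexts (A.only oΦ) (B.only oΨ) Mark-contexts)
          λ { zero → peak-redexes ; (suc _) → Decreasing-refl })

    module StrictOverlap (p≢[] : p ≢ []) where

      q≢root : q ≢ root
      q≢root q≡ = p≢[] (trans (sym path-q) (cong path q≡))

      critical : R* (below m) t₀ u₀ × ∃ λ w → Conv (below m) t₀ s₀ w × MStep (Allowed m) u₀ w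
      critical = outerInner {m} o q≢root allowedρ

      reach-u₀ : R* (below m) t₀ u₀
      reach-u₀ = proj₁ critical

      w : Term S ℕ
      w = proj₁ (proj₂ critical)

      conv-w : Conv (below m) t₀ s₀ w
      conv-w = proj₁ (proj₂ (proj₂ critical))

      open MStep (proj₂ (proj₂ (proj₂ critical)))
        renaming (multistep to χ; onlyQ to only-χ; src≡ to src-χ; tgt≡ to tgt-χ)

      -- `Y` is the closing multistep combined with what Φ does in the arguments. In `Z` the rule
      -- `θ` has already been applied, while the multisteps in its arguments are still pending.
      Y Z Φ′ Ψ′ : Proofterm R ℕ
      Y  = χ · δ₁
      Z  = ⌈_⌉ R (rhs R θ) · lookup Ψs
      Φ′ = A.context · fill Y
      Ψ′ = B.context · fill Z

      src-Y : src R Y ≡ u₀ · (src R ∘ δ₁)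
      src-Y = trans (unfold-· R (lhs R) χ δ₁) (cong (_· (src R ∘ δ₁)) src-χ)

      tgt-Y : tgt R Y ≡ w · (tgt R ∘ δ₁)
      tgt-Y = trans (unfold-· R (rhs R) χ δ₁) (cong (_· (tgt R ∘ δ₁)) tgt-χ)

      Ψs-δ : ∀ y → ⌈_⌉ R (σ₀ (inj₂ y)) · δ₂ ≡ lookup Ψs y
      Ψs-δ y = δ-σ₀ Θ₂ unifier₂ (inj₂ y)

      Z-δ : ⌈_⌉ R (d₁ · σ₀) · δ₂ ≡ Z
      Z-δ = begin
        ⌈_⌉ R (d₁ · σ₀) · δ₂                       ≡⟨ cong (_· δ₂) (⌈⌉-· d₁ σ₀) ⟩
        ⌈_⌉ R d₁ · (⌈_⌉ R ∘ σ₀) · δ₂               ≡⟨ ·-assoc (⌈_⌉ R d₁) (⌈_⌉ R ∘ σ₀) δ₂ ⟩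
        ⌈_⌉ R d₁ · (λ z → ⌈_⌉ R (σ₀ z) · δ₂)       ≡⟨ ⌈⌉-rename (rhs R θ) inj₂ _ ⟩
        ⌈_⌉ R (rhs R θ) · (λ y → ⌈_⌉ R (σ₀ (inj₂ y)) · δ₂) ≡⟨ ·-cong (⌈_⌉ R (rhs R θ)) Ψs-δ ⟩
        Z                                          ∎
        where open ≡-Reasoning

      src-Z : src R Z ≡ d₁ · σ₀ · (src R ∘ δ₁)
      src-Z = trans (cong (src R) (sym Z-δ)) (trans (unfold-⌈⌉· (lhs R) (d₁ · σ₀) δ₂)
        (·-cong (d₁ · σ₀) λ k → sym (src-δ k)))

      tgt-Z : tgt R Z ≡ tgt R redexΨ
      tgt-Z = trans (unfold-⌈⌉· (rhs R) (rhs R θ) (lookup Ψs)) (sym (unfold-redex (rhs R) θ Ψs))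

      Rep-u₀ : Rep t₀ p (d₁ · σ₀) u₀
      Rep-u₀ = subst (λ π → Rep t₀ π (d₁ · σ₀) u₀) path-q (Rep-· σ₀ (Rep-replace q d₁))

      Rep-Y : Rep (ℓρ · σ) p (src R Z) (src R Y)
      Rep-Y = subst₂ (λ t (u , v) → Rep t p u v) (trans (sym src-redexΦ-δ) src-redexΦ)
        (cong₂ _,_ (sym src-Z) (sym src-Y)) (Rep-· (src R ∘ δ₁) Rep-u₀)

      -- Both sources arise from the common source of Φ and Ψ by putting the source of `Z` at `b`:
      -- for Φ′ because the source of `Y` is the result of the inner step, for Ψ′ directly.
      src′ : src R Φ′ ≡ src R Ψ′
      src′ = Rep-functional (Rep-++ At-a Rep-Y (A.Rep-src Y))
        (subst (λ t → Rep t b (src R Z) (src R Ψ′)) (sym same-src) (B.Rep-src Z))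

      only-Φ′ : Only (Allowed m) Φ′
      only-Φ′ = Only-· (A.only oΦ) λ { zero → Only-· only-χ only-δ₁ ; (suc _) → only-var }

      only-Ψ′ : Only (Allowed n) Ψ′
      only-Ψ′ = Only-· (B.only oΨ) λ { zero → Only-· (Only-⌈⌉ (rhs R θ)) only-Ψs ; (suc _) → only-var }

      tgt-Ψ′ : tgt R Ψ′ ≡ tgt R Ψ
      tgt-Ψ′ = begin
        tgt R Ψ′                                    ≡⟨ unfold-fill (rhs R) B.context Z ⟩
        tgt R B.context · fill (tgt R Z)            ≡⟨ cong (λ t → tgt R B.context · fill t) tgt-Z ⟩
        tgt R B.context · fill (tgt R redexΨ)       ≡⟨ unfold-fill (rhs R) B.context redexΨ ⟨
        tgt R (B.context · fill redexΨ)             ≡⟨ cong (tgt R) B.filled ⟩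
        tgt R Ψ                                     ∎
        where open ≡-Reasoning

      src-Φ : src R A.context · fill (src R redexΦ) ≡ src R Φ
      src-Φ = trans (sym (unfold-fill (lhs R) A.context redexΦ)) (cong (src R) A.filled)

      src-Ψ : src R B.context · fill (src R redexΨ) ≡ src R Ψ
      src-Ψ = trans (sym (unfold-fill (lhs R) B.context redexΨ)) (cong (src R) B.filled)

      tgt-Φ : tgt R A.context · fill (tgt R redexΦ) ≡ tgt R Φ
      tgt-Φ = trans (sym (unfold-fill (rhs R) A.context redexΦ)) (cong (tgt R) A.filled)

      only-redexΦ : Only (Allowed m) redexΦ
      only-redexΦ = rule allowedρ only-Φs

      R*-fill : ∀ k {t s} → R* k t s → ∀ z → R* k (fill t z) (fill s z)
      R*-fill k r zero    = r
      R*-fill k r (suc _) = R*-refl k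

      reach-redexΦ : R* (below m) (src R redexΦ) (tgt R redexΦ)
      reach-redexΦ = Allowed⇒R* m (mstep redexΦ only-redexΦ refl refl)

      conv-redex : Conv (below m) (src R redexΦ) (tgt R redexΦ) (tgt R Y)
      conv-redex = subst₂ (λ t (x , y) → Conv (below m) t x y) (sym src-redexΦ-δ)
        (cong₂ _,_ (sym tgt-redexΦ-δ) (sym tgt-Y))
        (Conv-weaken (below m)
          (R*-·-cong (below m) t₀ λ k → Allowed⇒R* m (mstep (δ₁ k) (only-δ₁ k) refl refl))
          (Conv-· (below m) (tgt R ∘ δ₁) conv-w))

      conv-Φ : Conv (below m) (src R Φ) (tgt R Φ) (tgt R Φ′)
      conv-Φ = subst₂ (λ t (x , y) → Conv (below m) t x y) src-Φ (cong₂ _,_ tgt-Φ (sym (unfold-fill (rhs R) A.context Y)))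
        (Conv-weaken (below m)
          (R*-· (below m) (fill (src R redexΦ)) (Allowed⇒R* m (mstep A.context (A.only oΦ) refl refl)))
          (Conv-·-cong (below m) (tgt R A.context) (R*-fill (below m) reach-redexΦ)
            λ { zero → conv-redex ; (suc _) → ε }))

      -- The remaining peak starts at another term. To refer its conversions back to the source of
      -- Φ, that term must be reachable in the mode of Φ, by the outer-inner condition, and in the
      -- mode of Ψ, by contracting `θ`.
      reach-Φ′ : R* (below m) (src R Φ) (src R Φ′)
      reach-Φ′ = subst₂ (R* (below m)) src-Φ (sym (unfold-fill (lhs R) A.context Y))
        (R*-·-cong (below m) (src R A.context) (R*-fill (below m)
          (subst₂ (R* (below m)) (sym src-redexΦ-δ) (sym src-Y) (R*-· (below m) (src R ∘ δ₁) reach-u₀))))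

      reach-Ψ′ : R* (below n) (src R Φ) (src R Φ′)
      reach-Ψ′ = subst₂ (R* (below n)) (trans src-Ψ (sym same-src)) (trans (sym (unfold-fill (lhs R) B.context Z)) (sym src′))
        (R*-·-cong (below n) (src R B.context) (R*-fill (below n)
          (subst₂ (R* (below n)) (sym src-redexΨ) (sym (unfold-⌈⌉· (lhs R) (rhs R θ) (lookup Ψs)))
            (Allowed⇒R* n (MStep-rule θ allowedθ τ)))))

      -- The marks of the closing multistep outside the contracted inner redex lie
      -- in the pattern of ρ, since the unifier is the identity on the variables
      -- that do not occur in the overlapped subterm.
      Mark-Y-elsewhere : ∀ {π} → Mark Y π → (∀ π′ → π ≢ p ++ π′) → Mark redexΦ π
      Mark-Y-elsewhere {π} m π≱p with Mark-·⁻ χ m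
      ... | beneath {π₁} {π₂} r m′ with Rep-elsewhere-var Rep-u₀ (subst (λ t → At t π₁ _) src-χ r)
      ...   | inj₁ (π′ , refl) = ⊥-elim (π≱p (π′ ++ π₂) (++-assoc p π′ π₂))
      ...   | inj₂ r′ = subst (λ Φ → Mark Φ (π₁ ++ π₂)) rootStep-δ
                (Mark-beneath (proofterm rootStep) δ₁ (subst (λ t → At t π₁ _) (sym (source rootStep)) r′) m′)
      Mark-Y-elsewhere {π} m π≱p | within m′
        with Rep-elsewhere-fun Rep-u₀ (subst (λ t → Fun t π) src-χ (Mark-Fun m′))
      ... | inj₁ (π′ , e) = ⊥-elim (π≱p π′ e)
      ... | inj₂ (h , us , r) with At-·⁻ π ℓρ (subst (λ t → At t π _) (·-rename ℓρ inj₁ σ₀) r)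
      ...   | inside r′ _ = mark here (_ , _ , r′)
      ...   | beneath {π₁} {π₂} {x} r′ r″ with em {Occurs x ℓp}
      ...     | yes (π₃ , r‴) = ⊥-elim (π≱p (π₃ ++ π₂)
                  (trans (cong (_++ π₂) (linear ρ r′ (At-++ fp r‴))) (++-assoc p π₃ π₂)))
      ...     | no ∉ℓp with At-var (subst (λ t → At t π₂ _) (cong (_· (var ∘ ι)) (U.support (inj₁ x) ∉ℓp₁ ∉g₁)) r″)
        where
        ∉ℓp₁ : ¬ Occurs (inj₁ x) ℓp₁
        ∉ℓp₁ (_ , r) with At-rename⁻ {h = inj₁} ℓp r
        ... | _ , r , refl = ∉ℓp (_ , r)
        ∉g₁ : ¬ Occurs (inj₁ x) g₁
        ∉g₁ (_ , r) with At-rename⁻ {h = inj₂} ℓθ r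
        ... | _ , _ , ()
      ...       | _ , ()

      -- Marks of `Z` lie beneath a variable `k` of the contracted instance `d₁ · σ₀`. Marks of `χ`
      -- are at function positions, so there `Y` can only have marks of `δ₁ k`, which are disjoint
      -- from those of `δ₂ k`.
      disjoint-below : ∀ {π} → Mark Y (p ++ π) → ¬ Mark Z π
      disjoint-below {π} mY mZ with Mark-⌈⌉·⁻ (d₁ · σ₀) (subst (λ Φ → Mark Φ π) (sym Z-δ) mZ)
      ... | π₁ , π₂ , k , refl , r , m₂ = go (Mark-·⁻ χ mY) refl
        where
        At-u₀ : At (src R χ) (p ++ π₁) (var k)
        At-u₀ = subst (λ t → At t (p ++ π₁) (var k)) (sym src-χ) (At-++ (Rep-At Rep-u₀) r)
        go : ∀ {ϖ} → MarkSubst χ δ₁ ϖ → ϖ ≢ p ++ π₁ ++ π₂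
        go (within m) refl = let h , us , r′ = Mark-Fun m in
          var-At-prefix (p ++ π₁) At-u₀ (subst (λ π → At (src R χ) π (fn h us)) (sym (++-assoc p π₁ π₂)) r′)
        go (beneath {π₃} {π₄} r′ m₁) e with var-At-unique π₃ (p ++ π₁) r′ At-u₀ (trans e (sym (++-assoc p π₁ π₂)))
        ... | _ , refl , refl = disjoint-δ k m₁ m₂

      Marks′ : ∀ {π} → Mark Φ′ π → Mark Ψ′ π → Mark Φ π × Mark Ψ π × π ≢ b
      Marks′ {π} m₁ m₂ with Mark-fill A Y m₁ | Mark-fill B Z m₂
      ... | inj₁ mA | inj₁ mB = Mark-contexts mA mB
      -- Marks of `Z` are beneath `b`, hence beneath `a`, where the context of Φ has none.
      ... | inj₁ mA | inj₂ (π′ , e , mZ) = ⊥-elim (proj₂ (Mark-context A mA) (p ++ π′) (trans e (++-assoc a p π′)))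
      ... | inj₂ (π′ , refl , mY) | inj₁ mB =
        Mark-++ rΦ (Mark-Y-elsewhere mY λ { π″ refl → proj₂ (Mark-context B mB) π″ (sym (++-assoc a p π″)) }) ,
        proj₁ (Mark-context B mB) , λ e → proj₂ (Mark-context B mB) [] (trans e (sym (++-identityʳ b)))
      ... | inj₂ (π′ , refl , mY) | inj₂ (π″ , e , mZ) =
        ⊥-elim (disjoint-below (subst (Mark Y) (++-cancelˡ a π′ (p ++ π″) (trans e (++-assoc a p π″))) mY) mZ)

      rest : Peak m n Φ′ Ψ′
      rest = ih Φ′ Ψ′ src′ only-Φ′ only-Ψ′ Marks′

      module rest = Decreasing rest

      resolved : Peak m n Φ Ψ
      resolved = record
        { conv₁  = conv-Φ ◅◅ Conv-weaken (below m) reach-Φ′ rest.conv₁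
        ; step₁  = rest.step₁
        ; conv₂  = Conv-weaken (joint (below m) (below n)) (R*-jointˡ (below m) (below n) reach-Φ′) rest.conv₂
        ; step₂  = rest.step₂
        ; conv₃  = subst (λ u → Conv (below n) (src R Φ) u rest.u′) tgt-Ψ′ (Conv-weaken (below n) reach-Ψ′ rest.conv₃)
        ; reach₁ = Allowed⇒R* m (mstep Φ oΦ refl refl)
        ; reach₂ = Allowed⇒R* n (mstep Ψ oΨ (sym same-src) refl)
        }

    resolved : Peak m n Φ Ψ
    resolved with em {p ≡ []}
    ... | yes p≡[] = Overlay.resolved p≡[]
    ... | no p≢[]  = StrictOverlap.resolved p≢[]

  -- The measure of the induction: a finite list containing all shared marks, possibly among other
  -- positions.
  Covered : ℕ → Proofterm R ℕ → Proofterm R ℕ → Set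
  Covered k Φ Ψ = ∃ λ πs → length πs ≤ k × (∀ {π} → Mark Φ π → Mark Ψ π → π ∈ πs)

  mutual
    covered-peak : ∀ k {m n} Φ Ψ → src R Φ ≡ src R Ψ → Only (Allowed m) Φ → Only (Allowed n) Ψ →
           Covered k Φ Ψ → Peak m n Φ Ψ
    covered-peak k {m} {n} Φ Ψ e oΦ oΨ covered with em {∃ (OverlapAt Φ Ψ)}
    ... | no ∄   = Disjoint⇒Peak _ Φ Ψ ≤-refl e oΦ oΨ λ m₁ m₂ → ∄ (Marks⇒OverlapAt m₁ m₂)
    ... | yes ∃π with longest em (OverlapAt Φ Ψ) (size (src R Φ)) bounded ∃π
      where
      bounded : ∀ {π} → OverlapAt Φ Ψ π → length π ≤ size (src R Φ)
      bounded (inj₁ (_ , _ , r , _)) = ≤-trans (m≤m+n _ _) (At-size (Red-src r))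
      bounded {π} (inj₂ (_ , _ , r , _)) =
        ≤-trans (m≤m+n _ _) (At-size (subst (λ t → At t π _) (sym e) (Red-src r)))
    ...   | π , inj₂ (θ , Ψs , r , μ) , deepest = peak-inner k Φ Ψ e oΦ oΨ covered r μ deepest
    ...   | π , inj₁ (ρ , Φs , r , μ) , deepest = subst (λ t → Decreasing m n t (tgt R Φ) (tgt R Ψ)) (sym e)
      (Decreasing-sym (peak-inner k Ψ Φ (sym e) oΨ oΦ
        (let πs , le , c = covered in πs , le , λ m₁ m₂ → c m₂ m₁) r μ λ o → deepest (OverlapAt-sym o)))

    peak-inner : ∀ k {m n} Φ Ψ → src R Φ ≡ src R Ψ → Only (Allowed m) Φ → Only (Allowed n) Ψ →
                 Covered k Φ Ψ → ∀ {π θ Ψs} → Red Ψ π θ Ψs → Mark Φ π →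
                 (∀ {π′} → OverlapAt Φ Ψ π′ → length π′ ≤ length π) → Peak m n Φ Ψ
    peak-inner zero Φ Ψ e oΦ oΨ ([] , le , c) r μ deepest with c μ (Mark-root r)
    ... | ()
    peak-inner (suc k) Φ Ψ e oΦ oΨ (πs , le , c) r m@(mark {a} {p} rΦ (_ , _ , fp)) deepest =
      Deepest.resolved e oΦ oΨ rΦ r fp deepest λ Φ′ Ψ′ e′ oΦ′ oΨ′ marks → covered-peak k Φ′ Ψ′ e′ oΦ′ oΨ′
        -- The redex of Ψ at `b` and the pattern of Φ around it make `b` itself a shared mark, so it
        -- is in the list and its removal shortens the list.
        ( filter ≢b? πs
        , s≤s⁻¹ (≤-trans (filter-notAll ≢b? πs (Any.map (λ b≡π b≢π → b≢π (sym b≡π)) (c m (Mark-root r)))) le)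
        , λ m₁ m₂ → let m₁′ , m₂′ , π≢b = marks m₁ m₂ in ∈-filter⁺ ≢b? (c m₁′ m₂′) π≢b )
      where
      ≢b? : ∀ π → Dec (π ≢ a ++ p)
      ≢b? π = em

  multistep-peak : ∀ {m n} Φ Ψ → src R Φ ≡ src R Ψ → Only (Allowed m) Φ → Only (Allowed n) Ψ → Peak m n Φ Ψ
  multistep-peak Φ Ψ e oΦ oΨ = let πs , c = paths-finite (src R Φ) in
    covered-peak (length πs) Φ Ψ e oΦ oΨ (πs , ≤-refl , λ m₁ _ → c (proj₂ (proj₂ (Mark-Fun m₁))))

-- Critical peaks

[l]↭Z++X : ∀ {A : Set} {l : A} Z {X} → l ∷ [] ↭ Z ++ X → X ≢ [] → Z ≡ []
[l]↭Z++X []      p X≢[] = refl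
[l]↭Z++X (z ∷ Z) {[]}    p X≢[] = ⊥-elim (X≢[] refl)
[l]↭Z++X (z ∷ []) {x ∷ X} p X≢[] with ↭-length p
... | ()
[l]↭Z++X (z ∷ z′ ∷ Z) {x ∷ X} p X≢[] with ↭-length p
... | ()

-- The part removed from a singleton is nonempty, hence everything. Nothing is kept, and all of `M`
-- is dominated by `l`.
MultisetExtension-singleton : ∀ {L : Set} {_≻_ : L → L → Set} {l M} → MultisetExtension _≻_ (l ∷ []) M →
                              ∀ {y} → y ∈ M → l ≻ y
MultisetExtension-singleton (X , Y , Z , p , q , X≢[] , h) y∈M with [l]↭Z++X Z p X≢[]
... | refl with h (∈-resp-↭ q y∈M)
...   | x , x∈X , x≻y with ∈-resp-↭ (↭-sym p) x∈X
...     | here refl = x≻y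

module HotLabels (em : ExcludedMiddle 0ℓ) {S : Signature} (R : TRS S) (labelling : RuleLabelling R) where

  open Proofterms R
  open Unification em R
  open Peaks em R labelling
  open RuleLabelling labelling
  open Hot labelling
  open Rank em _⊏_

  RuleIn⇒ : ∀ {V} {Q ρ} {Φ : Proofterm R V} → Only Q Φ → RuleIn R ρ Φ → Q ρ
  RuleIn⇒ o (p , Φs , e) with At-Only o (subst (At _ (path p)) e (path-At p))
  ... | rule q _ = q

  ⇒Only : ∀ {V} {Q} {Φ : Proofterm R V} → (∀ ρ → RuleIn R ρ Φ → Q ρ) → Only Q Φ
  ⇒Only {V} {Q} {Φ} = term-induction (λ Φ → (∀ ρ → RuleIn R ρ Φ → Q ρ) → Only Q Φ) (λ _ _ → only-var)
    (λ { (inj₁ f) Φs ih h → fun λ i → ih i λ ρ (p , Ψs , e) → h ρ (arg i p , Ψs , e)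
       ; (inj₂ θ) Φs ih h → rule (h θ (root , Φs , refl)) λ i → ih i λ ρ (p , Ψs , e) → h ρ (arg i p , Ψs , e) }) Φ

  C⇒Allowed : ∀ m {ρ} → C ρ → Allowed m ρ
  C⇒Allowed cold    c = c
  C⇒Allowed (hot a) c = λ ρ∉C → ⊥-elim (ρ∉C c)

  -- O Q says that some collection of rules satisfies Q.
  Monotone : ((Rule R → Set) → Set) → Set₁
  Monotone O = ∀ {P Q} → (∀ {ρ} → P ρ → Q ρ) → O P → O Q

  -- The rule ρ attains the maximal rank among the labels of these rules.
  data Heaviest (P : Rule R → Set) (O : (Rule R → Set) → Set) : Set where
    all-C    : O C → Heaviest P O
    heaviest : ∀ ρ (ρ∉C : ¬ C ρ) → P ρ → O (Allowed (hot (label ρ ρ∉C))) → Heaviest P O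

  Heaviest-map : ∀ {P O O′} → (∀ {Q} → O Q → O′ Q) → Heaviest P O → Heaviest P O′
  Heaviest-map h (all-C o)            = all-C (h o)
  Heaviest-map h (heaviest ρ ρ∉C p o) = heaviest ρ ρ∉C p (h o)

  Heaviest-× : ∀ {P O O′} → Monotone O → Monotone O′ →
               Heaviest P O → Heaviest P O′ → Heaviest P (λ Q → O Q × O′ Q)
  Heaviest-× mono mono′ (all-C o) (all-C o′) = all-C (o , o′)
  Heaviest-× mono mono′ (all-C o) (heaviest ρ ρ∉C p o′) = heaviest ρ ρ∉C p (mono (C⇒Allowed (hot (label ρ ρ∉C))) o , o′)
  Heaviest-× mono mono′ (heaviest ρ ρ∉C p o) (all-C o′) = heaviest ρ ρ∉C p (o , mono′ (C⇒Allowed (hot (label ρ ρ∉C))) o′)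
  Heaviest-× mono mono′ (heaviest ρ ρ∉C p o) (heaviest θ θ∉C q o′)
    with ≼⊎≺ ⊏-wellFounded (inj₂ (label ρ ρ∉C)) (inj₂ (label θ θ∉C))
  ... | inj₁ ρ≼θ = heaviest θ θ∉C q (mono (λ h n → ≼-trans (h n) ρ≼θ) o , o′)
  ... | inj₂ θ≺ρ = heaviest ρ ρ∉C p (o , mono′ (λ h n → ≼-trans (h n) (≺⇒≼ ⊏-wellFounded θ≺ρ)) o′)

  Heaviest-vec : ∀ {n} {V : Set} {P} (Φs : Vec (Proofterm R V) n) → (∀ i → Heaviest P (λ Q → Only Q (lookup Φs i))) →
                 Heaviest P (λ Q → ∀ i → Only Q (lookup Φs i))
  Heaviest-vec []       h = all-C λ ()
  Heaviest-vec (Φ ∷ Φs) h = Heaviest-map (λ { (o , os) zero → o ; (o , os) (suc i) → os i })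
    (Heaviest-× Only-map (λ p os i → Only-map p (os i)) (h zero) (Heaviest-vec Φs (h ∘ suc)))

  Heaviest-rule : ∀ {P ρ} → P ρ → Heaviest P (λ Q → Q ρ)
  Heaviest-rule {ρ = ρ} p with em {C ρ}
  ... | yes c   = all-C c
  ... | no ρ∉C  = heaviest ρ ρ∉C p λ _ → ≼-refl ⊏-wellFounded

  find-heaviest : ∀ {V : Set} {P} {Φ : Proofterm R V} → Only P Φ → Heaviest P (λ Q → Only Q Φ)
  find-heaviest only-var               = all-C only-var
  find-heaviest (fun {Φs = Φs} os)     = Heaviest-map fun (Heaviest-vec Φs (λ i → find-heaviest (os i)))
  find-heaviest (rule {θ} {Φs} q os) = Heaviest-map (λ (q , os) → rule q os)
    (Heaviest-× {O = λ Q → Q θ} (λ h → h) (λ p os i → Only-map p (os i)) (Heaviest-rule q) (Heaviest-vec Φs (λ i → find-heaviest (os i))))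

  inj₂-≺ : ∀ {a b} → a ≻ b → _≺_ (inj₂ b) (inj₂ a)
  inj₂-≺ a≻b = <⇒≺ ⊏-wellFounded (labels a≻b)

  toMStep : ∀ {Q t s} (Φ : Multistep R t s) → Only Q (proofterm Φ) → MStep Q t s
  toMStep Φ o = mstep (proofterm Φ) o (source Φ) (target Φ)

  HasLabel-term : ∀ {t u s} {Φ : Multistep R t s} → Φ HasLabel term u → u ≡ t × MStep C t s
  HasLabel-term {Φ = Φ} (term onlyC) = refl , toMStep Φ (⇒Only onlyC)

  -- A label of greatest rank is also `≻`-maximal, because `≻` strictly increases rank. It therefore
  -- belongs to `M` and alone bounds the whole multistep.
  HasLabel-set : ∀ {t s M} {Φ : Multistep R t s} → Φ HasLabel set M →
                 ∃ λ a → a ∈ M × MStep (Allowed (hot a)) t s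
  HasLabel-set {Φ = Φ} (set notC _ maximal) with find-heaviest (⇒Only {Q = λ ρ → RuleIn R ρ (proofterm Φ)} λ ρ r → r)
  ... | all-C o = ⊥-elim (notC λ ρ r → RuleIn⇒ o r)
  ... | heaviest ρ ρ∉C r o = _ , Equivalence.from (maximal _) ((ρ , ρ∉C , r , refl) , isMaximal) , toMStep Φ o
    where
    isMaximal : ∀ {b} → LabelIn Φ b → ¬ b ≻ label ρ ρ∉C
    isMaximal (θ , θ∉C , r , refl) b≻ = inj₂-≺ b≻ (RuleIn⇒ o r θ∉C)

  data StepLabel (t : Term S ℕ) (ρ : Rule R) : HotLabel → Set where
    cold : C ρ → StepLabel t ρ (term t)
    hot  : (ρ∉C : ¬ C ρ) → StepLabel t ρ (set (label ρ ρ∉C ∷ []))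

  single-step : ∀ {t s ρ} (Φ : Multistep R t s) → RuleIn R ρ (proofterm Φ) → Only (_≡ ρ) (proofterm Φ) →
                ∃ λ α → Φ HasLabel α × StepLabel t ρ α
  single-step {t} {ρ = ρ} Φ r o with em {C ρ}
  ... | yes c  = _ , term (λ θ r′ → subst C (sym (RuleIn⇒ o r′)) c) , cold c
  ... | no ρ∉C = _ , set (λ onlyC → ρ∉C (onlyC ρ r)) ([] ∷ []) (λ a → mk⇔ to from) , hot ρ∉C
    where
    same-label : ∀ {θ} (θ∉C : ¬ C θ) → θ ≡ ρ → label θ θ∉C ≡ label ρ ρ∉C
    same-label θ∉C refl = refl
    to : ∀ {a} → a ∈ label ρ ρ∉C ∷ [] → MaximalLabelIn Φ a
    to (here refl) = (ρ , ρ∉C , r , refl) , λ { (θ , θ∉C , r′ , refl) →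
      IsStrictPartialOrder.irrefl isStrictPartialOrder (same-label θ∉C (RuleIn⇒ o r′)) }
    from : ∀ {a} → MaximalLabelIn Φ a → a ∈ label ρ ρ∉C ∷ []
    from ((θ , θ∉C , r′ , e) , _) with RuleIn⇒ o r′
    ... | refl = here e

  hot-below : ∀ {a b ρ} → _≺_ (inj₂ b) (inj₂ a) → Allowed (hot b) ρ → class (below (hot a)) ρ
  hot-below b≺a h ρ∉C = ≼-≺-trans ⊏-wellFounded (h ρ∉C) b≺a

  -- The label of a single step is a term or a singleton. A smaller set has a member bounding its
  -- multistep, and the rank of that member is strictly below that of the singleton and so below the
  -- mode.
  step-below : ∀ {t ρ α β x y} m → StepLabel t ρ α → Allowed m ρ → α ≻° β → Labelled β x y → Below (below m) t x y
  step-below cold    (cold c)  _ (term r) (χ , h) with HasLabel-term h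
  ... | refl , s = r , s
  step-below (hot a) (cold c)  _ (term r) (χ , h) = _ , MStep-map (C⇒class (hot a)) (proj₂ (HasLabel-term h))
  step-below cold    (hot ρ∉C) c _ _ = ⊥-elim (ρ∉C c)
  step-below (hot a) (hot ρ∉C) q set≻term (χ , h) = _ , MStep-map (C⇒class (hot a)) (proj₂ (HasLabel-term h))
  step-below (hot a) (hot ρ∉C) q (set l≻M) (χ , h) = let b , b∈M , s = HasLabel-set h in
    _ , MStep-map (hot-below (≺-≼-trans ⊏-wellFounded (inj₂-≺ (MultisetExtension-singleton l≻M b∈M)) (q ρ∉C))) s

  step-equal : ∀ {t ρ α x y} m → StepLabel t ρ α → Allowed m ρ → Labelled α x y → MStep (Allowed m) x y
  step-equal m       (cold c)  _ (χ , h) = MStep-map (C⇒Allowed m) (proj₂ (HasLabel-term h))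
  step-equal cold    (hot ρ∉C) c _       = ⊥-elim (ρ∉C c)
  step-equal (hot a) (hot ρ∉C) q (χ , h) with HasLabel-set h
  ... | _ , here refl , s = MStep-map (λ h n → ≼-trans (h n) (q ρ∉C)) s

  reflexive-step : ∀ {t ρ α x y} m → StepLabel t ρ α → Allowed m ρ → ReflClosure (Labelled α) x y → MStep (Allowed m) x y
  reflexive-step m l q Refl.refl = MStep-refl
  reflexive-step m l q Refl.[ s ] = step-equal m l q s

  Conversion⇒Conv : ∀ {t ρ α x y} m → StepLabel t ρ α → Allowed m ρ → Conversion (↓ α) x y → Conv (below m) t x y
  Conversion⇒Conv m l q = Eq.map λ (β , α≻β , s) → step-below m l q α≻β s

  Below-jointˡ : ∀ k k′ {t x y} → (∀ {ρ} → C ρ → class k′ ρ) → Below k t x y → Below (joint k k′) t x y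
  Below-jointˡ cold    cold    h b       = b
  Below-jointˡ cold    (hot Q) h (r , s) = _ , MStep-map h s
  Below-jointˡ (hot P) cold    h (r , s) = _ , s
  Below-jointˡ (hot P) (hot Q) h (r , s) = _ , MStep-map inj₁ s

  Below-jointʳ : ∀ k k′ {t x y} → (∀ {ρ} → C ρ → class k ρ) → Below k′ t x y → Below (joint k k′) t x y
  Below-jointʳ cold    k′      h b       = b
  Below-jointʳ (hot P) cold    h (r , s) = _ , MStep-map h s
  Below-jointʳ (hot P) (hot Q) h (r , s) = _ , MStep-map inj₂ s

  DecreasingConversion⇒Decreasing : ∀ {t ρ θ α β s u} m n → StepLabel t ρ α → StepLabel t θ β → Allowed m ρ → Allowed n θ →
    R* (below m) t s → R* (below n) t u → DecreasingConversion α β s u → Decreasing m n t s u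
  DecreasingConversion⇒Decreasing m n l l′ q q′ r r′ (_ , c₁ , _ , s₁ , _ , c₂ , _ , s₂ , c₃) = record
    { conv₁  = Conversion⇒Conv m l q c₁
    ; step₁  = reflexive-step n l′ q′ s₁
    ; conv₂  = Eq.map (λ { (β , inj₁ ≻β , s) → Below-jointˡ (below m) (below n) (C⇒class n) (step-below m l q ≻β s)
                         ; (β , inj₂ ≻β , s) → Below-jointʳ (below m) (below n) (C⇒class m) (step-below n l′ q′ ≻β s) }) c₂
    ; step₂  = reflexive-step m l q s₂
    ; conv₃  = Conv-sym (below n) (Conversion⇒Conv n l′ q′ c₃)
    ; reach₁ = r
    ; reach₂ = r′
    }

  -- For a rule in `C`, `β` must be a term, namely the source `x` of the multistep, and `α ⪰° β`
  -- says that `x` is reachable from `t` by `C`-steps. For cold modes this gives the reachability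
  -- claim.
  step-atMost : ∀ {t ρ α β x y} m → StepLabel t ρ α → Allowed m ρ → α ⪰° β → Labelled β x y →
                R* (below m) t x × MStep (Allowed m) x y
  step-atMost cold    (cold c)  _ (inj₁ (term r))    (χ , h) with HasLabel-term h
  ... | refl , s = ⁺⇒* r , s
  step-atMost cold    (cold c)  _ (inj₂ (term refl)) (χ , h) with HasLabel-term h
  ... | refl , s = ε , s
  step-atMost (hot a) (cold c)  _ (inj₁ (term r))    (χ , h) = _ , MStep-map (C⇒Allowed (hot a)) (proj₂ (HasLabel-term h))
  step-atMost (hot a) (cold c)  _ (inj₂ (term e))    (χ , h) = _ , MStep-map (C⇒Allowed (hot a)) (proj₂ (HasLabel-term h))
  step-atMost cold    (hot ρ∉C) c _ _ = ⊥-elim (ρ∉C c)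
  step-atMost (hot a) l@(hot _) q (inj₁ α≻β) s =
    _ , MStep-map (λ h n → ≺⇒≼ ⊏-wellFounded (h n)) (proj₂ (step-below (hot a) l q α≻β s))
  step-atMost (hot a) (hot ρ∉C) q (inj₂ (set l↭M)) (χ , h) with HasLabel-set h
  ... | b , b∈M , s with ∈-resp-↭ (↭-sym l↭M) b∈M
  ...   | here refl = _ , MStep-map (λ h n → ≼-trans (h n) (q ρ∉C)) s

  module _ (o : Overlap R) where

    open Overlap o

    private
      ⌈σ⌉ = ⌈_⌉ R ∘ σ

    rule-instance : ∀ {V W : Set} {θ} (h : Fin (vars R θ) → V) (δ : V → Proofterm R W) → (∀ z → Only (_≡ θ) (δ z)) →
                    Only (_≡ θ) (fn (inj₂ θ) (tabulate (var ∘ h)) · δ)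
    rule-instance h δ o = Only-· (rule refl λ x → subst (Only _) (sym (lookup∘tabulate (var ∘ h) x)) only-var) o

    Only-plug : ∀ {V Q} {t : Term S V} (p : Pos t) {Φ} → Only Q Φ → Only Q (plug R t p Φ)
    Only-plug root o = o
    Only-plug (arg {ts = ts} i p) o = fun (Only-update (⌈_⌉* R ts) i
      (λ j → subst (Only _) (sym (lookup-⌈⌉* ts j)) (Only-⌈⌉ (lookup ts j))) (Only-plug p o))

    At-plug : ∀ {V} {t : Term S V} (p : Pos t) Φ → At (plug R t p Φ) (path p) Φ
    At-plug root Φ = []
    At-plug (arg {ts = ts} i p) Φ =
      arg i refl (subst (λ Ψ → At Ψ (path p) Φ) (sym (lookup∘update i (⌈_⌉* R ts) _)) (At-plug p Φ))

    root-label : ∃ λ α → rootStep HasLabel α × StepLabel (ℓ · σ) ρ α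
    root-label = single-step rootStep (root , _ , refl) (rule-instance inj₁ ⌈σ⌉ λ z → Only-⌈⌉ (σ z))

    p-label : ∃ λ α → pStep HasLabel α × StepLabel (ℓ · σ) θ α
    p-label = single-step pStep (let q , _ , e = At-pos (At-· ⌈σ⌉ (At-plug p θ⟨y⟩)) in q , _ , e) only-θ
      where
      only-θ : Only (_≡ θ) (plug R ℓ p θ⟨y⟩ · ⌈σ⌉)
      only-θ = Only-· (Only-plug p (rule refl λ x → subst (Only _) (sym (lookup∘tabulate (var ∘ inj₂) x)) only-var))
        λ z → Only-⌈⌉ (σ z)

    root-MStep : ∀ m → Allowed m ρ → MStep (Allowed m) (ℓ · σ) (r · σ)
    root-MStep m q = subst₂ (MStep (Allowed m)) (sym (·-assoc (lhs R ρ) (var ∘ inj₁) σ)) (sym (·-assoc (rhs R ρ) (var ∘ inj₁) σ))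
      (MStep-rule ρ q (σ ∘ inj₁))

    p-MStep : ∀ n → Allowed n θ → MStep (Allowed n) (ℓ · σ) (replace ℓ p d · σ)
    p-MStep n q = toMStep pStep (Only-· (Only-plug p (rule q λ x →
      subst (Only _) (sym (lookup∘tabulate (var ∘ inj₂) x)) only-var)) λ z → Only-⌈⌉ (σ z))

    critical-decreasing : AllCriticalPeaksDecreasing → ∀ m n → Allowed m ρ → Allowed n θ →
                          Decreasing m n (ℓ · σ) (r · σ) (replace ℓ p d · σ)
    critical-decreasing dec m n q q′ =
      let α , h , l   = root-label
          β , h′ , l′ = p-label
      in DecreasingConversion⇒Decreasing m n l l′ q q′ (Allowed⇒R* m (root-MStep m q)) (Allowed⇒R* n (p-MStep n q′))
           (dec (peak o) α β h h′)

    outer-inner-conversion : OuterInnerCondition → p ≢ root → ∀ m → Allowed m ρ →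
      R* (below m) (ℓ · σ) (replace ℓ p d · σ) ×
      ∃ λ w → Conv (below m) (ℓ · σ) (r · σ) w × MStep (Allowed m) (replace ℓ p d · σ) w
    outer-inner-conversion oi p≢root m q =
      let α , h , l = root-label
          w , c , γ , α⪰γ , s = oi (outer-inner o p≢root) α h
          reach , s′ = step-atMost m l q α⪰γ s
      in reach , w , Conversion⇒Conv m l q c , s′

-- Confluence by decreasing diagrams

module Confluence (em : ExcludedMiddle 0ℓ) {S : Signature} (R : TRS S) (leftLinear : LeftLinear R)
                  (hd : HotDecreasing R) where

  open HotDecreasing hd
  open RuleLabelling labelling using (C; L; label)
  open Proofterms R
  open Peaks em R labelling
  open HotLabels em R labelling
  open Rank em _⊏_
  open OverlapResolution em R labelling (Linear⇒Lin ∘ leftLinear)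
    (λ {m} {n} o _ → critical-decreasing o decreasing m n)
    (λ {m} o p≢root → outer-inner-conversion o outerInnerCondition p≢root m)
  private
    module DD = DecreasingDiagrams em _⊏_ ⊏-wellFounded
    open DD using (Word; fw; bw; lab; none; some)

    T : Set
    T = Term S ℕ

    Λ : Set
    Λ = T ⊎ L

  -- A label from `L` is only an upper bound, so one multistep may carry several labels. This is
  -- harmless, since peaks are shown decreasing for every choice of labels.
  Labelled : Λ → Rel T 0ℓ
  Labelled (inj₁ t) x y = x ≡ t × MStep C x y
  Labelled (inj₂ a) x y = MStep (Allowed (hot a)) x y

  open DD.Conversions Labelled

  Conversion-All : (Λ → Set) → Rel T 0ℓ
  Conversion-All P x y = ∃ λ w → All (P ∘ lab) w × Conversion w x y

  labelled : ∀ {P t s} → MStep P t s → Labelled (inj₁ t) t s ⊎ ∃ λ ρ → Σ (¬ C ρ) λ ρ∉C → P ρ × Labelled (inj₂ (label ρ ρ∉C)) t s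
  labelled (mstep Φ o e e′) with find-heaviest o
  ... | all-C o′            = inj₁ (refl , mstep Φ o′ e e′)
  ... | heaviest ρ ρ∉C p o′ = inj₂ (ρ , ρ∉C , p , mstep Φ o′ e e′)

  Conv⇒Conversion : ∀ {P : Λ → Set} k {t} → (∀ {x y} → Below k t x y → ∃ λ α → P α × Labelled α x y) →
                    ∀ {x y} → Conv k t x y → Conversion-All P x y
  Conv⇒Conversion k h ε           = [] , [] , []
  Conv⇒Conversion k h (fwd b ◅ c) = let α , p , s = h b ; w , ps , d = Conv⇒Conversion k h c in fw α ∷ w , p ∷ ps , s ∷ d
  Conv⇒Conversion k h (bwd b ◅ c) = let α , p , s = h b ; w , ps , d = Conv⇒Conversion k h c in bw α ∷ w , p ∷ ps , s ∷⁻ d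

  modeLabel : Mode → T → Λ
  modeLabel cold    t = inj₁ t
  modeLabel (hot a) t = inj₂ a

  term≺ : ∀ {t a} → inj₁ t ≺ inj₂ a
  term≺ = <⇒≺ ⊏-wellFounded term⊏label

  Below⇒Labelled : ∀ m {t x y} → Below (below m) t x y → ∃ λ α → α ≺ modeLabel m t × Labelled α x y
  Below⇒Labelled cold    (r , s) = _ , <⇒≺ ⊏-wellFounded (terms r) , refl , s
  Below⇒Labelled (hot a) (r , s) with labelled s
  ... | inj₁ s′                 = _ , term≺ , s′
  ... | inj₂ (ρ , ρ∉C , p , s′) = _ , p ρ∉C , s′

  Below-joint⇒Labelled : ∀ m n {t x y} → Below (joint (below m) (below n)) t x y →
                         ∃ λ α → (α ≺ modeLabel m t ⊎ α ≺ modeLabel n t) × Labelled α x y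
  Below-joint⇒Labelled cold    n    {t} b = let α , p , s = Below⇒Labelled n {t} b in α , inj₂ p , s
  Below-joint⇒Labelled (hot a) cold {t} b = let α , p , s = Below⇒Labelled (hot a) {t} b in α , inj₁ p , s
  Below-joint⇒Labelled (hot a) (hot b) (r , s) with labelled s
  ... | inj₁ s′                 = _ , inj₁ term≺ , s′
  ... | inj₂ (ρ , ρ∉C , p , s′) = _ , Sum.map (λ h → h ρ∉C) (λ h → h ρ∉C) p , s′

  -- A single step in cold mode has the label of the peak only if its source is still `t`. Otherwise
  -- its label is smaller and the step is absorbed by the adjacent conversion `conv₁` or `conv₃`.
  Decreasing⇒word : ∀ m n {t s u} → Decreasing m n t s u →
                    ∃ λ w → DD.Decreasing (modeLabel m t) (modeLabel n t) w × Conversion w s u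
  Decreasing⇒word m n {t} d = go m n d
    (Conv⇒Conversion (below m) (Below⇒Labelled m) (Decreasing.conv₁ d))
    (Conv⇒Conversion (joint (below m) (below n)) (Below-joint⇒Labelled m n) (Decreasing.conv₂ d))
    (Conv⇒Conversion (below n) (Below⇒Labelled n) (Conv-sym (below n) (Decreasing.conv₃ d)))
    where
    go : ∀ m n {t s u} (d : Decreasing m n t s u) →
         Conversion-All (_≺ modeLabel m t) s (Decreasing.s′ d) →
         Conversion-All (λ α → α ≺ modeLabel m t ⊎ α ≺ modeLabel n t) (Decreasing.v d) (Decreasing.w d) →
         Conversion-All (_≺ modeLabel n t) (Decreasing.u′ d) u →
         ∃ λ w → DD.Decreasing (modeLabel m t) (modeLabel n t) w × Conversion w s u
    go cold cold d (w₁ , a₁ , c₁) (w₂ , a₂ , c₂) (w₃ , a₃ , c₃)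
      with *⇒≡⊎⁺ (Decreasing.reach-s′ d) | *⇒≡⊎⁺ (Decreasing.reach-u′ d)
    ... | inj₁ refl | inj₁ refl = _ , DD.decreasing a₁ some a₂ some a₃ ,
      c₁ ◅◅ᶜ (refl , Decreasing.step₁ d) ∷ (c₂ ◅◅ᶜ (refl , Decreasing.step₂ d) ∷⁻ c₃)
    ... | inj₁ refl | inj₂ r    = _ , DD.decreasing a₁ some a₂ none (<⇒≺ ⊏-wellFounded (terms r) ∷ a₃) ,
      c₁ ◅◅ᶜ (refl , Decreasing.step₁ d) ∷ (c₂ ◅◅ᶜ (refl , Decreasing.step₂ d) ∷⁻ c₃)
    ... | inj₂ r | inj₁ refl    = _ , DD.decreasing (++⁺ a₁ (<⇒≺ ⊏-wellFounded (terms r) ∷ [])) none a₂ some a₃ ,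
      (c₁ ◅◅ᶜ (refl , Decreasing.step₁ d) ∷ []) ◅◅ᶜ (c₂ ◅◅ᶜ (refl , Decreasing.step₂ d) ∷⁻ c₃)
    ... | inj₂ r | inj₂ r′      = _ , DD.decreasing (++⁺ a₁ (<⇒≺ ⊏-wellFounded (terms r) ∷ [])) none a₂ none (<⇒≺ ⊏-wellFounded (terms r′) ∷ a₃) ,
      (c₁ ◅◅ᶜ (refl , Decreasing.step₁ d) ∷ []) ◅◅ᶜ (c₂ ◅◅ᶜ (refl , Decreasing.step₂ d) ∷⁻ c₃)
    -- A step by `C`-rules only has a term label, which is below `hot b`; so `step₂` joins `conv₃`.
    go cold (hot b) d (w₁ , a₁ , c₁) (w₂ , a₂ , c₂) (w₃ , a₃ , c₃) = _ , DD.decreasing a₁ some a₂ none (term≺ ∷ a₃) ,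
      c₁ ◅◅ᶜ Decreasing.step₁ d ∷ (c₂ ◅◅ᶜ (refl , Decreasing.step₂ d) ∷⁻ c₃)
    go (hot a) cold d (w₁ , a₁ , c₁) (w₂ , a₂ , c₂) (w₃ , a₃ , c₃) = _ , DD.decreasing (++⁺ a₁ (term≺ ∷ [])) none a₂ some a₃ ,
      (c₁ ◅◅ᶜ (refl , Decreasing.step₁ d) ∷ []) ◅◅ᶜ (c₂ ◅◅ᶜ Decreasing.step₂ d ∷⁻ c₃)
    go (hot a) (hot b) d (w₁ , a₁ , c₁) (w₂ , a₂ , c₂) (w₃ , a₃ , c₃) = _ , DD.decreasing a₁ some a₂ some a₃ ,
      c₁ ◅◅ᶜ Decreasing.step₁ d ∷ (c₂ ◅◅ᶜ Decreasing.step₂ d ∷⁻ c₃)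

  toMode : ∀ α {x y} → Labelled α x y → ∃ λ m → modeLabel m x ≡ α × MStep (Allowed m) x y
  toMode (inj₁ t) (refl , s) = cold , refl , s
  toMode (inj₂ a) s          = hot a , refl , s

  locallyDecreasing : LocallyDecreasing
  locallyDecreasing {α} {β} s s′ with toMode α s | toMode β s′
  ... | m , refl , mstep Φ o refl refl | n , refl , mstep Ψ o′ e refl =
    Decreasing⇒word m n (multistep-peak Φ Ψ (sym e) o o′)

  Step⇒MStep : ∀ {t s} → Step R t s → MStep (λ _ → ⊤) t s
  Step⇒MStep (contract ρ σ)     = MStep-rule ρ tt σ
  Step⇒MStep (inside f ts i {u} s) = subst (λ us → MStep (λ _ → ⊤) (fn f us) (fn f (ts [ i ]≔ u))) ([]≔-lookup ts i) (MStep-arg f ts i (Step⇒MStep s))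

  Step⇒Labelled : ∀ {t s} → Step R t s → ∃ λ α → Labelled α t s
  Step⇒Labelled s with labelled (Step⇒MStep s)
  ... | inj₁ s′               = _ , s′
  ... | inj₂ (_ , _ , _ , s′) = _ , s′

  MStep⇒Star : ∀ {Q t s} → MStep Q t s → Star (Step R) t s
  MStep⇒Star (mstep Φ o refl refl) = Only⇒Star R R (λ _ σ → contract _ σ) o

  Labelled⇒Star : ∀ {t s} → ∃ (λ α → Labelled α t s) → Star (Step R) t s
  Labelled⇒Star (inj₁ _ , _ , s) = MStep⇒Star s
  Labelled⇒Star (inj₂ _ , s)     = MStep⇒Star s

  Star⇒Conversion : ∀ {t s} → Star (Step R) t s → ∃ λ w → Conversion w t s
  Star⇒Conversion ε        = _ , []
  Star⇒Conversion (s ◅ ss) = let _ , s′ = Step⇒Labelled s ; _ , c = Star⇒Conversion ss in _ , s′ ∷ c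

  Star⇒Conversion⁻ : ∀ {t s u w} → Star (Step R) t s → Conversion w t u → ∃ λ w′ → Conversion w′ s u
  Star⇒Conversion⁻ ε        c = _ , c
  Star⇒Conversion⁻ (s ◅ ss) c = let _ , s′ = Step⇒Labelled s in Star⇒Conversion⁻ ss (s′ ∷⁻ c)

  confluent : Confluent (Step R)
  confluent p q =
    let _ , c = Star⇒Conversion q
        _ , d = Star⇒Conversion⁻ p c
        u , p′ , q′ = churchRosser locallyDecreasing d
    in u , Star.kleisliStar id Labelled⇒Star p′ , Star.kleisliStar id Labelled⇒Star q′

theorem2 : ExcludedMiddle 0ℓ → (S : Signature) (R : TRS S) →
    LeftLinear R → HotDecreasing R → Confluent (Step R)
theorem2 em S R leftLinear hd = Confluence.confluent em R leftLinear hd
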